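{- For every even integer $d>2$ there exists a positive integer $N(d)$ such that for every $n\ge N(d)$, every optimal binary $(n,M,\{d,d+2\})$-code $C$ is isomorphic to a constant-weight code of weight $\frac{d}{2}+1$; that is, there is a vector $y\in\{0,1\}^n$ such that every word of $C+y=\{x+y: x\in C\}$ has Hamming weight exactly $\frac{d}{2}+1$.
   Context: A binary code of length $n$ is a subset $C\subseteq\{0,1\}^n$, with Hamming distance $d(\cdot,\cdot)$ and addition modulo 2. $C$ is an $(n,M,\{d_1,d_2\})$-code if $|C|=M$ and $\{d(u,v): u,v\in C,\ u\ne v\}=\{d_1,d_2\}$. $A_2(n,\{d_1,d_2\})$ is the maximum size of such a code; a code is optimal if $|C|=A_2(n,\{d_1,d_2\})$. Isomorphism here means the code is obtained by a translation $x\mapsto x+y$ (which preserves all distances). -}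

module Defs where

open import Data.Nat using (ℕ; zero; suc; _+_; _≤_)
open import Data.Bool using (Bool; true; false; _xor_)
open import Data.Vec using (Vec; zipWith; count)
open import Data.List using (List; length; map)
open import Data.List.Membership.Propositional using (_∈_)
open import Data.List.Relation.Unary.All using (All)
open import Data.List.Relation.Unary.Unique.Propositional using (Unique)
open import Data.Product using (Σ; ∃; _×_; _,_)
open import Data.Sum using (_⊎_)
open import Relation.Binary.PropositionalEquality using (_≡_; _≢_)
open import Relation.Nullary using (¬_)
open import Data.Bool.Properties using (T?)

Word : ℕ → Set
Word n = Vec Bool n

_⊕_ : ∀ {n} → Word n → Word n → Word n
_⊕_ = zipWith _xor_

wt : ∀ {n} → Word n → ℕ
wt = count T?

dist : ∀ {n} → Word n → Word n → ℕ
dist u v = wt (u ⊕ v)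

record Code (n : ℕ) : Set where
  constructor mkCode
  field
    words  : List (Word n)
    unique : Unique words
open Code public

HasDistanceSet : ∀ {n} → Code n → ℕ → ℕ → Set
HasDistanceSet {n} C d₁ d₂ =
  (∀ u v → u ∈ words C → v ∈ words C → u ≢ v → dist u v ≡ d₁ ⊎ dist u v ≡ d₂)
  × (∃ λ u → ∃ λ v → u ∈ words C × v ∈ words C × u ≢ v × dist u v ≡ d₁)
  × (∃ λ u → ∃ λ v → u ∈ words C × v ∈ words C × u ≢ v × dist u v ≡ d₂)

IsCode : ∀ {n} → Code n → ℕ → ℕ → ℕ → Set
IsCode C M d₁ d₂ = length (words C) ≡ M × HasDistanceSet C d₁ d₂

Optimal : ∀ {n} → Code n → ℕ → ℕ → Set
Optimal {n} C d₁ d₂ =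
  HasDistanceSet C d₁ d₂ ×
  (∀ (C' : Code n) → HasDistanceSet C' d₁ d₂ → length (words C') ≤ length (words C))

{-# OPTIONS --safe #-}
module Submission where

-- Write d = 2 k and w = k + 1, and let x₀, x₁ ∈ C be at distance 2 k + 2. Every word of C lies within distance k + 1 of one of the
-- boundedly many words that agree with x₀ wherever x₀ and x₁ agree. Fewer than n + 2 words of C lie within distance k of a given
-- centre, so if |C| exceeds a constant times n, then some centre y has many words of C at distance k + 1. Translated by y these are
-- w-sets pairwise meeting in at most one point; comparing a word of C with one of them that is disjoint from it shows that its weight
-- is k + 1 or k - 1. A word of weight k - 1 would be disjoint from all other words, so |C| - 1 would obey Johnson's bound for packings
-- of w-sets on n - k + 1 points, and it remains to find a packing on n points with at least two more blocks.
--
-- That packing comes from Wilson's theory of pairwise balanced designs. For a prime p ≡ 1 modulo w (w - 1), a second moment argument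
-- gives w residues whose differences lie in distinct classes of C(w,2)-th power residues, hence a Steiner system S(2,w,p). Deleting a
-- point gives a group divisible design with block size w and groups of size k. Transversal designs turn it into such designs with
-- u and with u + 1 groups, and truncated transversal designs then yield, for every N, a partial design with N groups whose deficiency
-- is linear in N. Designs without deficiency exist for all A ^ i * B ^ j groups with B / A as close to 1 as desired; using these as
-- long groups and linear deficiency only on the short one makes the deficiency at most N / 4, which suffices.

open import Defs
open import Data.Nat
open import Data.Nat.Properties
open import Data.Nat.Divisibility
open import Data.Nat.DivMod using (m%n<n; m≡m%n+[m/n]*n; [m+n]%n≡m%n; m<n⇒m%n≡m; m*n/n≡m; /-monoˡ-≤; m/n*n≤m)
open import Data.Nat.Induction using (<-rec)
open import Data.Nat.Primality
open import Data.Nat.Primality.Factorisation using (factorise)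
open import Data.Nat.Coprimality using (Coprime; coprime-divisor; coprime-Bézout)
open import Data.Nat.GCD using (module Bézout; gcd; gcd[m,n]∣m; gcd[m,n]∣n; gcd-GCD)
open import Data.Integer.Base as ℤ using (ℤ; +_; -[1+_]; ∣_∣)
import Data.Integer.Properties as ℤ
import Data.Integer.DivMod as ℤ
import Data.Nat.Tactic.RingSolver as ℕ-Ring
import Data.Integer.Tactic.RingSolver as ℤ-Ring
open import Data.Fin as Fin using (Fin; zero; suc; toℕ; fromℕ<; punchOut; punchIn)
import Data.Fin.Properties as Fin
open import Data.Fin.Permutation using (Permutation; permutation)
open import Algebra.Properties.CommutativeMonoid.Sum +-0-commutativeMonoid using (sum; sum-cong-≗; ∑-distrib-+; ∑-comm; sum-permute)
import Algebra.Properties.CommutativeMonoid.Sum ℤ.*-1-commutativeMonoid as ∏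
open import Data.Bool using (Bool; true; false; _xor_)
open import Data.Bool.Properties using () renaming (_≟_ to _≟ᵇ_)
open import Data.Vec as Vec using (Vec; []; _∷_; lookup; tabulate; replicate)
open import Data.Vec.Properties using (≡-dec; lookup-zipWith; lookup-replicate; lookup∘tabulate)
open import Data.List as List using (List; []; _∷_; length; map; _++_)
open import Data.List.Properties using (length-map; length-++; length-tabulate)
open import Data.List.Membership.Propositional using (_∈_)
open import Data.List.Membership.Propositional.Properties using (∈-map⁺; ∈-++⁺ˡ; ∈-++⁺ʳ; ∈-tabulate⁺; ∈-tabulate⁻)
open import Data.List.Relation.Unary.Any using (here; there)
open import Data.List.Relation.Unary.All as All using (All; []; _∷_)
open import Data.List.Relation.Unary.AllPairs using (_∷_)
open import Data.List.Relation.Unary.Unique.Propositional using (Unique)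
open import Data.List.Relation.Unary.Unique.Propositional.Properties using (tabulate⁺)
open import Data.Product using (Σ; ∃; ∃₂; _×_; _,_; proj₁; proj₂)
open import Data.Sum using (_⊎_; inj₁; inj₂; [_,_]′)
open import Data.Sum.Properties using (inj₁-injective; inj₂-injective)
open import Data.Empty using (⊥; ⊥-elim)
open import Data.Unit using (⊤; tt)
open import Function using (_∘_; id)
open import Relation.Nullary using (¬_; Dec; yes; no; contradiction)
open import Relation.Nullary.Decidable using (_×-dec_; ¬?; does)
open import Relation.Binary.Definitions using (tri<; tri≈; tri>)
open import Relation.Binary.PropositionalEquality

-- Cyclotomic values

-- The margin shapes the proof. A word of weight k - 1 takes only k - 1 points away from the others,
-- and for n = k * (N + 1) a full set of blocks on n points exceeds Johnson's bound on the remaining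
-- points by just (k - 1) * N / (k + 1) blocks. An asymptotically optimal packing, with an error of
-- lower order than n ^ 2, would not do: the deficiency must be linear in N with a small constant,
-- whence the detour through exact designs. The margin vanishes for k = 1, which is where d > 2
-- enters; for k ≥ 2 it leaves room for a deficiency of N / 4. Two classical inputs are replaced by
-- elementary ones. The primes in the progression divide values of cyclotomic polynomials, built as
-- mere numbers by Φ_rs(y) = Φ_s(y ^ r) / Φ_s(y); they bring along a residue of known order, which
-- serves in place of a primitive root. Character sums are avoided by taking the second moment over
-- all residue classes together: for one class the correlations are cyclotomic numbers, while their
-- sum over the classes has an exact elementary bound.

prime-divisor : ∀ n → n ≢ 1 → n ≢ 0 → ∃ λ p → Prime p × p ∣ n
prime-divisor n n≢1 n≢0 with factorise n {{≢-nonZero n≢0}}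
... | record { factors = [] ; isFactorisation = eq } = contradiction eq n≢1
... | record { factors = p ∷ ps ; isFactorisation = eq ; factorsPrime = pp ∷ _ } =
  p , pp , subst (p ∣_) (sym eq) (m∣m*n _)

prime-≥2 : ∀ {p} → Prime p → 2 ≤ p
prime-≥2 {p} pp = nonTrivial⇒n>1 p {{prime⇒nonTrivial pp}}

prime∤1 : ∀ {p} → Prime p → ¬ p ∣ 1
prime∤1 pp p∣1 = contradiction (∣1⇒≡1 p∣1) (λ { refl → <-irrefl refl (prime-≥2 pp) })

prime∣prime : ∀ {p r} → Prime p → Prime r → p ∣ r → p ≡ r
prime∣prime pp pr p∣r with prime⇒irreducible pr p∣r
... | inj₁ refl = contradiction ∣-refl (prime∤1 pp)
... | inj₂ eq = eq

no-common-prime⇒coprime : ∀ {a b} → b ≢ 0 → (∀ p → Prime p → p ∣ a → ¬ p ∣ b) → Coprime a b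
no-common-prime⇒coprime {a} {b} b≢0 h {d} (d∣a , d∣b) with d ≟ 1
... | yes eq = eq
... | no d≢1 with prime-divisor d d≢1 (λ { refl → b≢0 (0∣⇒≡0 d∣b) })
...   | p , pp , p∣d = contradiction (∣-trans p∣d d∣b) (h p pp (∣-trans p∣d d∣a))

-- The congruence x ^ n ≡ 1 modulo p, written additively so that no truncated subtraction arises.
record One (p x n : ℕ) : Set where
  constructor by
  field
    quotient : ℕ
    equation : x ^ n ≡ 1 + p * quotient

One-* : ∀ {p x} n m → One p x n → One p x (m * n)
One-* {p} n zero _ = by 0 (cong suc (sym (*-zeroʳ p)))
One-* {p} {x} n (suc m) (by t eq) with One-* {p} {x} n m (by t eq)
... | by t' eq' = by (t + t' + p * (t * t')) (begin
  x ^ (n + m * n)            ≡⟨ ^-distribˡ-+-* x n (m * n) ⟩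
  x ^ n * x ^ (m * n)        ≡⟨ cong₂ _*_ eq eq' ⟩
  (1 + p * t) * (1 + p * t') ≡⟨ lem p t t' ⟩
  1 + p * (t + t' + p * (t * t')) ∎)
  where
  open ≡-Reasoning
  lem : ∀ p t t' → (1 + p * t) * (1 + p * t') ≡ 1 + p * (t + t' + p * (t * t'))
  lem = ℕ-Ring.solve-∀

One-cancel : ∀ {p x} d m → 1 ≤ x → One p x m → One p x (d + m) → One p x d
One-cancel {p} {x} d m 1≤x (by t eq) (by t' eq') = go (x ^ d) refl
  where
  go : ∀ e → x ^ d ≡ e → One p x d
  go zero e≡ = contradiction (subst (1 ≤_) e≡ (m^n>0 x {{>-nonZero 1≤x}} d)) λ ()
  go (suc e) e≡ with ∣m+n∣m⇒∣n {p} {p * (suc e * t)} {e} (divides t' eq3) (divides (suc e * t) (*-comm p _))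
    where
    lem : ∀ e p t → suc e * (1 + p * t) ≡ suc (p * (suc e * t) + e)
    lem = ℕ-Ring.solve-∀
    eq2 : suc (p * (suc e * t) + e) ≡ suc (p * t')
    eq2 = trans (sym (lem e p t)) (trans (sym (cong₂ _*_ e≡ eq)) (trans (sym (^-distribˡ-+-* x d m)) eq'))
    eq3 : p * (suc e * t) + e ≡ t' * p
    eq3 = trans (suc-injective eq2) (*-comm p t')
  ... | divides q e≡qp = by q (trans e≡ (cong suc (trans e≡qp (*-comm q p))))

One-gcd : ∀ {p x d m n} → 1 ≤ x → Bézout.Identity d m n → One p x m → One p x n → One p x d
One-gcd {p} {x} {d} {m} {n} 1≤x (Bézout.+- a b eq) om on =
  One-cancel d (b * n) 1≤x (One-* n b on) (subst (One p x) (sym eq) (One-* m a om))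
One-gcd {p} {x} {d} {m} {n} 1≤x (Bézout.-+ a b eq) om on =
  One-cancel d (a * m) 1≤x (One-* m a om) (subst (One p x) (sym eq) (One-* n b on))

One-pow : ∀ {p} x r n → One p (x ^ r) n → One p x (r * n)
One-pow x r n (by t eq) = by t (trans (sym (^-*-assoc x r n)) eq)

One-pow⁻ : ∀ {p} x r n → One p x (r * n) → One p (x ^ r) n
One-pow⁻ x r n (by t eq) = by t (trans (^-*-assoc x r n) eq)

prime-coprime : ∀ {p r} → Prime p → Prime r → p ≢ r → Coprime p r
prime-coprime pp pr p≢r {d} (d∣p , d∣r) with prime⇒irreducible pp d∣p
... | inj₁ eq = eq
... | inj₂ refl = contradiction (prime∣prime pp pr d∣r) p≢r

-- Bézout in the exponent, applied to x ^ s, whose r-th and r'-th powers are both 1.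
One-coprime : ∀ {p} x r r' s → 1 ≤ x → Prime r → Prime r' → r ≢ r' → One p x (r * s) → One p x (r' * s) → One p x s
One-coprime {p} x r r' s 1≤x pr pr' r≢r' o o' with
  One-gcd {p} {x ^ s} {1} {r} {r'} (m^n>0 x {{>-nonZero 1≤x}} s) (coprime-Bézout (prime-coprime pr pr' r≢r'))
    (One-pow⁻ x s r (subst (One p x) (*-comm r s) o)) (One-pow⁻ x s r' (subst (One p x) (*-comm r' s) o'))
... | by t eq = by t (trans (sym (*-identityʳ _)) eq)

-- The binomial expansion to second order: the cofactor of D in (1 + D) ^ r - 1 is r modulo D. With
-- 1 + D = y ^ s this controls the primes shared by y ^ s - 1 and its cofactor in y ^ (r * s) - 1.
geometric : ∀ D r → ∃ λ E → (1 + D) ^ r ≡ 1 + D * (r + D * E)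
geometric D zero = 0 , lem D
  where
  lem : ∀ D → 1 ≡ 1 + D * (0 + D * 0)
  lem = ℕ-Ring.solve-∀
geometric D (suc r) with geometric D r
... | E , eq = E + r + D * E , trans (cong ((1 + D) *_) eq) (lem D r E)
  where
  lem : ∀ D r E → (1 + D) * (1 + D * (r + D * E)) ≡ 1 + D * (suc r + D * (E + r + D * E))
  lem = ℕ-Ring.solve-∀

-- In the instances constructed below s is the product of the primes up to k, F is Φ_s(y), and L is
-- the product of Φ_d(y) over the proper divisors d of s. The fields `F≡` and `y∤c` reflect the
-- constant term 1 and the linear coefficient ±1 of Φ_s; they keep F away from 1. The last two
-- fields say that y has order s modulo the primes of F and a smaller order modulo those of L.
record CycVal (k s y : ℕ) : Set where
  field
    F L c    : ℕ
    factored : y ^ s ≡ 1 + F * L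
    F≡       : F ≡ 1 + y * c
    y∤c      : ¬ y ∣ c
    primitive-order : ∀ p → Prime p → p ∣ F → ∀ r → Prime r → r ≤ k → ∀ s' → s ≡ r * s' → ¬ One p y s'
    L-order  : ∀ p → Prime p → p ∣ L → ∃₂ λ r s' → Prime r × r ≤ k × s ≡ r * s' × One p y s'

  F≢0 : F ≢ 0
  F≢0 F≡0 = contradiction (trans (sym F≡) F≡0) λ ()

  F∣⇒One : ∀ p → p ∣ F → One p y s
  F∣⇒One p (divides q eq) = by (q * L) (trans factored (cong suc (trans (cong (_* L) eq) (lem q p L))))
    where
    lem : ∀ q p L → q * p * L ≡ p * (q * L)
    lem = ℕ-Ring.solve-∀

  F-L-disjoint : ∀ p → Prime p → p ∣ F → ¬ p ∣ L
  F-L-disjoint p pp p∣F p∣L with L-order p pp p∣L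
  ... | r , s' , pr , r≤k , s≡ , one = primitive-order p pp p∣F r pr r≤k s' s≡ one

  p∣F⇒p∤y : ∀ p → Prime p → p ∣ F → ¬ p ∣ y
  p∣F⇒p∤y p pp p∣F p∣y = prime∤1 pp (∣m+n∣m⇒∣n (subst (p ∣_) (trans F≡ (+-comm 1 _)) p∣F) (∣m⇒∣m*n c p∣y))

  F≢1 : y ≢ 0 → F ≢ 1
  F≢1 y≢0 eq with m*n≡0⇒m≡0∨n≡0 y (suc-injective (trans (sym F≡) eq))
  ... | inj₁ y≡0 = y≢0 y≡0
  ... | inj₂ c≡0 = y∤c (subst (y ∣_) (sym c≡0) (y ∣0))

-- The values y are multiples of all primes up to k. As F ≡ 1 modulo y, none of these primes divides
-- F, and they are the only ones that F and L could have in common.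
Cyc : ℕ → ℕ → Set
Cyc k s = (∀ r → Prime r → k < r → ¬ r ∣ s) × (∀ r → Prime r → r ≤ k → r ∣ s) ×
  (∀ y → 2 ≤ y → (∀ r → Prime r → r ≤ k → r ∣ y) → CycVal k s y)

cyc-base : Cyc 2 2
cyc-base = (λ r pr 2<r r∣2 → <⇒≱ 2<r (∣⇒≤ r∣2))
  , (λ r pr r≤2 → subst (r ∣_) (≤-antisym r≤2 (prime-≥2 pr)) ∣-refl)
  , value
  where
  value : ∀ y → 2 ≤ y → (∀ r → Prime r → r ≤ 2 → r ∣ y) → CycVal 2 2 y
  value (suc y) 2≤y div = record
    { F = 2 + y ; L = y ; c = 1
    ; factored = lem y
    ; F≡ = cong suc (sym (*-identityʳ (suc y)))
    ; y∤c = λ d → contradiction (∣1⇒≡1 d) (λ { refl → <-irrefl refl 2≤y })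
    ; primitive-order = order
    ; L-order = λ { p pp (divides q eq) → 2 , 1 , prime[2] , ≤-refl , refl , by q (cong suc (trans (*-identityʳ y) (trans eq (*-comm q p)))) }
    }
    where
    lem : ∀ y → suc y * (suc y * 1) ≡ 1 + (2 + y) * y
    lem = ℕ-Ring.solve-∀
    order : ∀ p → Prime p → p ∣ 2 + y → ∀ r → Prime r → r ≤ 2 → ∀ s' → 2 ≡ r * s' → ¬ One p (suc y) s'
    order p pp p∣F r pr r≤2 s' eq (by t one) with ≤-antisym r≤2 (prime-≥2 pr)
    ... | refl with *-cancelˡ-≡ 1 s' 2 eq
    ... | refl = prime∤1 pp (∣m+n∣m⇒∣n (subst (p ∣_) (+-comm 1 (suc y)) p∣F) p∣sy)
      where
      p∣y : p ∣ y
      p∣y = divides t (trans (suc-injective (trans (cong suc (sym (*-identityʳ y))) one)) (*-comm p t))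
      p≡2 : p ≡ 2
      p≡2 = prime∣prime pp prime[2] (∣m+n∣m⇒∣n (subst (p ∣_) (+-comm 2 y) p∣F) p∣y)
      p∣sy : p ∣ suc y
      p∣sy = subst (_∣ suc y) (sym p≡2) (div 2 prime[2] ≤-refl)

-- The identity Φ_rs(y) = Φ_s(y ^ r) / Φ_s(y) for a new prime r, with `V₁` and `V₀` supplying
-- numerator and denominator. The divisibility is obtained by comparing orders, not by dividing
-- polynomials.
module CycStep (k s y : ℕ) (s>0 : 0 < s) (pr : Prime (suc k)) (2≤y : 2 ≤ y)
  (small : ∀ r → Prime r → r ≤ k → r ∣ s) (div : ∀ r → Prime r → r ≤ suc k → r ∣ y)
  (V₀ : CycVal k s y) (V₁ : CycVal k s (y ^ suc k)) where
  r = suc k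
  1≤y : 1 ≤ y
  1≤y = ≤-trans (s≤s z≤n) 2≤y
  instance
    y≢0 : NonZero y
    y≢0 = >-nonZero 1≤y
  y^r≥ : 2 ≤ y ^ r
  y^r≥ = ≤-trans 2≤y (m≤m*n y (y ^ k) {{m^n≢0 y k}})
  module V0 = CycVal V₀
  module V1 = CycVal V₁
  r≢ : ∀ {r'} → r' ≤ k → r ≢ r'
  r≢ r'≤k refl = <-irrefl refl r'≤k
  D0 = V0.F * V0.L
  E = proj₁ (geometric D0 r)
  Q = r + D0 * E
  pow≡ : y ^ (r * s) ≡ 1 + D0 * Q
  pow≡ = trans (cong (y ^_) (*-comm r s)) (trans (sym (^-*-assoc y s r)) (trans (cong (_^ r) V0.factored) (proj₂ (geometric D0 r))))
  F1L1≡ : V1.F * V1.L ≡ D0 * Q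
  F1L1≡ = suc-injective (trans (sym V1.factored) (trans (^-*-assoc y r s) pow≡))
  L1≢0 : V1.L ≢ 0
  L1≢0 L≡0 with m^n≡1⇒n≡0∨m≡1 (y ^ r) s (trans V1.factored (cong suc (trans (cong (V1.F *_) L≡0) (*-zeroʳ V1.F))))
  ... | inj₁ s≡0 = <-irrefl (sym s≡0) s>0
  ... | inj₂ e = <-irrefl (sym e) y^r≥
  -- Modulo a common prime, y ^ (r * s') and y ^ (r' * s') would both be 1 for some prime r' < r
  -- with s = r' * s'. Then y ^ s' would be 1 as well, although y has order s modulo the primes of
  -- `V0.F`.
  coprime-F0-L1 : Coprime V0.F V1.L
  coprime-F0-L1 = no-common-prime⇒coprime L1≢0 λ p pp p∣F0 p∣L1 → absurd p pp p∣F0 (V1.L-order p pp p∣L1)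
    where
    absurd : ∀ p → Prime p → p ∣ V0.F → (∃₂ λ r' s' → Prime r' × r' ≤ k × s ≡ r' * s' × One p (y ^ r) s') → ⊥
    absurd p pp p∣F0 (r' , s' , pr' , r'≤k , s≡ , one) =
      V0.primitive-order p pp p∣F0 r' pr' r'≤k s' s≡
        (One-coprime y r r' s' 1≤y pr pr' (r≢ r'≤k) (One-pow y r s' one) (subst (One p y) s≡ (V0.F∣⇒One p p∣F0)))
  F0∣F1 : V0.F ∣ V1.F
  F0∣F1 = coprime-divisor coprime-F0-L1 (subst (V0.F ∣_) (trans (sym F1L1≡) (*-comm V1.F V1.L)) (∣m⇒∣m*n Q (m∣m*n V0.L)))

  quotient-value : ∀ F' → V1.F ≡ F' * V0.F → CycVal r (r * s) y
  quotient-value F' F1≡ = record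
    -- Modulo the primes of `V0.F` the order of y is s, a proper divisor of r * s, so this factor
    -- moves to the L side.
    { F = F' ; L = V1.L * V0.F ; c = g
    ; factored = trans (sym (^-*-assoc y r s)) (trans V1.factored (cong suc (trans (cong (_* V1.L) F1≡) (l1 F' V0.F V1.L))))
    ; F≡ = F'≡ ; y∤c = y∤g
    ; primitive-order = order ; L-order = lorder }
    where
    l1 : ∀ a b c → a * b * c ≡ a * (c * b)
    l1 = ℕ-Ring.solve-∀
    F'∣F1 : F' ∣ V1.F
    F'∣F1 = divides V0.F (trans F1≡ (*-comm F' V0.F))
    prod≡ : F' * (1 + y * V0.c) ≡ 1 + y * (y ^ k * V1.c)
    prod≡ = trans (cong (F' *_) (sym V0.F≡)) (trans (sym F1≡) (trans V1.F≡ (cong suc (*-assoc y (y ^ k) V1.c))))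
    shape : ∀ F'' → F'' * (1 + y * V0.c) ≡ 1 + y * (y ^ k * V1.c) → ∃ λ g → F'' ≡ 1 + y * g × ¬ y ∣ g
    shape zero ()
    shape (suc f) prod = finish (∣m+n∣m⇒∣n {y} {(1 + f) * (y * V0.c)} {f} (divides (y ^ k * V1.c) (trans (suc-injective (trans (sym (l2 f (y * V0.c))) prod)) (*-comm y _))) (∣n⇒∣m*n (1 + f) (m∣m*n V0.c)))
      where
      l2 : ∀ f x → suc f * (1 + x) ≡ suc ((1 + f) * x + f)
      l2 = ℕ-Ring.solve-∀
      finish : y ∣ f → ∃ λ g → suc f ≡ 1 + y * g × ¬ y ∣ g
      finish (divides g refl) = g , cong suc (*-comm g y) , λ y∣g → V0.y∤c
        (∣m+n∣m⇒∣n {y} {g + g * y * V0.c} {V0.c} (subst (y ∣_) eq2 (y∣ k refl)) (∣m∣n⇒∣m+n y∣g (∣m⇒∣m*n V0.c (n∣m*n g))))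
        where
        l3 : ∀ g y c → suc (g * y) * (1 + y * c) ≡ suc (y * (g + g * y * c + c))
        l3 = ℕ-Ring.solve-∀
        eq2 : y ^ k * V1.c ≡ g + g * y * V0.c + V0.c
        eq2 = *-cancelˡ-≡ _ _ y (suc-injective (trans (sym prod) (l3 g y V0.c)))
        -- For k = 0 the number r would be 1, not a prime. Otherwise y divides y ^ k, so that g ≡ -
        -- `V0.c` modulo y: only the sign of the linear coefficient changes.
        y∣ : ∀ k' → k' ≡ k → y ∣ y ^ k * V1.c
        y∣ zero refl = contradiction pr (λ p1 → <-irrefl refl (prime-≥2 p1))
        y∣ (suc k') refl = ∣m⇒∣m*n V1.c (m∣m*n (y ^ k'))
    g = proj₁ (shape F' prod≡)
    F'≡ = proj₁ (proj₂ (shape F' prod≡))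
    y∤g = proj₂ (proj₂ (shape F' prod≡))
    F'L1≡ : F' * V1.L ≡ V0.L * Q
    F'L1≡ = *-cancelˡ-≡ _ _ V0.F {{≢-nonZero V0.F≢0}} (trans (l4 V0.F F' V1.L) (trans (cong (_* V1.L) (sym F1≡)) (trans F1L1≡ (*-assoc V0.F V0.L Q))))
      where
      l4 : ∀ a b c → a * (b * c) ≡ b * a * c
      l4 = ℕ-Ring.solve-∀
    -- Modulo a prime dividing D0 the cofactor Q of D0 is r, which divides y.
    F'-F0-disjoint : ∀ p → Prime p → p ∣ F' → ¬ p ∣ V0.F
    F'-F0-disjoint p pp p∣F' p∣F0 with euclidsLemma V0.L Q pp (subst (p ∣_) F'L1≡ (∣m⇒∣m*n V1.L p∣F'))
    ... | inj₁ p∣L0 = V0.F-L-disjoint p pp p∣F0 p∣L0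
    ... | inj₂ p∣Q = V0.p∣F⇒p∤y p pp p∣F0 (subst (_∣ y) (sym p≡r) (div r pr ≤-refl))
      where
      p≡r : p ≡ r
      p≡r = prime∣prime pp pr (∣m+n∣m⇒∣n (subst (p ∣_) (+-comm r _) p∣Q) (∣m⇒∣m*n E (∣m⇒∣m*n V0.L p∣F0)))
    -- For r' ≤ k the order is read off from `V₁`. For r' = r, the assumption y ^ s ≡ 1 places p in
    -- `V0.F`, which is excluded, or in `V0.L`; there y has an order dividing s / r'', which its
    -- power y ^ r inherits, against `V₁`.
    order : ∀ p → Prime p → p ∣ F' → ∀ r' → Prime r' → r' ≤ r → ∀ s' → r * s ≡ r' * s' → ¬ One p y s'
    order p pp p∣F' r' pr' r'≤r s' eq one with m≤n⇒m<n∨m≡n r'≤r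
    ... | inj₁ (s≤s r'≤k) with small r' pr' r'≤k
    ...   | divides t s≡ = V1.primitive-order p pp (∣-trans p∣F' F'∣F1) r' pr' r'≤k t (trans s≡ (*-comm t r'))
            (One-pow⁻ y r t (subst (One p y) s'≡ one))
      where
      s'≡ : s' ≡ r * t
      s'≡ = *-cancelˡ-≡ s' (r * t) r' {{prime⇒nonZero pr'}} (trans (sym eq) (trans (cong (r *_) s≡) (l5 r t r')))
        where
        l5 : ∀ a b c → a * (b * c) ≡ c * (a * b)
        l5 = ℕ-Ring.solve-∀
    order p pp p∣F' r' pr' r'≤r s' eq one | inj₂ refl with *-cancelˡ-≡ s s' r eq
    ... | refl = absurd one
      where
      absurd : One p y s → ⊥
      absurd (by t e) with euclidsLemma V0.F V0.L pp (divides t (trans (suc-injective (trans (sym V0.factored) e)) (*-comm p t)))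
      ... | inj₁ p∣F0 = F'-F0-disjoint p pp p∣F' p∣F0
      ... | inj₂ p∣L0 with V0.L-order p pp p∣L0
      ...   | r'' , s'' , pr'' , r''≤k , s≡ , one'' =
              V1.primitive-order p pp (∣-trans p∣F' F'∣F1) r'' pr'' r''≤k s'' s≡ (One-pow⁻ y r s'' (One-* s'' r one''))
    lorder : ∀ p → Prime p → p ∣ V1.L * V0.F → ∃₂ λ r' s' → Prime r' × r' ≤ r × r * s ≡ r' * s' × One p y s'
    lorder p pp p∣ with euclidsLemma V1.L V0.F pp p∣
    ... | inj₂ p∣F0 = r , s , pr , ≤-refl , refl , V0.F∣⇒One p p∣F0
    ... | inj₁ p∣L1 with V1.L-order p pp p∣L1
    ...   | r' , s' , pr' , r'≤k , s≡ , one = r' , r * s' , pr' , m≤n⇒m≤1+n r'≤k , trans (cong (r *_) s≡) (l6 r r' s') , One-pow y r s' one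
      where
      l6 : ∀ a b c → a * (b * c) ≡ b * (a * c)
      l6 = ℕ-Ring.solve-∀

  value : CycVal r (r * s) y
  value with F0∣F1
  ... | divides F' F1≡ = quotient-value F' F1≡

cyc-step-prime : ∀ k s → 0 < s → Prime (suc k) → Cyc k s → Cyc (suc k) (suc k * s)
cyc-step-prime k s s>0 pr (big , small , value) = big' , small' , value'
  where
  r = suc k
  big' : ∀ r' → Prime r' → r < r' → ¬ r' ∣ r * s
  big' r' pr' r<r' r'∣ with euclidsLemma r s pr' r'∣
  ... | inj₁ d = <⇒≱ r<r' (∣⇒≤ d)
  ... | inj₂ d = big r' pr' (<-trans (n<1+n k) r<r') d
  small' : ∀ r' → Prime r' → r' ≤ r → r' ∣ r * s
  small' r' pr' r'≤r with m≤n⇒m<n∨m≡n r'≤r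
  ... | inj₁ (s≤s r'≤k) = ∣n⇒∣m*n r (small r' pr' r'≤k)
  ... | inj₂ refl = m∣m*n s
  value' : ∀ y → 2 ≤ y → (∀ r' → Prime r' → r' ≤ r → r' ∣ y) → CycVal r (r * s) y
  value' y 2≤y div = CycStep.value k s y s>0 pr 2≤y small div
    (value y 2≤y (λ r' pr' r'≤k → div r' pr' (m≤n⇒m≤1+n r'≤k)))
    (value (y ^ r) (≤-trans 2≤y (m≤m*n y (y ^ k) {{m^n≢0 y k {{>-nonZero (≤-trans (s≤s z≤n) 2≤y)}}}}))
      (λ r' pr' r'≤k → ∣m⇒∣m*n (y ^ k) (div r' pr' (m≤n⇒m≤1+n r'≤k))))

cyc-step : ∀ k → (∃ λ s → 0 < s × Cyc k s) → ∃ λ s → 0 < s × Cyc (suc k) s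
cyc-step k (s , s>0 , cyc@(big , small , value)) with prime? (suc k)
... | yes pr = suc k * s , *-mono-≤ {1} {suc k} {1} {s} (s≤s z≤n) s>0 , cyc-step-prime k s s>0 pr cyc
... | no ¬pr = s , s>0 , (λ r pr k<r → big r pr (<-trans (n<1+n k) k<r)) , (λ r pr r≤ → small r pr (down r pr r≤)) , value'
  where
  down : ∀ r → Prime r → r ≤ suc k → r ≤ k
  down r pr r≤ with m≤n⇒m<n∨m≡n r≤
  ... | inj₁ (s≤s h) = h
  ... | inj₂ refl = contradiction pr ¬pr
  value' : ∀ y → 2 ≤ y → (∀ r → Prime r → r ≤ suc k → r ∣ y) → CycVal (suc k) s y
  value' y 2≤y div = record
    { F = V.F ; L = V.L ; c = V.c ; factored = V.factored ; F≡ = V.F≡ ; y∤c = V.y∤c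
    ; primitive-order = λ p pp p∣F r pr r≤ → V.primitive-order p pp p∣F r pr (down r pr r≤)
    ; L-order = λ p pp p∣L → let (r , s' , pr , r≤k , rest) = V.L-order p pp p∣L in r , s' , pr , m≤n⇒m≤1+n r≤k , rest }
    where module V = CycVal (value y 2≤y (λ r pr r≤k → div r pr (m≤n⇒m≤1+n r≤k)))

cyc-exists : ∀ k → ∃ λ s → 0 < s × Cyc (2 + k) s
cyc-exists zero = 2 , s≤s z≤n , cyc-base
cyc-exists (suc k) = cyc-step (2 + k) (cyc-exists k)

-- Congruences and Fermat's theorem

injective⇒surjective : ∀ {n} (f : Fin n → Fin n) → (∀ {i j} → f i ≡ f j → i ≡ j) → ∀ y → ∃ λ x → f x ≡ y
injective⇒surjective {suc n} f inj y with Fin.any? (λ x → f x Fin.≟ y)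
... | yes h = h
... | no ¬h = contradiction (Fin.injective⇒≤ {f = f'} (λ {a} {b} e → inj (Fin.punchOut-injective (y≢f a) (y≢f b) e))) (<⇒≱ (n<1+n n))
  where
  y≢f : ∀ x → y ≢ f x
  y≢f x e = ¬h (x , sym e)
  f' : Fin (suc n) → Fin n
  f' x = punchOut (y≢f x)

inj⇒perm : ∀ {n} (f : Fin n → Fin n) → (∀ {i j} → f i ≡ f j → i ≡ j) → Permutation n n
inj⇒perm f inj = permutation f (λ y → proj₁ (injective⇒surjective f inj y))
  (λ y → proj₂ (injective⇒surjective f inj y))
  (λ x → inj (proj₂ (injective⇒surjective f inj (f x))))

infix 4 _≈[_]_
record _≈[_]_ (x : ℤ) (q : ℕ) (y : ℤ) : Set where
  constructor mod-eq
  field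
    quot : ℤ
    eq   : x ≡ y ℤ.+ quot ℤ.* + q

module _ {q : ℕ} where
  ≈-reflexive : ∀ {x y} → x ≡ y → x ≈[ q ] y
  ≈-reflexive {x} refl = mod-eq ℤ.0ℤ (lem x (+ q))
    where
    lem : ∀ x q → x ≡ x ℤ.+ ℤ.0ℤ ℤ.* q
    lem = ℤ-Ring.solve-∀

  ≈-refl : ∀ {x} → x ≈[ q ] x
  ≈-refl = ≈-reflexive refl

  ≈-sym : ∀ {x y} → x ≈[ q ] y → y ≈[ q ] x
  ≈-sym {x} {y} (mod-eq k refl) = mod-eq (ℤ.- k) (lem y k (+ q))
    where
    lem : ∀ y k q → y ≡ (y ℤ.+ k ℤ.* q) ℤ.+ (ℤ.- k) ℤ.* q
    lem = ℤ-Ring.solve-∀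

  ≈-trans : ∀ {x y z} → x ≈[ q ] y → y ≈[ q ] z → x ≈[ q ] z
  ≈-trans {z = z} (mod-eq k refl) (mod-eq l refl) = mod-eq (k ℤ.+ l) (lem z k l (+ q))
    where
    lem : ∀ z k l q → (z ℤ.+ l ℤ.* q) ℤ.+ k ℤ.* q ≡ z ℤ.+ (k ℤ.+ l) ℤ.* q
    lem = ℤ-Ring.solve-∀

  ≈-+ : ∀ {x y u v} → x ≈[ q ] y → u ≈[ q ] v → x ℤ.+ u ≈[ q ] y ℤ.+ v
  ≈-+ {y = y} {v = v} (mod-eq k refl) (mod-eq l refl) = mod-eq (k ℤ.+ l) (lem y v k l (+ q))
    where
    lem : ∀ y v k l q → (y ℤ.+ k ℤ.* q) ℤ.+ (v ℤ.+ l ℤ.* q) ≡ (y ℤ.+ v) ℤ.+ (k ℤ.+ l) ℤ.* q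
    lem = ℤ-Ring.solve-∀

  ≈-* : ∀ {x y u v} → x ≈[ q ] y → u ≈[ q ] v → x ℤ.* u ≈[ q ] y ℤ.* v
  ≈-* {y = y} {v = v} (mod-eq k refl) (mod-eq l refl) = mod-eq (k ℤ.* v ℤ.+ y ℤ.* l ℤ.+ k ℤ.* l ℤ.* + q) (lem y v k l (+ q))
    where
    lem : ∀ y v k l q → (y ℤ.+ k ℤ.* q) ℤ.* (v ℤ.+ l ℤ.* q) ≡ y ℤ.* v ℤ.+ (k ℤ.* v ℤ.+ y ℤ.* l ℤ.+ k ℤ.* l ℤ.* q) ℤ.* q
    lem = ℤ-Ring.solve-∀

  ≈-neg : ∀ {x y} → x ≈[ q ] y → ℤ.- x ≈[ q ] ℤ.- y
  ≈-neg {y = y} (mod-eq k refl) = mod-eq (ℤ.- k) (lem y k (+ q))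
    where
    lem : ∀ y k q → ℤ.- (y ℤ.+ k ℤ.* q) ≡ (ℤ.- y) ℤ.+ (ℤ.- k) ℤ.* q
    lem = ℤ-Ring.solve-∀

  ≈-- : ∀ {x y u v} → x ≈[ q ] y → u ≈[ q ] v → x ℤ.- u ≈[ q ] y ℤ.- v
  ≈-- e f = ≈-+ e (≈-neg f)

  ≈-^ : ∀ {x y} n → x ≈[ q ] y → x ℤ.^ n ≈[ q ] y ℤ.^ n
  ≈-^ zero e = ≈-refl
  ≈-^ (suc n) e = ≈-* e (≈-^ n e)

  ≈⇒-≈0 : ∀ {x y} → x ≈[ q ] y → x ℤ.- y ≈[ q ] ℤ.0ℤ
  ≈⇒-≈0 {y = y} e = ≈-trans (≈-- e ≈-refl) (≈-reflexive (ℤ.+-inverseʳ y))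

  -≈0⇒≈ : ∀ {x y} → x ℤ.- y ≈[ q ] ℤ.0ℤ → x ≈[ q ] y
  -≈0⇒≈ {x} {y} (mod-eq k e) = mod-eq k (trans (lem x y) (cong (λ z → y ℤ.+ z) (trans e (ℤ.+-identityˡ _))))
    where
    lem : ∀ x y → x ≡ y ℤ.+ (x ℤ.- y)
    lem = ℤ-Ring.solve-∀

  -- With `≈-comb₂` and `≈-comb₃` this reduces a congruence to an integer identity: the difference
  -- of the two sides is written as a combination of the differences in the hypotheses, with
  -- explicit coefficients.
  ≈-comb₁ : ∀ {a b x y} k → a ≈[ q ] b → x ≡ y ℤ.+ k ℤ.* (a ℤ.- b) → x ≈[ q ] y
  ≈-comb₁ {b = b} {y = y} k (mod-eq l refl) refl = mod-eq (k ℤ.* l) (lem b y k l (+ q))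
    where
    lem : ∀ b y k l q → y ℤ.+ k ℤ.* ((b ℤ.+ l ℤ.* q) ℤ.- b) ≡ y ℤ.+ k ℤ.* l ℤ.* q
    lem = ℤ-Ring.solve-∀

  ≈-comb₂ : ∀ {a b c d x y} k l → a ≈[ q ] b → c ≈[ q ] d → x ≡ y ℤ.+ k ℤ.* (a ℤ.- b) ℤ.+ l ℤ.* (c ℤ.- d) → x ≈[ q ] y
  ≈-comb₂ k l h h' eq = ≈-trans (≈-comb₁ l h' eq) (≈-comb₁ k h refl)

  ≈-comb₃ : ∀ {a b c d e f x y} k l m → a ≈[ q ] b → c ≈[ q ] d → e ≈[ q ] f →
    x ≡ y ℤ.+ k ℤ.* (a ℤ.- b) ℤ.+ l ℤ.* (c ℤ.- d) ℤ.+ m ℤ.* (e ℤ.- f) → x ≈[ q ] y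
  ≈-comb₃ k l m h h' h'' eq = ≈-trans (≈-comb₁ m h'' eq) (≈-comb₂ k l h h' refl)

  ≈0⇒∣ : ∀ {x} → x ≈[ q ] ℤ.0ℤ → q ∣ ∣ x ∣
  ≈0⇒∣ (mod-eq k refl) = divides ∣ k ∣ (trans (cong ∣_∣ (ℤ.+-identityˡ (k ℤ.* + q))) (ℤ.abs-* k (+ q)))

  ∣⇒≈0 : ∀ {x} → q ∣ ∣ x ∣ → x ≈[ q ] ℤ.0ℤ
  ∣⇒≈0 {+ n} (divides k eq) = mod-eq (+ k) (trans (cong +_ eq) (trans (ℤ.pos-* k q) (sym (ℤ.+-identityˡ _))))
  ∣⇒≈0 { -[1+ n ]} (divides k eq) = mod-eq (ℤ.- (+ k))
    (trans (cong (λ z → ℤ.- (+ z)) eq) (trans (cong ℤ.-_ (ℤ.pos-* k q)) (trans (ℤ.neg-distribˡ-* (+ k) (+ q)) (sym (ℤ.+-identityˡ _)))))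

  *-cancel-coprime : ∀ d {x} → Coprime q ∣ d ∣ → d ℤ.* x ≈[ q ] ℤ.0ℤ → x ≈[ q ] ℤ.0ℤ
  *-cancel-coprime d {x} c e = ∣⇒≈0 (coprime-divisor c (subst (q ∣_) (ℤ.abs-* d x) (≈0⇒∣ e)))

abstract
  ι : ∀ {q} → Fin q → ℤ
  ι i = + toℕ i

  ι-injective : ∀ {q} {a b : Fin q} → ι a ≈[ q ] ι b → a ≡ b
  ι-injective {q} {a} {b} e = Fin.toℕ-injective (ℤ.+-injective (ℤ.i-j≡0⇒i≡j _ _ (ℤ.∣i∣≡0⇒i≡0 (small (≈0⇒∣ (≈⇒-≈0 e))))))
    where
    bound : ∣ ι a ℤ.- ι b ∣ < q
    bound = ≤-<-trans (subst (λ z → ∣ z ∣ ≤ toℕ a ⊔ toℕ b) (sym (ℤ.m-n≡m⊖n (toℕ a) (toℕ b))) (ℤ.∣m⊝n∣≤m⊔n (toℕ a) (toℕ b)))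
      (⊔-lub (Fin.toℕ<n a) (Fin.toℕ<n b))
    small : q ∣ ∣ ι a ℤ.- ι b ∣ → ∣ ι a ℤ.- ι b ∣ ≡ 0
    small d with ∣ ι a ℤ.- ι b ∣ | bound
    ... | zero  | _ = refl
    ... | suc n | n<q = contradiction (∣⇒≤ d) (<⇒≱ n<q)

  red : ∀ q .{{_ : NonZero q}} → ℤ → Fin q
  red q x = fromℕ< (ℤ.n%ℕd<d x q)

  red-≈ : ∀ q .{{_ : NonZero q}} x → ι (red q x) ≈[ q ] x
  red-≈ q x = ≈-sym (mod-eq (x ℤ./ℕ q) (trans (ℤ.a≡a%ℕn+[a/ℕn]*n x q)
    (cong (λ z → + z ℤ.+ (x ℤ./ℕ q) ℤ.* + q) (sym (Fin.toℕ-fromℕ< (ℤ.n%ℕd<d x q))))))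

  ι-zero : ∀ {q} → ι {suc q} zero ≡ ℤ.0ℤ
  ι-zero = refl

  ι-toℕ : ∀ {q} (i : Fin q) → ι i ≡ + toℕ i
  ι-toℕ i = refl

ι≉0 : ∀ {q} (i : Fin q) → ¬ ι (Fin.suc i) ≈[ suc q ] ℤ.0ℤ
ι≉0 i h with () ← ι-injective {a = suc i} {zero} (≈-trans h (≈-reflexive (sym ι-zero)))

red-injective : ∀ {q} .{{_ : NonZero q}} {x y} → red q x ≡ red q y → x ≈[ q ] y
red-injective {q} {x} {y} e = ≈-trans (≈-sym (red-≈ q x)) (≈-trans (≈-reflexive (cong ι e)) (red-≈ q y))

pos-^ : ∀ x n → (+ x) ℤ.^ n ≡ + (x ^ n)
pos-^ x zero = refl
pos-^ x (suc n) = trans (cong (+ x ℤ.*_) (pos-^ x n)) (sym (ℤ.pos-* x (x ^ n)))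

module PrimeField {p : ℕ} (pp : Prime p) where
  instance
    p≢0 : NonZero p
    p≢0 = prime⇒nonZero pp

  *≈0 : ∀ x {y} → x ℤ.* y ≈[ p ] ℤ.0ℤ → x ≈[ p ] ℤ.0ℤ ⊎ y ≈[ p ] ℤ.0ℤ
  *≈0 x {y} e with euclidsLemma ∣ x ∣ ∣ y ∣ pp (subst (p ∣_) (ℤ.abs-* x y) (≈0⇒∣ e))
  ... | inj₁ d = inj₁ (∣⇒≈0 d)
  ... | inj₂ d = inj₂ (∣⇒≈0 d)

  *-cancelˡ-≈ : ∀ {x} y z → ¬ x ≈[ p ] ℤ.0ℤ → x ℤ.* y ≈[ p ] x ℤ.* z → y ≈[ p ] z
  *-cancelˡ-≈ {x} y z x≉0 e = [ (λ h → contradiction h x≉0) , -≈0⇒≈ ]′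
    (*≈0 x {y ℤ.- z} (≈-comb₁ ℤ.1ℤ e (lem x y z)))
    where
    lem : ∀ x y z → x ℤ.* (y ℤ.- z) ≡ ℤ.0ℤ ℤ.+ ℤ.1ℤ ℤ.* (x ℤ.* y ℤ.- x ℤ.* z)
    lem = ℤ-Ring.solve-∀

  1≉0 : ¬ ℤ.1ℤ ≈[ p ] ℤ.0ℤ
  1≉0 e = prime∤1 pp (≈0⇒∣ e)

  *≉0 : ∀ {x y} → ¬ x ≈[ p ] ℤ.0ℤ → ¬ y ≈[ p ] ℤ.0ℤ → ¬ x ℤ.* y ≈[ p ] ℤ.0ℤ
  *≉0 {x} x≉0 y≉0 e = [ x≉0 , y≉0 ]′ (*≈0 x e)

  ^≉0 : ∀ {x} n → ¬ x ≈[ p ] ℤ.0ℤ → ¬ x ℤ.^ n ≈[ p ] ℤ.0ℤ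
  ^≉0 zero x≉0 = 1≉0
  ^≉0 (suc n) x≉0 = *≉0 x≉0 (^≉0 n x≉0)

  _≈?_ : ∀ x y → Dec (x ≈[ p ] y)
  x ≈? y with p ∣? ∣ x ℤ.- y ∣
  ... | yes d = yes (-≈0⇒≈ (∣⇒≈0 d))
  ... | no ¬d = no (λ e → ¬d (≈0⇒∣ (≈⇒-≈0 e)))

  -- Injective multiplication permutes the residues, so it is onto.
  inverse : ∀ {x} → ¬ x ≈[ p ] ℤ.0ℤ → ∃ λ y → x ℤ.* y ≈[ p ] ℤ.1ℤ
  inverse {x} x≉0 = let (i , e) = injective⇒surjective f f-inj (red p ℤ.1ℤ) in ι i , red-injective e
    where
    f : Fin p → Fin p
    f i = red p (x ℤ.* ι i)
    f-inj : ∀ {i j} → f i ≡ f j → i ≡ j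
    f-inj {i} {j} e = ι-injective (*-cancelˡ-≈ {x} (ι i) (ι j) x≉0 (red-injective e))

  ∏-cong : ∀ {n} {f g : Fin n → ℤ} → (∀ i → f i ≈[ p ] g i) → ∏.sum f ≈[ p ] ∏.sum g
  ∏-cong {zero} h = ≈-refl
  ∏-cong {suc n} h = ≈-* (h zero) (∏-cong (h ∘ suc))

  ∏≉0 : ∀ {n} (f : Fin n → ℤ) → (∀ i → ¬ f i ≈[ p ] ℤ.0ℤ) → ¬ ∏.sum f ≈[ p ] ℤ.0ℤ
  ∏≉0 {zero} f h = 1≉0
  ∏≉0 {suc n} f h = *≉0 (h zero) (∏≉0 (f ∘ suc) (h ∘ suc))

∏-scale : ∀ {n} x (f : Fin n → ℤ) → ∏.sum (λ i → x ℤ.* f i) ≡ x ℤ.^ n ℤ.* ∏.sum f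
∏-scale {zero} x f = refl
∏-scale {suc n} x f = trans (cong (x ℤ.* f zero ℤ.*_) (∏-scale x (f ∘ suc))) (lem x (f zero) (x ℤ.^ n) _)
  where
  lem : ∀ a b c d → a ℤ.* b ℤ.* (c ℤ.* d) ≡ a ℤ.* c ℤ.* (b ℤ.* d)
  lem = ℤ-Ring.solve-∀

-- Multiplication by x permutes the nonzero residues; comparing their product before and after gives
-- a factor x ^ m, and the product can be cancelled.
fermat : ∀ {m} → Prime (suc m) → ∀ x → ¬ x ≈[ suc m ] ℤ.0ℤ → x ℤ.^ m ≈[ suc m ] ℤ.1ℤ
fermat {m} pp x x≉0 = *-cancelˡ-≈ {∏.sum e} _ _ (∏≉0 e e≉0)
  (≈-trans (≈-reflexive (ℤ.*-comm (∏.sum e) (x ℤ.^ m)))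
  (≈-trans (≈-reflexive (sym (∏-scale x e)))
  (≈-trans (≈-sym (∏-cong f≈))
  (≈-trans (≈-reflexive (sym (∏.sum-permute e (inj⇒perm f f-inj)))) (≈-reflexive (sym (ℤ.*-identityʳ _)))))))
  where
  open PrimeField pp
  e : Fin m → ℤ
  e i = ι (Fin.suc i)
  e≉0 : ∀ i → ¬ e i ≈[ suc m ] ℤ.0ℤ
  e≉0 = ι≉0
  xe≢0 : ∀ i → zero ≢ red (suc m) (x ℤ.* e i)
  xe≢0 i h = *≉0 x≉0 (e≉0 i) (≈-trans (≈-sym (red-≈ (suc m) (x ℤ.* e i))) (≈-reflexive (trans (cong ι (sym h)) ι-zero)))
  f : Fin m → Fin m
  f i = punchOut (xe≢0 i)
  f≈ : ∀ i → e (f i) ≈[ suc m ] x ℤ.* e i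
  f≈ i = ≈-trans (≈-reflexive (cong ι (Fin.punchIn-punchOut (xe≢0 i)))) (red-≈ (suc m) (x ℤ.* e i))
  f-inj : ∀ {i j} → f i ≡ f j → i ≡ j
  f-inj {i} {j} h = Fin.suc-injective (ι-injective (*-cancelˡ-≈ _ _ x≉0 (red-injective (Fin.punchOut-injective (xe≢0 i) (xe≢0 j) h))))

One⇒≈ : ∀ {p x n} → One p x n → (+ x) ℤ.^ n ≈[ p ] ℤ.1ℤ
One⇒≈ {p} {x} {n} (by t eq) = mod-eq (+ t) (trans (pos-^ x n) (trans (cong +_ eq) (trans (ℤ.pos-+ 1 (p * t)) (cong (λ z → ℤ.1ℤ ℤ.+ z) (trans (cong +_ (*-comm p t)) (ℤ.pos-* t p))))))

≈⇒One : ∀ {p x} n → 1 ≤ x → (+ x) ℤ.^ n ≈[ p ] ℤ.1ℤ → One p x n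
≈⇒One {p} {x} n 1≤x h = go (x ^ n) refl
  where
  h' : + (x ^ n) ℤ.- ℤ.1ℤ ≈[ p ] ℤ.0ℤ
  h' = ≈⇒-≈0 (≈-trans (≈-reflexive (sym (pos-^ x n))) h)
  go : ∀ e → x ^ n ≡ e → One p x n
  go zero e≡ = contradiction (subst (1 ≤_) e≡ (m^n>0 x {{>-nonZero 1≤x}} n)) λ ()
  go (suc e) e≡ with ≈0⇒∣ (≈-trans (≈-reflexive (cong (λ z → + z ℤ.- ℤ.1ℤ) (sym e≡))) h')
  ... | divides q eq = by q (trans e≡ (cong suc (trans eq (*-comm q p))))

-- The power of x with exponent g = gcd M d is 1. If g were a proper divisor of M, then M / r would
-- be a multiple of g for some prime r, against the hypothesis.
order-divides : ∀ {p x} M d → 1 ≤ x → 0 < M → (∀ r t → Prime r → M ≡ r * t → ¬ One p x t) →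
  One p x M → One p x d → M ∣ d
order-divides {p} {x} M d 1≤x 0<M order oM od with gcd[m,n]∣m M d
... | divides c M≡ = go (c ≟ 1)
  where
  g = gcd M d
  og : One p x g
  og = One-gcd 1≤x (Bézout.identity (gcd-GCD M d)) oM od
  c≢0 : c ≢ 0
  c≢0 refl = <-irrefl (sym M≡) 0<M
  go : Dec (c ≡ 1) → M ∣ d
  go (yes refl) = subst (_∣ d) (trans (sym (*-identityˡ g)) (sym M≡)) (gcd[m,n]∣n M d)
  go (no c≢1) with prime-divisor c c≢1 c≢0
  ... | r , pr , divides c' c≡ = contradiction (One-* g c' og)
    (order r (c' * g) pr (trans M≡ (trans (cong (_* g) c≡) (lem c' r g))))
    where
    lem : ∀ c' r g → c' * r * g ≡ r * (c' * g)
    lem = ℕ-Ring.solve-∀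

-- A residue of order exactly M is kept along with the prime. It forces p ≡ 1 modulo M through
-- Fermat's theorem, and its powers are the roots of unity that label the residue classes.
record CycPrime (M : ℕ) : Set where
  field
    m       : ℕ
    p-prime : Prime (suc m)
    x       : ℕ
    1≤x     : 1 ≤ x
    x^M     : One (suc m) x M
    exact   : ∀ d → One (suc m) x d → M ∣ d
    M∣m     : M ∣ m

-- A prime r dividing M * s is at most M and therefore divides s itself, so (M * s) / r = M * (s /
-- r). At y = x ^ M the field `primitive-order` then says that no such quotient is an exponent of x.
primeFactor⇒CycPrime : ∀ M s → 2 ≤ M → 0 < s → Cyc M s → ∀ p → Prime p →
  ∀ x → 1 ≤ x → (V : CycVal M s (x ^ M)) → p ∣ CycVal.F V → CycPrime (M * s)
primeFactor⇒CycPrime M s 2≤M s>0 _ zero pp x 1≤x V p∣F = contradiction (prime-≥2 pp) λ ()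
primeFactor⇒CycPrime M s 2≤M s>0 (big , small , _) (suc m) pp x 1≤x V p∣F = record
  { m = m ; p-prime = pp ; x = x ; 1≤x = 1≤x ; x^M = x^Ms
  ; exact = exact
  ; M∣m = exact m (≈⇒One m 1≤x (fermat pp (+ x) x≉0)) }
  where
  module V = CycVal V
  x^Ms : One (suc m) x (M * s)
  x^Ms = One-pow x M s (V.F∣⇒One (suc m) p∣F)
  x≉0 : ¬ (+ x) ≈[ suc m ] ℤ.0ℤ
  x≉0 h = V.p∣F⇒p∤y (suc m) pp p∣F (p∣x^ M 2≤M)
    where
    p∣x^ : ∀ n → 2 ≤ n → suc m ∣ x ^ n
    p∣x^ (suc n) _ = ∣m⇒∣m*n (x ^ n) (≈0⇒∣ h)
  M>0 : 0 < M
  M>0 = ≤-trans (s≤s z≤n) 2≤M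
  exact : ∀ d → One (suc m) x d → M * s ∣ d
  exact d = order-divides (M * s) d 1≤x (*-mono-≤ {1} {M} {1} {s} M>0 s>0) order x^Ms
    where
    r≤M : ∀ r → Prime r → r ∣ M * s → r ≤ M
    r≤M r pr d with r ≤? M
    ... | yes h = h
    ... | no ¬h with euclidsLemma M s pr d
    ...   | inj₁ r∣M = ∣⇒≤ {{>-nonZero M>0}} r∣M
    ...   | inj₂ r∣s = contradiction r∣s (big r pr (≰⇒> ¬h))
    order : ∀ r t → Prime r → M * s ≡ r * t → ¬ One (suc m) x t
    order r t pr eq o with small r pr (r≤M r pr (divides t (trans eq (*-comm r t))))
    ... | divides s' s≡ = V.primitive-order (suc m) pp p∣F r pr (r≤M r pr (divides t (trans eq (*-comm r t)))) s' (trans s≡ (*-comm s' r))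
      (One-pow⁻ x M s' (subst (One (suc m) x) t≡ o))
      where
      lem : ∀ M s' r → M * (s' * r) ≡ r * (M * s')
      lem = ℕ-Ring.solve-∀
      t≡ : t ≡ M * s'
      t≡ = *-cancelˡ-≡ t (M * s') r {{prime⇒nonZero pr}} (trans (sym eq) (trans (cong (M *_) s≡) (lem M s' r)))

∃CycPrime : ∀ M → 2 ≤ M → ∃ λ c → 0 < c × CycPrime (M * c)
∃CycPrime (suc zero) (s≤s ())
∃CycPrime M@(suc (suc k)) 2≤M with cyc-exists k
... | s , s>0 , cyc@(_ , _ , value) = s , s>0 , finish (prime-divisor F (V.F≢1 y≢0) V.F≢0)
  where
  x≢0 : NonZero (M !)
  x≢0 = M !≢0
  1≤x : 1 ≤ M !
  1≤x = >-nonZero⁻¹ (M !) {{x≢0}}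
  -- The base M ! contains every prime up to M, as `Cyc` requires; the exponent M turns order s for
  -- y into order M * s for M !.
  y = (M !) ^ M
  2≤y : 2 ≤ y
  2≤y = ≤-trans (*-monoʳ-≤ 2 {1} {(suc k) !} (>-nonZero⁻¹ _ {{(suc k) !≢0}})) (≤-trans (*-monoˡ-≤ ((suc k) !) 2≤M) (m≤m*n (M !) ((M !) ^ suc k) {{m^n≢0 (M !) (suc k) {{x≢0}}}}))
  y≢0 : y ≢ 0
  y≢0 e = contradiction (subst (2 ≤_) e 2≤y) λ ()
  V = value y 2≤y (λ r pr r≤ → ∣m⇒∣m*n ((M !) ^ suc k) (r∣n! r pr M r≤))
    where
    r∣n! : ∀ r → Prime r → ∀ n → r ≤ n → r ∣ n !
    r∣n! r pr n r≤n = ∣-trans (r∣r! r pr) (m≤n⇒m!∣n! r≤n)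
      where
      r∣r! : ∀ r → Prime r → r ∣ r !
      r∣r! zero pr = contradiction (prime-≥2 pr) λ ()
      r∣r! (suc r) pr = m∣m*n (r !)
  module V = CycVal V
  F = V.F
  finish : (∃ λ p → Prime p × p ∣ F) → CycPrime (M * s)
  finish (p , pp , p∣F) = primeFactor⇒CycPrime M s 2≤M s>0 cyc p pp (M !) 1≤x V p∣F

-- Finite counting and roots of polynomials

sum-mono-≤ : ∀ {n} {f g : Fin n → ℕ} → (∀ i → f i ≤ g i) → sum f ≤ sum g
sum-mono-≤ {zero} h = z≤n
sum-mono-≤ {suc n} h = +-mono-≤ (h zero) (sum-mono-≤ (h ∘ suc))

sum-*ˡ : ∀ {n} c (f : Fin n → ℕ) → sum (λ i → c * f i) ≡ c * sum f
sum-*ˡ {zero} c f = sym (*-zeroʳ c)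
sum-*ˡ {suc n} c f = trans (cong (λ z → c * f zero + z) (sum-*ˡ c (f ∘ suc))) (sym (*-distribˡ-+ c (f zero) _))

sum-*ʳ : ∀ {n} c (f : Fin n → ℕ) → sum (λ i → f i * c) ≡ sum f * c
sum-*ʳ c f = trans (sum-cong-≗ (λ i → *-comm (f i) c)) (trans (sum-*ˡ c f) (*-comm c _))

sum-const : ∀ n c → sum {n} (λ _ → c) ≡ n * c
sum-const zero c = refl
sum-const (suc n) c = cong (λ z → c + z) (sum-const n c)

sum-≤-const : ∀ {n} {f : Fin n → ℕ} c → (∀ i → f i ≤ c) → sum f ≤ n * c
sum-≤-const {n} c h = ≤-trans (sum-mono-≤ h) (≤-reflexive (sum-const n c))

sum-≥-at : ∀ {n} (f : Fin n → ℕ) i → f i ≤ sum f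
sum-≥-at f zero = m≤m+n (f zero) _
sum-≥-at f (suc i) = ≤-trans (sum-≥-at (f ∘ suc) i) (m≤n+m _ (f zero))

∃-sum-< : ∀ {n} (f g : Fin n → ℕ) → sum f < sum g → ∃ λ i → f i < g i
∃-sum-< {suc n} f g h with f zero <? g zero
... | yes h0 = zero , h0
... | no ¬h0 with ∃-sum-< (f ∘ suc) (g ∘ suc) (≰⇒> (λ le → <⇒≱ h (+-mono-≤ (≮⇒≥ ¬h0) le)))
...   | i , hi = suc i , hi

sum-tight : ∀ {n} κ (f : Fin n → ℕ) → (∀ i → f i ≤ κ) → n * κ ≤ sum f → ∀ i → f i ≡ κ
sum-tight {suc n} κ f ub lb zero = ≤-antisym (ub zero) (+-cancelʳ-≤ (n * κ) κ (f zero) (≤-trans lb (+-monoʳ-≤ (f zero) (sum-≤-const κ (ub ∘ suc)))))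
sum-tight {suc n} κ f ub lb (suc i) = sum-tight κ (f ∘ suc) (ub ∘ suc) (+-cancelˡ-≤ κ _ _ (≤-trans lb (+-monoˡ-≤ _ (ub zero)))) i

⟦_⟧ : ∀ {A : Set} → Dec A → ℕ
⟦ yes _ ⟧ = 1
⟦ no _ ⟧ = 0

⟦⟧≤1 : ∀ {A : Set} (d : Dec A) → ⟦ d ⟧ ≤ 1
⟦⟧≤1 (yes _) = ≤-refl
⟦⟧≤1 (no _) = z≤n

⟦⟧-yes : ∀ {A : Set} (d : Dec A) → A → ⟦ d ⟧ ≡ 1
⟦⟧-yes (yes _) _ = refl
⟦⟧-yes (no ¬a) a = contradiction a ¬a

⟦⟧-no : ∀ {A : Set} (d : Dec A) → ¬ A → ⟦ d ⟧ ≡ 0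
⟦⟧-no (yes a) ¬a = contradiction a ¬a
⟦⟧-no (no _) _ = refl

⟦⟧-holds : ∀ {A : Set} (d : Dec A) → 0 < ⟦ d ⟧ → A
⟦⟧-holds (yes a) _ = a

⟦⟧-⇔ : ∀ {A B : Set} (d : Dec A) (d' : Dec B) → (A → B) → (B → A) → ⟦ d ⟧ ≡ ⟦ d' ⟧
⟦⟧-⇔ (yes a) d' f g = sym (⟦⟧-yes d' (f a))
⟦⟧-⇔ (no ¬a) d' f g = sym (⟦⟧-no d' (¬a ∘ g))

count : ∀ {n} {P : Fin n → Set} → (∀ i → Dec (P i)) → ℕ
count P? = sum (λ i → ⟦ P? i ⟧)

record Enum {n : ℕ} (N : ℕ) (P : Fin n → Set) : Set where
  field
    to     : Fin N → Fin n
    to-inj : ∀ {i j} → to i ≡ to j → i ≡ j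
    sat    : ∀ i → P (to i)
    index  : ∀ i → P i → Fin N
    to-index : ∀ i h → to (index i h) ≡ i

enum : ∀ {n} {P : Fin n → Set} (P? : ∀ i → Dec (P i)) → Enum (count P?) P
enum {zero} P? = record { to = λ () ; to-inj = λ { {()} } ; sat = λ () ; index = λ () ; to-index = λ () }
enum {suc n} {P} P? = go (P? zero) (enum (P? ∘ suc))
  where
  go : (d : Dec (P zero)) → Enum (count (P? ∘ suc)) (P ∘ suc) → Enum (⟦ d ⟧ + count (P? ∘ suc)) P
  go (yes h) E = record { to = to' ; to-inj = inj' ; sat = sat' ; index = index' ; to-index = ti' }
    where
    open Enum E
    to' : Fin (suc (count (P? ∘ suc))) → Fin (suc n)
    to' zero = zero
    to' (suc j) = suc (to j)
    inj' : ∀ {i j} → to' i ≡ to' j → i ≡ j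
    inj' {zero} {zero} e = refl
    inj' {suc i} {suc j} e = cong suc (to-inj (Fin.suc-injective e))
    sat' : ∀ i → P (to' i)
    sat' zero = h
    sat' (suc j) = sat j
    index' : ∀ i → P i → Fin (suc (count (P? ∘ suc)))
    index' zero _ = zero
    index' (suc i) p = suc (index i p)
    ti' : ∀ i p → to' (index' i p) ≡ i
    ti' zero _ = refl
    ti' (suc i) p = cong suc (to-index i p)
  go (no ¬h) E = record { to = suc ∘ to ; to-inj = λ e → to-inj (Fin.suc-injective e) ; sat = sat
    ; index = λ { zero p → contradiction p ¬h ; (suc i) p → index i p }
    ; to-index = λ { zero p → contradiction p ¬h ; (suc i) p → cong suc (to-index i p) } }
    where open Enum E

count-inj : ∀ {n m} {P : Fin n → Set} {Q : Fin m → Set} (P? : ∀ i → Dec (P i)) (Q? : ∀ i → Dec (Q i))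
  (f : ∀ i → P i → Fin m) → (∀ i h → Q (f i h)) → (∀ i j h h' → f i h ≡ f j h' → i ≡ j) → count P? ≤ count Q?
count-inj P? Q? f sat-f inj-f = Fin.injective⇒≤ {f = g} λ {i} {j} e → EP.to-inj (inj-f _ _ (EP.sat i) (EP.sat j)
  (trans (sym (EQ.to-index _ (sat-f _ _))) (trans (cong EQ.to e) (EQ.to-index _ (sat-f _ _)))))
  where
  module EP = Enum (enum P?)
  module EQ = Enum (enum Q?)
  g : Fin (count P?) → Fin (count Q?)
  g i = EQ.index (f (EP.to i) (EP.sat i)) (sat-f _ _)

count-exclusive : ∀ {n} {P : Fin n → Set} {A : Set} (P? : ∀ i → Dec (P i)) (A? : Dec A) →
  (∀ i → P i → A) → (∀ i j → P i → P j → i ≡ j) → count P? ≤ ⟦ A? ⟧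
count-exclusive {zero} P? A? f u = z≤n
count-exclusive {suc n} P? A? f u with P? zero
... | no _ = count-exclusive (P? ∘ suc) A? (f ∘ suc) (λ i j p q → Fin.suc-injective (u _ _ p q))
... | yes h = ≤-reflexive (trans (cong suc (none (P? ∘ suc) λ i p → Fin.0≢1+n (u _ _ h p))) (sym (⟦⟧-yes A? (f zero h))))
  where
  none : ∀ {m} {Q : Fin m → Set} (Q? : ∀ i → Dec (Q i)) → (∀ i → ¬ Q i) → count Q? ≡ 0
  none {zero} Q? no-Q = refl
  none {suc m} Q? no-Q = cong₂ _+_ (⟦⟧-no (Q? zero) (no-Q zero)) (none (Q? ∘ suc) (no-Q ∘ suc))

-- The leading coefficient 1 is not listed.
evalMonic : ∀ {n} → Vec ℤ n → ℤ → ℤ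
evalMonic [] x = ℤ.1ℤ
evalMonic (c ∷ cs) x = c ℤ.+ x ℤ.* evalMonic cs x

quotientBy : ∀ {n} → ℤ → Vec ℤ (suc n) → Vec ℤ n
quotientBy {zero} a cs = []
quotientBy {suc n} a (c ∷ cs) = evalMonic cs a ∷ quotientBy a cs

evalMonic-factor : ∀ {n} (cs : Vec ℤ (suc n)) a x →
  evalMonic cs x ≡ evalMonic cs a ℤ.+ (x ℤ.- a) ℤ.* evalMonic (quotientBy a cs) x
evalMonic-factor (c ∷ []) a x = lem c a x
  where
  lem : ∀ c a x → c ℤ.+ x ℤ.* ℤ.1ℤ ≡ (c ℤ.+ a ℤ.* ℤ.1ℤ) ℤ.+ (x ℤ.- a) ℤ.* ℤ.1ℤ
  lem = ℤ-Ring.solve-∀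
evalMonic-factor (c ∷ cs@(_ ∷ _)) a x =
  trans (cong (λ z → c ℤ.+ x ℤ.* z) (evalMonic-factor cs a x)) (lem c x a (evalMonic cs a) (evalMonic (quotientBy a cs) x))
  where
  lem : ∀ c x a F G → c ℤ.+ x ℤ.* (F ℤ.+ (x ℤ.- a) ℤ.* G) ≡ (c ℤ.+ a ℤ.* F) ℤ.+ (x ℤ.- a) ℤ.* (F ℤ.+ x ℤ.* G)
  lem = ℤ-Ring.solve-∀

evalPower : ∀ n c x → evalMonic (c ∷ Vec.replicate n ℤ.0ℤ) x ≡ x ℤ.^ suc n ℤ.+ c
evalPower n c x = trans (ℤ.+-comm c _) (cong (λ z → x ℤ.* z ℤ.+ c) (zeros n))
  where
  zeros : ∀ n → evalMonic (Vec.replicate n ℤ.0ℤ) x ≡ x ℤ.^ n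
  zeros zero = refl
  zeros (suc n) = trans (ℤ.+-identityˡ _) (cong (x ℤ.*_) (zeros n))

module _ {p : ℕ} (pp : Prime p) where
  open PrimeField pp

  -- Lagrange's theorem: dividing by the linear factor of one root leaves the other roots, since a
  -- prime modulus has no zero divisors.
  too-many-roots : ∀ {n} (cs : Vec ℤ n) (r : Fin (suc n) → ℤ) → (∀ i j → r i ≈[ p ] r j → i ≡ j) →
    ¬ (∀ i → evalMonic cs (r i) ≈[ p ] ℤ.0ℤ)
  too-many-roots [] r inj root = 1≉0 (root zero)
  too-many-roots cs@(_ ∷ _) r inj root = too-many-roots (quotientBy a cs) (r ∘ suc)
    (λ i j e → Fin.suc-injective (inj _ _ e)) root'
    where
    a = r zero
    root' : ∀ i → evalMonic (quotientBy a cs) (r (suc i)) ≈[ p ] ℤ.0ℤ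
    root' i with *≈0 (r (suc i) ℤ.- a) {evalMonic (quotientBy a cs) (r (suc i))} prod≈0
      where
      G = evalMonic (quotientBy a cs) (r (suc i))
      prod≈0 : (r (suc i) ℤ.- a) ℤ.* G ≈[ p ] ℤ.0ℤ
      prod≈0 = ≈-trans (≈-reflexive (sym (ℤ.+-identityˡ _))) (≈-trans (≈-+ (≈-sym (root zero)) ≈-refl)
        (≈-trans (≈-reflexive (sym (evalMonic-factor cs a (r (suc i))))) (root (suc i))))
    ... | inj₁ e = contradiction (inj (suc i) zero (-≈0⇒≈ e)) λ ()
    ... | inj₂ e = e

  power-roots : ∀ n c (r : Fin (suc (suc n)) → ℤ) → (∀ i j → r i ≈[ p ] r j → i ≡ j) →
    ¬ (∀ i → r i ℤ.^ suc n ≈[ p ] c)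
  power-roots n c r inj root = too-many-roots (ℤ.- c ∷ Vec.replicate n ℤ.0ℤ) r inj
    (λ i → ≈-trans (≈-reflexive (evalPower n (ℤ.- c) (r i))) (≈⇒-≈0 (root i)))

  count-power-roots : ∀ n c → count (λ (i : Fin p) → (ι i ℤ.^ suc n) ≈? c) ≤ suc n
  count-power-roots n c = ≮⇒≥ λ h → power-roots n c (λ j → ι (E.to (Fin.inject≤ j h)))
    (λ i j e → Fin.inject≤-injective h h i j (E.to-inj (ι-injective e))) (λ i → E.sat _)
    where module E = Enum (enum (λ (i : Fin p) → (ι i ℤ.^ suc n) ≈? c))

-- Power residue classes

-- The e colours are the cosets of the subgroup of order κ in the units modulo p, the e-th power
-- residues, and `unit` is that subgroup. The interface hides how colours are computed; `col-neg`
-- expresses that -1 lies in the subgroup.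
record Colouring (p e κ : ℕ) : Set₁ where
  field
    p-prime     : Prime p
    p≡          : p ≡ suc (e * κ)
    Col         : Fin e → ℤ → Set
    Col?        : ∀ c x → Dec (Col c x)
    unit        : Fin e
    col-cong    : ∀ {c x y} → x ≈[ p ] y → Col c x → Col c y
    col-unique  : ∀ {c c' x} → Col c x → Col c' x → c ≡ c'
    col-nonzero : ∀ {c x} → Col c x → ¬ x ≈[ p ] ℤ.0ℤ
    col-count   : ∀ c → count (λ (i : Fin p) → Col? c (ι i)) ≡ κ
    col-*       : ∀ {c h x} → Col unit h → Col c x → Col c (h ℤ.* x)
    col-ratio   : ∀ {c x y z} → Col c x → Col c y → x ≈[ p ] z ℤ.* y → Col unit z
    col-neg     : ∀ {c x} → Col c x → Col c (ℤ.- x)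

^-distrib-* : ∀ x y n → (x ℤ.* y) ℤ.^ n ≡ x ℤ.^ n ℤ.* y ℤ.^ n
^-distrib-* x y zero = refl
^-distrib-* x y (suc n) = trans (cong (x ℤ.* y ℤ.*_) (^-distrib-* x y n)) (lem x y (x ℤ.^ n) (y ℤ.^ n))
  where
  lem : ∀ x y a b → x ℤ.* y ℤ.* (a ℤ.* b) ≡ x ℤ.* a ℤ.* (y ℤ.* b)
  lem = ℤ-Ring.solve-∀

1^ : ∀ n → ℤ.1ℤ ℤ.^ n ≡ ℤ.1ℤ
1^ zero = refl
1^ (suc n) = trans (ℤ.*-identityˡ _) (1^ n)

neg-^-even : ∀ x n → (ℤ.- x) ℤ.^ (2 * n) ≡ x ℤ.^ (2 * n)
neg-^-even x n = trans (sym (ℤ.^-*-assoc (ℤ.- x) 2 n)) (trans (cong (ℤ._^ n) (lem x)) (ℤ.^-*-assoc x 2 n))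
  where
  lem : ∀ x → ℤ.- x ℤ.* (ℤ.- x ℤ.* ℤ.1ℤ) ≡ x ℤ.* (x ℤ.* ℤ.1ℤ)
  lem = ℤ-Ring.solve-∀

module PowerResidues {m : ℕ} (pp : Prime (suc m)) (e' h : ℕ) (m≡ : m ≡ suc e' * (2 * suc h))
  (ζ : ℤ) (ζ^e : ζ ℤ.^ suc e' ≈[ suc m ] ℤ.1ℤ)
  (ζ-inj : ∀ (i j : Fin (suc e')) → ζ ℤ.^ toℕ i ≈[ suc m ] ζ ℤ.^ toℕ j → i ≡ j) where
  open PrimeField pp
  p = suc m
  e = suc e'
  κ = 2 * suc h

  ζ≉0 : ¬ ζ ≈[ p ] ℤ.0ℤ
  ζ≉0 z = 1≉0 (≈-trans (≈-sym ζ^e) (≈-trans (≈-* z ≈-refl) (≈-reflexive (ℤ.*-zeroˡ (ζ ℤ.^ e')))))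

  -- By Fermat x ^ κ is a root of X ^ e = 1, and the e distinct powers of ζ leave no room for
  -- another root.
  exists : ∀ {x} → ¬ x ≈[ p ] ℤ.0ℤ → ∃ λ (c : Fin e) → x ℤ.^ κ ≈[ p ] ζ ℤ.^ toℕ c
  exists {x} x≉0 with Fin.any? (λ (c : Fin e) → (x ℤ.^ κ) ≈? (ζ ℤ.^ toℕ c))
  ... | yes h = h
  ... | no ¬h = ⊥-elim (power-roots pp e' ℤ.1ℤ r r-inj root)
    where
    r : Fin (suc e) → ℤ
    r zero = x ℤ.^ κ
    r (suc i) = ζ ℤ.^ toℕ i
    r-inj : ∀ i j → r i ≈[ p ] r j → i ≡ j
    r-inj zero zero _ = refl
    r-inj zero (suc j) e = contradiction (j , e) ¬h
    r-inj (suc i) zero e = contradiction (i , ≈-sym e) ¬h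
    r-inj (suc i) (suc j) e = cong suc (ζ-inj i j e)
    root : ∀ i → r i ℤ.^ e ≈[ p ] ℤ.1ℤ
    root zero = ≈-trans (≈-reflexive (trans (ℤ.^-*-assoc x κ e) (cong (x ℤ.^_) (trans (*-comm κ e) (sym m≡))))) (fermat pp x x≉0)
    root (suc i) = ≈-trans (≈-reflexive (trans (ℤ.^-*-assoc ζ (toℕ i) e) (trans (cong (ζ ℤ.^_) (*-comm (toℕ i) e)) (sym (ℤ.^-*-assoc ζ e (toℕ i))))))
      (≈-trans (≈-^ (toℕ i) ζ^e) (≈-reflexive (1^ (toℕ i))))

  nonzero : ∀ {x c} → x ℤ.^ κ ≈[ p ] ζ ℤ.^ c → ¬ x ≈[ p ] ℤ.0ℤ
  nonzero {x} {c} hx z = ^≉0 c ζ≉0 (≈-trans (≈-sym hx) (≈-trans (≈-^ κ z) (≈-reflexive refl)))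

  class? : ∀ (c : Fin e) (i : Fin p) → Dec (ι i ℤ.^ κ ≈[ p ] ζ ℤ.^ toℕ c)
  class? c i = (ι i ℤ.^ κ) ≈? (ζ ℤ.^ toℕ c)

  -- A class consists of roots of X ^ κ = ζ ^ c and has at most κ members. The e classes cover all p
  -- - 1 = e * κ units, so every bound is attained.
  class-size : ∀ c → count (class? c) ≡ κ
  class-size = sum-tight κ (λ c → count (class? c)) (λ c → count-power-roots pp (h + suc (h + 0)) (ζ ℤ.^ toℕ c))
    (subst (_≤ sum (λ c → count (class? c))) m≡ total)
    where
    total : m ≤ sum (λ c → count (class? c))
    total = subst (m ≤_) (∑-comm (λ i c → ⟦ class? c i ⟧)) (≤-trans (≤-reflexive (trans (sym (*-identityʳ m)) (sym (sum-const m 1))))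
      (≤-trans (sum-mono-≤ {f = λ _ → 1} at-least-one) (m≤n+m _ (sum (λ c → ⟦ class? c zero ⟧)))))
      where
      at-least-one : ∀ i → 1 ≤ sum (λ c → ⟦ class? c (suc i) ⟧)
      at-least-one i with exists {ι (Fin.suc i)} (ι≉0 i)
      ... | c , hc = ≤-trans (≤-reflexive (sym (⟦⟧-yes (class? c (suc i)) hc))) (sum-≥-at (λ c → ⟦ class? c (suc i) ⟧) c)

  colouring : Colouring p e κ
  colouring = record
    { p-prime = pp
    ; p≡ = cong suc m≡
    ; Col = λ c x → x ℤ.^ κ ≈[ p ] ζ ℤ.^ toℕ c
    ; Col? = λ c x → (x ℤ.^ κ) ≈? (ζ ℤ.^ toℕ c)
    ; unit = zero
    ; col-cong = λ x≈y hx → ≈-trans (≈-sym (≈-^ κ x≈y)) hx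
    ; col-unique = λ {c} {c'} hx hx' → ζ-inj c c' (≈-trans (≈-sym hx) hx')
    ; col-nonzero = λ {c} → nonzero {c = toℕ c}
    ; col-count = class-size
    ; col-* = λ {c} {h} {x} hh hx → ≈-trans (≈-reflexive (^-distrib-* h x κ)) (≈-trans (≈-* hh hx) (≈-reflexive (ℤ.*-identityˡ _)))
    ; col-ratio = λ {c} {x} {y} {z} hx hy x≈zy → *-cancelˡ-≈ {y ℤ.^ κ} (z ℤ.^ κ) ℤ.1ℤ (^≉0 {y} κ (nonzero {y} {toℕ c} hy))
        (≈-trans (≈-reflexive (trans (ℤ.*-comm (y ℤ.^ κ) (z ℤ.^ κ)) (sym (^-distrib-* z y κ))))
          (≈-trans (≈-sym (≈-^ κ x≈zy)) (≈-trans hx (≈-trans (≈-sym hy) (≈-reflexive (sym (ℤ.*-identityʳ _)))))))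
    ; col-neg = λ {c} {x} hx → ≈-trans (≈-reflexive (neg-^-even x (suc h))) hx
    }

-- An element x of order M = 2 * e * K * c gives the root of unity x ^ (M / e) of order e. The
-- factor 2 makes κ even and puts -1 into the unit class; the factor K is handed on to impose
-- divisibility and size later.
∃Colouring : ∀ e K → 0 < e → 0 < K → ∃₂ λ κ h → Colouring (suc (e * κ)) e κ × κ ≡ 2 * (K * h) × 0 < h
∃Colouring e@(suc e') K@(suc _) 0<e 0<K with ∃CycPrime (2 * e * K) (*-mono-≤ {2} {2 * e} {1} {K} (*-mono-≤ {2} {2} {1} {e} ≤-refl 0<e) 0<K)
... | c , c>0 , P = build M∣m
  where
  open CycPrime P
  M = 2 * e * K * c
  c' = 2 * K * c
  M≡ : M ≡ c' * e
  M≡ = lem e K c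
    where
    lem : ∀ e K c → 2 * e * K * c ≡ 2 * K * c * e
    lem = ℕ-Ring.solve-∀
  instance
    c≢0 : NonZero c
    c≢0 = >-nonZero c>0
    c'≢0 : NonZero c'
    c'≢0 = m*n≢0 (2 * K) c
  ζ = (+ x) ℤ.^ c'
  x≉0 : ¬ (+ x) ≈[ suc m ] ℤ.0ℤ
  x≉0 z = PrimeField.1≉0 p-prime (≈-trans (≈-sym (One⇒≈ x^M)) (zero-pow M (subst (0 <_) (sym M≡) (>-nonZero⁻¹ (c' * e) {{m*n≢0 c' e}}))))
    where
    zero-pow : ∀ n → 0 < n → (+ x) ℤ.^ n ≈[ suc m ] ℤ.0ℤ
    zero-pow (suc n) _ = ≈-trans (≈-* z ≈-refl) (≈-reflexive (ℤ.*-zeroˡ ((+ x) ℤ.^ n)))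
  ζ^e : ζ ℤ.^ e ≈[ suc m ] ℤ.1ℤ
  ζ^e = ≈-trans (≈-reflexive (trans (ℤ.^-*-assoc (+ x) c' e) (cong ((+ x) ℤ.^_) (sym M≡)))) (One⇒≈ x^M)
  ζ≉0 : ¬ ζ ≈[ suc m ] ℤ.0ℤ
  ζ≉0 = PrimeField.^≉0 p-prime c' x≉0
  ζ-lt : ∀ i d → d < e → ζ ℤ.^ (i + d) ≈[ suc m ] ζ ℤ.^ i → d ≡ 0
  ζ-lt i zero d<e _ = refl
  ζ-lt i d@(suc _) d<e eq = contradiction (∣⇒≤ (*-cancelˡ-∣ c' (subst (_∣ c' * d) M≡ (exact (c' * d) (≈⇒One (c' * d) 1≤x ζ^d)))))
    (<⇒≱ d<e)
    where
    ζ^d : (+ x) ℤ.^ (c' * d) ≈[ suc m ] ℤ.1ℤ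
    ζ^d = ≈-trans (≈-reflexive (sym (ℤ.^-*-assoc (+ x) c' d)))
      (PrimeField.*-cancelˡ-≈ p-prime {ζ ℤ.^ i} (ζ ℤ.^ d) ℤ.1ℤ (PrimeField.^≉0 p-prime i ζ≉0)
        (≈-trans (≈-reflexive (sym (ℤ.^-distribˡ-+-* ζ i d))) (≈-trans eq (≈-reflexive (sym (ℤ.*-identityʳ _))))))
  ζ-le : ∀ i j → i ≤ j → j < e → ζ ℤ.^ j ≈[ suc m ] ζ ℤ.^ i → i ≡ j
  ζ-le i j i≤j j<e eq = trans (sym (+-identityʳ i)) (trans (cong (λ z → i + z) (sym (ζ-lt i (j ∸ i) (≤-<-trans (m∸n≤m j i) j<e)
    (≈-trans (≈-reflexive (cong (ζ ℤ.^_) (m+[n∸m]≡n i≤j))) eq)))) (m+[n∸m]≡n i≤j))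
  ζ-inj : ∀ (i j : Fin e) → ζ ℤ.^ toℕ i ≈[ suc m ] ζ ℤ.^ toℕ j → i ≡ j
  ζ-inj i j eq with ≤-total (toℕ i) (toℕ j)
  ... | inj₁ i≤j = Fin.toℕ-injective (ζ-le (toℕ i) (toℕ j) i≤j (Fin.toℕ<n j) (≈-sym eq))
  ... | inj₂ j≤i = sym (Fin.toℕ-injective (ζ-le (toℕ j) (toℕ i) j≤i (Fin.toℕ<n i) eq))
  build : M ∣ m → ∃₂ λ κ h → Colouring (suc (e * κ)) e κ × κ ≡ 2 * (K * h) × 0 < h
  build (divides zero eq) = contradiction (subst (2 ≤_) (cong suc eq) (prime-≥2 p-prime)) λ { (s≤s ()) }
  build (divides q@(suc _) eq) = go (K * (c * q)) refl
    where
    lem : ∀ e K c q → q * (2 * e * K * c) ≡ e * (2 * (K * (c * q)))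
    lem = ℕ-Ring.solve-∀
    go : ∀ h → h ≡ K * (c * q) → ∃₂ λ κ h → Colouring (suc (e * κ)) e κ × κ ≡ 2 * (K * h) × 0 < h
    go zero h≡ = contradiction h≡ (m<n⇒n≢0 {0} (>-nonZero⁻¹ _ {{m*n≢0 K (c * q) {{it}} {{m*n≢0 c q}}}}) ∘ sym)
      where it : NonZero K ; it = _
    go (suc h) h≡ = 2 * suc h , c * q , subst (λ z → Colouring (suc z) e (2 * suc h)) m≡
        (PowerResidues.colouring p-prime e' h m≡ ζ ζ^e ζ-inj) , cong (2 *_) h≡ , >-nonZero⁻¹ (c * q) {{m*n≢0 c q}}
      where
      m≡ : m ≡ e * (2 * suc h)
      m≡ = trans eq (trans (lem e K c q) (cong (λ z → e * (2 * z)) (sym h≡)))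

-- Differences with prescribed residue classes

⟦⟧-* : ∀ {A B : Set} (d : Dec A) (d' : Dec B) → ⟦ d ⟧ * ⟦ d' ⟧ ≡ ⟦ d ×-dec d' ⟧
⟦⟧-* (yes _) (yes _) = refl
⟦⟧-* (yes _) (no _) = refl
⟦⟧-* (no _) (yes _) = refl
⟦⟧-* (no _) (no _) = refl

sum-product : ∀ {n m} (f : Fin n → ℕ) (g : Fin m → ℕ) → sum f * sum g ≡ sum (λ a → sum (λ b → f a * g b))
sum-product f g = trans (sym (sum-*ʳ (sum g) f)) (sum-cong-≗ (λ a → sym (sum-*ˡ (f a) g)))

sum-move : ∀ {l n m} (G : Fin l → Fin n → Fin m → ℕ) →
  sum (λ c → sum (λ x → sum (λ a → G c x a))) ≡ sum (λ a → sum (λ c → sum (λ x → G c x a)))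
sum-move G = trans (sum-cong-≗ (λ c → ∑-comm (G c))) (∑-comm (λ c a → sum (λ x → G c x a)))

2ab≤a²+b² : ∀ y s → 8 * (s * y) ≤ 4 * (y * y) + 4 * (s * s)
2ab≤a²+b² y s with ≤-total y s
... | inj₁ y≤s = subst (λ z → 8 * (z * y) ≤ 4 * (y * y) + 4 * (z * z)) (m+[n∸m]≡n y≤s) (≤-trans (m≤m+n _ (4 * (d * d))) (≤-reflexive (lem y d)))
  where
  d = s ∸ y
  lem : ∀ y d → 8 * ((y + d) * y) + 4 * (d * d) ≡ 4 * (y * y) + 4 * ((y + d) * (y + d))
  lem = ℕ-Ring.solve-∀
... | inj₂ s≤y = subst (λ z → 8 * (s * z) ≤ 4 * (z * z) + 4 * (s * s)) (m+[n∸m]≡n s≤y) (≤-trans (m≤m+n _ (4 * (d * d))) (≤-reflexive (lem s d)))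
  where
  d = y ∸ s
  lem : ∀ s d → 8 * (s * (s + d)) + 4 * (d * d) ≡ 4 * ((s + d) * (s + d)) + 4 * (s * s)
  lem = ℕ-Ring.solve-∀

-- The inequality says 4 * (s - y) ^ 2 ≥ s ^ 2, which follows from s - y > s / 2. It makes every
-- poor point pay s ^ 2 in Chebyshev's argument.
2ab+gap≤a²+b² : ∀ y s → 2 * y < s → 8 * (s * y) + s * s ≤ 4 * (y * y) + 4 * (s * s)
2ab+gap≤a²+b² y s 2y<s = subst (λ z → 8 * (z * y) + z * z ≤ 4 * (y * y) + 4 * (z * z)) (m+[n∸m]≡n (<⇒≤ 2y<s))
  (≤-trans (m≤m+n _ (d * (4 * y + 3 * d))) (≤-reflexive (lem y d)))
  where
  d = s ∸ 2 * y
  lem : ∀ y d → 8 * ((2 * y + d) * y) + (2 * y + d) * (2 * y + d) + d * (4 * y + 3 * d) ≡ 4 * (y * y) + 4 * ((2 * y + d) * (2 * y + d))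
  lem = ℕ-Ring.solve-∀

module SecondMoment {p e κ : ℕ} (C : Colouring p e κ) where
  open Colouring C
  open PrimeField p-prime

  χ : Fin e → ℤ → ℕ
  χ c d = ⟦ Col? c d ⟧

  _⊖_ : Fin p → Fin p → ℤ
  a ⊖ x = ι a ℤ.- ι x

  χ-shift : ∀ c a → sum (λ x → χ c (a ⊖ x)) ≡ κ
  χ-shift c a = trans (sum-cong-≗ (λ x → ⟦⟧-⇔ (Col? c (a ⊖ x)) (Col? c (ι (f x)))
      (col-cong (≈-sym (red-≈ p (a ⊖ x)))) (col-cong (red-≈ p (a ⊖ x)))))
    (trans (sym (sum-permute (λ i → χ c (ι i)) (inj⇒perm f f-inj))) (col-count c))
    where
    f : Fin p → Fin p
    f x = red p (a ⊖ x)
    f-inj : ∀ {x y} → f x ≡ f y → x ≡ y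
    f-inj {x} {y} h = ι-injective (≈-comb₁ (ℤ.- ℤ.1ℤ) (red-injective h) (lem (ι a) (ι x) (ι y)))
      where
      lem : ∀ a x y → x ≡ y ℤ.+ ℤ.- ℤ.1ℤ ℤ.* ((a ℤ.- x) ℤ.- (a ℤ.- y))
      lem = ℤ-Ring.solve-∀

  -- The substitution z = (a - x) / (b - x) maps the x with a - x, b - x in the same class into the unit class.
  same-class : ∀ a b → a ≢ b → sum (λ c → sum (λ x → χ c (a ⊖ x) * χ c (b ⊖ x))) ≤ κ
  same-class a b a≢b = ≤-trans (≤-reflexive (∑-comm (λ c x → χ c (a ⊖ x) * χ c (b ⊖ x))))
    (≤-trans (sum-mono-≤ {g = λ x → ⟦ Q? x ⟧} per-x)
    (≤-trans (count-inj Q? (λ i → Col? unit (ι i)) f f-sat f-inj) (≤-reflexive (col-count unit))))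
    where
    Q : Fin p → Set
    Q x = ∃ λ c → Col c (a ⊖ x) × Col c (b ⊖ x)
    Q? : ∀ x → Dec (Q x)
    Q? x = Fin.any? (λ c → Col? c (a ⊖ x) ×-dec Col? c (b ⊖ x))
    per-x : ∀ x → sum (λ c → χ c (a ⊖ x) * χ c (b ⊖ x)) ≤ ⟦ Q? x ⟧
    per-x x = ≤-trans (≤-reflexive (sum-cong-≗ (λ c → ⟦⟧-* (Col? c (a ⊖ x)) (Col? c (b ⊖ x)))))
      (count-exclusive (λ c → Col? c (a ⊖ x) ×-dec Col? c (b ⊖ x)) (Q? x) (λ c h → c , h) (λ c c' h h' → col-unique (proj₁ h) (proj₁ h')))
    inv : ∀ x → Q x → ℤ
    inv x (c , _ , hb) = proj₁ (inverse (col-nonzero hb))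
    inv-≈ : ∀ x q → (b ⊖ x) ℤ.* inv x q ≈[ p ] ℤ.1ℤ
    inv-≈ x (c , _ , hb) = proj₂ (inverse (col-nonzero hb))
    z : ∀ x → Q x → ℤ
    z x q = (a ⊖ x) ℤ.* inv x q
    z-≈ : ∀ x q → a ⊖ x ≈[ p ] z x q ℤ.* (b ⊖ x)
    z-≈ x q = ≈-comb₁ (ℤ.- (a ⊖ x)) (inv-≈ x q) (lem (a ⊖ x) (inv x q) (b ⊖ x))
      where
      lem : ∀ u v w → u ≡ u ℤ.* v ℤ.* w ℤ.+ ℤ.- u ℤ.* (w ℤ.* v ℤ.- ℤ.1ℤ)
      lem = ℤ-Ring.solve-∀
    f : ∀ x → Q x → Fin p
    f x q = red p (z x q)
    f-sat : ∀ x q → Col unit (ι (f x q))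
    f-sat x q@(c , ha , hb) = col-cong (≈-sym (red-≈ p (z x q))) (col-ratio ha hb (z-≈ x q))
    f-inj : ∀ x y q r → f x q ≡ f y r → x ≡ y
    f-inj x y q r h = [ (λ a≈b → contradiction (ι-injective (-≈0⇒≈ a≈b)) a≢b) , (λ x≈y → ι-injective (-≈0⇒≈ x≈y)) ]′
      (*≈0 (ι a ℤ.- ι b) (≈-comb₃ (b ⊖ y) (ℤ.- (b ⊖ x)) ((b ⊖ x) ℤ.* (b ⊖ y)) (z-≈ x q) (z-≈ y r) (red-injective h)
        (lem (ι a) (ι b) (ι x) (ι y) (z x q) (z y r))))
      where
      lem : ∀ a b x y z w → (a ℤ.- b) ℤ.* (x ℤ.- y) ≡ ℤ.0ℤ ℤ.+ (b ℤ.- y) ℤ.* ((a ℤ.- x) ℤ.- z ℤ.* (b ℤ.- x))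
        ℤ.+ ℤ.- (b ℤ.- x) ℤ.* ((a ℤ.- y) ℤ.- w ℤ.* (b ℤ.- y)) ℤ.+ ((b ℤ.- x) ℤ.* (b ℤ.- y)) ℤ.* (z ℤ.- w)
      lem = ℤ-Ring.solve-∀

  pair-bound : ∀ a b → sum (λ c → sum (λ x → χ c (a ⊖ x) * χ c (b ⊖ x))) ≤ κ + ⟦ a Fin.≟ b ⟧ * p
  pair-bound a b with a Fin.≟ b
  ... | no a≢b = ≤-trans (same-class a b a≢b) (m≤m+n κ 0)
  ... | yes refl = ≤-trans (≤-reflexive (∑-comm (λ c x → χ c (a ⊖ x) * χ c (a ⊖ x))))
    (≤-trans (sum-≤-const 1 per-x) (≤-trans (≤-reflexive (*-comm p 1)) (m≤n+m (1 * p) κ)))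
    where
    per-x : ∀ x → sum (λ c → χ c (a ⊖ x) * χ c (a ⊖ x)) ≤ 1
    per-x x = ≤-trans (≤-reflexive (sum-cong-≗ (λ c → ⟦⟧-* (Col? c (a ⊖ x)) (Col? c (a ⊖ x)))))
      (count-exclusive (λ c → Col? c (a ⊖ x) ×-dec Col? c (a ⊖ x)) (yes tt) (λ _ _ → tt) (λ c c' h h' → col-unique (proj₁ h) (proj₁ h')))

  -- Here α is the indicator of a set of size s. The value is s / e on average, up to a small error,
  -- and `poor?` marks the points that receive less than half of s / e.
  deg : (Fin p → ℕ) → Fin e → Fin p → ℕ
  deg α c x = sum (λ a → α a * χ c (a ⊖ x))

  module _ (α : Fin p → ℕ) (α≤1 : ∀ a → α a ≤ 1) where
    s = sum α

    first-moment : ∀ c → sum (λ x → deg α c x) ≡ s * κ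
    first-moment c = trans (∑-comm (λ x a → α a * χ c (a ⊖ x)))
      (trans (sum-cong-≗ (λ a → trans (sum-*ˡ (α a) (λ x → χ c (a ⊖ x))) (cong (α a *_) (χ-shift c a)))) (sum-*ʳ κ α))

    -- Expanding the square gives pairs (a, b) of members of α. Summed over all classes, a pair off
    -- the diagonal contributes at most κ and a diagonal one at most p more, by `pair-bound`.
    second-moment : sum (λ c → sum (λ x → deg α c x * deg α c x)) ≤ s * (s * κ + p)
    second-moment = ≤-trans (≤-reflexive expand) (≤-trans (sum-mono-≤ per-a) (≤-reflexive (sum-*ʳ (s * κ + p) α)))
      where
      T : Fin e → Fin p → Fin p → Fin p → ℕ
      T c x a b = (α a * χ c (a ⊖ x)) * (α b * χ c (b ⊖ x))
      expand : sum (λ c → sum (λ x → deg α c x * deg α c x)) ≡ sum (λ a → sum (λ b → sum (λ c → sum (λ x → T c x a b))))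
      expand = trans (sum-cong-≗ (λ c → sum-cong-≗ (λ x → sum-product (λ a → α a * χ c (a ⊖ x)) (λ b → α b * χ c (b ⊖ x)))))
        (trans (sum-move (λ c x a → sum (T c x a))) (sum-cong-≗ (λ a → sum-move (λ c x b → T c x a b))))
      per-ab : ∀ a b → sum (λ c → sum (λ x → T c x a b)) ≤ α a * (α b * κ + ⟦ a Fin.≟ b ⟧ * p)
      per-ab a b = begin
        sum (λ c → sum (λ x → T c x a b)) ≡⟨ sum-cong-≗ (λ c → trans (sum-cong-≗ (λ x → lem (α a) (χ c (a ⊖ x)) (α b) (χ c (b ⊖ x)))) (sum-*ˡ (α a * α b) (λ x → χ c (a ⊖ x) * χ c (b ⊖ x)))) ⟩
        sum (λ c → α a * α b * sum (λ x → χ c (a ⊖ x) * χ c (b ⊖ x))) ≡⟨ sum-*ˡ (α a * α b) (λ c → sum (λ x → χ c (a ⊖ x) * χ c (b ⊖ x))) ⟩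
        α a * α b * sum (λ c → sum (λ x → χ c (a ⊖ x) * χ c (b ⊖ x))) ≤⟨ *-monoʳ-≤ (α a * α b) (pair-bound a b) ⟩
        α a * α b * (κ + ⟦ a Fin.≟ b ⟧ * p) ≡⟨ lem2 (α a) (α b) κ (⟦ a Fin.≟ b ⟧ * p) ⟩
        α a * (α b * κ + α b * (⟦ a Fin.≟ b ⟧ * p)) ≤⟨ *-monoʳ-≤ (α a) (+-monoʳ-≤ (α b * κ) (≤-trans (*-monoˡ-≤ (⟦ a Fin.≟ b ⟧ * p) (α≤1 b)) (≤-reflexive (*-identityˡ _)))) ⟩
        α a * (α b * κ + ⟦ a Fin.≟ b ⟧ * p) ∎
        where
        open ≤-Reasoning
        lem : ∀ x y z w → (x * y) * (z * w) ≡ x * z * (y * w)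
        lem = ℕ-Ring.solve-∀
        lem2 : ∀ x y k q → x * y * (k + q) ≡ x * (y * k + y * q)
        lem2 = ℕ-Ring.solve-∀
      per-a : ∀ a → sum (λ b → sum (λ c → sum (λ x → T c x a b))) ≤ α a * (s * κ + p)
      per-a a = begin
        sum (λ b → sum (λ c → sum (λ x → T c x a b))) ≤⟨ sum-mono-≤ (per-ab a) ⟩
        sum (λ b → α a * (α b * κ + ⟦ a Fin.≟ b ⟧ * p)) ≡⟨ sum-*ˡ (α a) (λ b → α b * κ + ⟦ a Fin.≟ b ⟧ * p) ⟩
        α a * sum (λ b → α b * κ + ⟦ a Fin.≟ b ⟧ * p) ≡⟨ cong (α a *_) (∑-distrib-+ (λ b → α b * κ) (λ b → ⟦ a Fin.≟ b ⟧ * p)) ⟩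
        α a * (sum (λ b → α b * κ) + sum (λ b → ⟦ a Fin.≟ b ⟧ * p)) ≡⟨ cong (α a *_) (cong₂ _+_ (sum-*ʳ κ α) (sum-*ʳ p (λ b → ⟦ a Fin.≟ b ⟧))) ⟩
        α a * (s * κ + count (a Fin.≟_) * p) ≤⟨ *-monoʳ-≤ (α a) (+-monoʳ-≤ (s * κ) (≤-trans (*-monoˡ-≤ p (count-exclusive (a Fin.≟_) (yes tt) (λ _ _ → tt) (λ i j h h' → trans (sym h) h'))) (≤-reflexive (*-identityˡ p)))) ⟩
        α a * (s * κ + p) ∎
        where open ≤-Reasoning

    poor? : ∀ c x → Dec (2 * (e * deg α c x) < s)
    poor? c x = 2 * (e * deg α c x) <? s

    -- Chebyshev's inequality: the sum of 4 * (e * deg - s) ^ 2 over all classes and points is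
    -- computed from the two moments, while every poor point for c₀ contributes at least s ^ 2 to
    -- it.
    few-poor : ∀ c₀ → 0 < s → count (poor? c₀) * s ≤ 8 * (e * e) * p
    few-poor c₀ s>0 = ≤-trans divided (≤-trans (+-monoʳ-≤ (4 * (e * e) * p) (*-mono-≤ (*-monoʳ-≤ 4 (m≤m*n e e {{e≢0 c₀}})) s≤p)) (≤-reflexive (lem3 e p)))
      where
      B = count (poor? c₀)
      e≢0 : Fin e → NonZero e
      e≢0 c = >-nonZero (≤-<-trans z≤n (Fin.toℕ<n c))
      lem3 : ∀ e p → 4 * (e * e) * p + 4 * (e * e) * p ≡ 8 * (e * e) * p
      lem3 = ℕ-Ring.solve-∀
      s≤p : s ≤ p
      s≤p = ≤-trans (sum-≤-const 1 α≤1) (≤-reflexive (*-identityʳ p))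
      γ : Fin e → Fin p → ℕ
      γ c x = ⟦ c Fin.≟ c₀ ⟧ * ⟦ poor? c x ⟧ * (s * s)
      pointwise : ∀ c x → 8 * (s * (e * deg α c x)) + γ c x ≤ 4 * ((e * deg α c x) * (e * deg α c x)) + 4 * (s * s)
      pointwise c x with c Fin.≟ c₀ | poor? c x
      ... | no _ | _ = ≤-trans (≤-reflexive (+-identityʳ _)) (2ab≤a²+b² (e * deg α c x) s)
      ... | yes _ | no _ = ≤-trans (≤-reflexive (+-identityʳ _)) (2ab≤a²+b² (e * deg α c x) s)
      ... | yes _ | yes h = ≤-trans (≤-reflexive (cong (λ z → 8 * (s * (e * deg α c x)) + z) (+-identityʳ (s * s)))) (2ab+gap≤a²+b² (e * deg α c x) s h)
      lhs : 8 * (s * (e * (e * (s * κ)))) + B * (s * s) ≤ sum (λ c → sum (λ x → 8 * (s * (e * deg α c x)) + γ c x))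
      lhs = begin
        8 * (s * (e * (e * (s * κ)))) + B * (s * s) ≡⟨ cong₂ _+_ (trans (lem4 s e (s * κ)) (sym (trans (sum-cong-≗ (λ c → trans (sum-cong-≗ (λ x → lem5 s e (deg α c x))) (trans (sum-*ˡ (8 * (s * e)) (deg α c)) (cong (8 * (s * e) *_) (first-moment c))))) (sum-const e (8 * (s * e) * (s * κ)))))) (sym (sum-*ʳ (s * s) (λ x → ⟦ poor? c₀ x ⟧))) ⟩
        sum (λ c → sum (λ x → 8 * (s * (e * deg α c x)))) + sum (λ x → ⟦ poor? c₀ x ⟧ * (s * s)) ≤⟨ +-monoʳ-≤ _ (≤-trans (≤-reflexive (sum-cong-≗ (λ x → cong (_* (s * s)) (sym (trans (cong (_* ⟦ poor? c₀ x ⟧) (⟦⟧-yes (c₀ Fin.≟ c₀) refl)) (*-identityˡ _)))))) (sum-≥-at (λ c → sum (γ c)) c₀)) ⟩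
        sum (λ c → sum (λ x → 8 * (s * (e * deg α c x)))) + sum (λ c → sum (γ c)) ≡⟨ sym (trans (sum-cong-≗ (λ c → ∑-distrib-+ (λ x → 8 * (s * (e * deg α c x))) (γ c))) (∑-distrib-+ (λ c → sum (λ x → 8 * (s * (e * deg α c x)))) (λ c → sum (γ c)))) ⟩
        sum (λ c → sum (λ x → 8 * (s * (e * deg α c x)) + γ c x)) ∎
        where
        open ≤-Reasoning
        lem4 : ∀ s e t → 8 * (s * (e * (e * t))) ≡ e * (8 * (s * e) * t)
        lem4 = ℕ-Ring.solve-∀
        lem5 : ∀ s e t → 8 * (s * (e * t)) ≡ 8 * (s * e) * t
        lem5 = ℕ-Ring.solve-∀
      rhs : sum (λ c → sum (λ x → 4 * ((e * deg α c x) * (e * deg α c x)) + 4 * (s * s))) ≤ 4 * (e * e) * (s * (s * κ + p)) + e * (p * (4 * (s * s)))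
      rhs = begin
        sum (λ c → sum (λ x → 4 * ((e * deg α c x) * (e * deg α c x)) + 4 * (s * s))) ≡⟨ trans (sum-cong-≗ (λ c → ∑-distrib-+ (λ x → 4 * ((e * deg α c x) * (e * deg α c x))) (λ _ → 4 * (s * s)))) (∑-distrib-+ (λ c → sum (λ x → 4 * ((e * deg α c x) * (e * deg α c x)))) (λ c → sum (λ (x : Fin p) → 4 * (s * s)))) ⟩
        sum (λ c → sum (λ x → 4 * ((e * deg α c x) * (e * deg α c x)))) + sum (λ (c : Fin e) → sum (λ (x : Fin p) → 4 * (s * s)))
          ≡⟨ cong₂ _+_ (trans (sum-cong-≗ (λ c → trans (sum-cong-≗ (λ x → lem6 e (deg α c x))) (sum-*ˡ (4 * (e * e)) (λ x → deg α c x * deg α c x)))) (sum-*ˡ (4 * (e * e)) (λ c → sum (λ x → deg α c x * deg α c x))))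
               (trans (sum-cong-≗ {e} (λ c → sum-const p (4 * (s * s)))) (sum-const e (p * (4 * (s * s))))) ⟩
        4 * (e * e) * sum (λ c → sum (λ x → deg α c x * deg α c x)) + e * (p * (4 * (s * s))) ≤⟨ +-monoˡ-≤ _ (*-monoʳ-≤ (4 * (e * e)) second-moment) ⟩
        4 * (e * e) * (s * (s * κ + p)) + e * (p * (4 * (s * s))) ∎
        where
        open ≤-Reasoning
        lem6 : ∀ e t → 4 * ((e * t) * (e * t)) ≡ 4 * (e * e) * (t * t)
        lem6 = ℕ-Ring.solve-∀
      total : 8 * (s * (e * (e * (s * κ)))) + B * (s * s) ≤ 4 * (e * e) * (s * (s * κ + p)) + e * (p * (4 * (s * s)))
      total = ≤-trans lhs (≤-trans (sum-mono-≤ (λ c → sum-mono-≤ (pointwise c))) rhs)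
      -- Substituting p = e * κ + 1 cancels the terms in e ^ 2 * s ^ 2 * κ exactly; what remains has
      -- a factor s to divide by.
      divided : B * s ≤ 4 * (e * e) * p + 4 * e * s
      divided = *-cancelʳ-≤ (B * s) _ s {{>-nonZero s>0}} (+-cancelˡ-≤ (8 * (s * (e * (e * (s * κ))))) _ _
        (≤-trans (≤-reflexive (cong (λ z → 8 * (s * (e * (e * (s * κ)))) + z) (*-assoc B s s))) (≤-trans total (≤-reflexive (final p≡)))))
        where
        lem7 : ∀ e s κ → 4 * (e * e) * (s * (s * κ + suc (e * κ))) + e * (suc (e * κ) * (4 * (s * s))) ≡
          8 * (s * (e * (e * (s * κ)))) + (4 * (e * e) * suc (e * κ) + 4 * e * s) * s
        lem7 = ℕ-Ring.solve-∀
        final : p ≡ suc (e * κ) → 4 * (e * e) * (s * (s * κ + p)) + e * (p * (4 * (s * s))) ≡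
          8 * (s * (e * (e * (s * κ)))) + (4 * (e * e) * p + 4 * e * s) * s
        final eq = subst (λ q → 4 * (e * e) * (s * (s * κ + q)) + e * (q * (4 * (s * s))) ≡ 8 * (s * (e * (e * (s * κ)))) + (4 * (e * e) * q + 4 * e * s) * s) (sym eq) (lem7 e s κ)

  -- Choose the a j one at a time, each rich for all candidate sets still open, so that these shrink only by the factor 2 e.
  embed : ∀ (w Dmax : ℕ) → 0 < e → w * (8 * (e * e)) * (Dmax * Dmax) < p →
    ∀ m Δ → m ≤ w → 0 < Δ → Δ * (2 * e) ^ m ≤ Dmax →
    (α : Fin m → Fin p → ℕ) → (∀ j a → α j a ≤ 1) → (∀ j → p ≤ Δ * sum (α j)) →
    (σ : Fin m → Fin m → Fin e) →
    ∃ λ (a : Fin m → Fin p) → (∀ j → α j (a j) ≡ 1) × (∀ i j → i Fin.< j → Col (σ i j) (a j ⊖ a i))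
  embed w Dmax 0<e big zero Δ m≤w 0<Δ Δ≤ α α≤1 dense σ = (λ ()) , (λ ()) , (λ ())
  -- Since `α zero` is at most 1, a point with `bad x < α zero x` belongs to the first set and is
  -- bad for none of the later ones.
  embed w Dmax 0<e big (suc m) Δ m≤w 0<Δ Δ≤ α α≤1 dense σ = choose (∃-sum-< bad (α zero) few-bad)
    where
    c : Fin m → Fin e
    c j = σ zero (suc j)
    S : Fin m → ℕ
    S j = sum (α (suc j))
    bad? : ∀ j x → Dec (2 * (e * deg (α (suc j)) (c j) x) < S j)
    bad? j = poor? (α (suc j)) (α≤1 (suc j)) (c j)
    bad : Fin p → ℕ
    bad x = sum (λ j → ⟦ bad? j x ⟧)
    0<p : 0 < p
    0<p = ≤-<-trans z≤n big
    twice-e≢0 : NonZero (2 * e)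
    twice-e≢0 = m*n≢0 2 e {{_}} {{>-nonZero 0<e}}
    instance
      Δ≢0 : NonZero Δ
      Δ≢0 = >-nonZero 0<Δ
      p≢0' : NonZero p
      p≢0' = >-nonZero 0<p
    Δ≤Dmax : Δ ≤ Dmax
    Δ≤Dmax = ≤-trans (m≤m*n Δ ((2 * e) ^ suc m) {{m^n≢0 (2 * e) (suc m) {{twice-e≢0}}}}) Δ≤
    S>0 : ∀ j → 0 < sum (α j)
    S>0 j with sum (α j) | dense j
    ... | zero | h = contradiction (≤-trans 0<p (≤-trans h (≤-reflexive (*-zeroʳ Δ)))) λ ()
    ... | suc _ | _ = s≤s z≤n
    few : ∀ j → count (bad? j) ≤ 8 * (e * e) * Δ
    few j = *-cancelʳ-≤ (count (bad? j)) (8 * (e * e) * Δ) p (begin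
      count (bad? j) * p ≤⟨ *-monoʳ-≤ (count (bad? j)) (dense (suc j)) ⟩
      count (bad? j) * (Δ * S j) ≡⟨ l1 (count (bad? j)) Δ (S j) ⟩
      count (bad? j) * S j * Δ ≤⟨ *-monoˡ-≤ Δ (few-poor (α (suc j)) (α≤1 (suc j)) (c j) (S>0 (suc j))) ⟩
      8 * (e * e) * p * Δ ≡⟨ l2 (8 * (e * e)) p Δ ⟩
      8 * (e * e) * Δ * p ∎)
      where
      open ≤-Reasoning
      l1 : ∀ a b c → a * (b * c) ≡ a * c * b
      l1 = ℕ-Ring.solve-∀
      l2 : ∀ a b c → a * b * c ≡ a * c * b
      l2 = ℕ-Ring.solve-∀
    -- Every set has at least p / Δ members, so each later one has at most 8 * e ^ 2 * Δ bad points.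
    -- The hypothesis on p makes the first set larger than all of these together.
    few-bad : sum bad < sum (α zero)
    few-bad = *-cancelˡ-< Δ (sum bad) (sum (α zero)) (begin-strict
      Δ * sum bad ≡⟨ cong (Δ *_) (∑-comm (λ x j → ⟦ bad? j x ⟧)) ⟩
      Δ * sum (λ j → count (bad? j)) ≤⟨ *-mono-≤ Δ≤Dmax (sum-≤-const (8 * (e * e) * Δ) few) ⟩
      Dmax * (m * (8 * (e * e) * Δ)) ≤⟨ *-monoʳ-≤ Dmax (*-mono-≤ (≤-trans (n≤1+n m) m≤w) (*-monoʳ-≤ (8 * (e * e)) Δ≤Dmax)) ⟩
      Dmax * (w * (8 * (e * e) * Dmax)) ≡⟨ l3 Dmax w (8 * (e * e)) ⟩
      w * (8 * (e * e)) * (Dmax * Dmax) <⟨ big ⟩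
      p ≤⟨ dense zero ⟩
      Δ * sum (α zero) ∎)
      where
      open ≤-Reasoning
      l3 : ∀ D w k → D * (w * (k * D)) ≡ w * k * (D * D)
      l3 = ℕ-Ring.solve-∀
    choose : (∃ λ x → bad x < α zero x) → ∃ λ (a : Fin (suc m) → Fin p) → (∀ j → α j (a j) ≡ 1) × (∀ i j → i Fin.< j → Col (σ i j) (a j ⊖ a i))
    choose (x , hx) = finish (embed w Dmax 0<e big m (Δ * (2 * e)) (≤-trans (n≤1+n m) m≤w) (>-nonZero⁻¹ (Δ * (2 * e)) {{m*n≢0 Δ (2 * e) {{it}} {{twice-e≢0}}}})
        (≤-trans (≤-reflexive (*-assoc Δ (2 * e) ((2 * e) ^ m))) Δ≤) α' α'≤1 dense' (λ i j → σ (suc i) (suc j)))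
      where
      it = Δ≢0
      bad0 : bad x ≡ 0
      bad0 = n≤0⇒n≡0 (s≤s⁻¹ (≤-trans hx (α≤1 zero x)))
      αx≡1 : α zero x ≡ 1
      αx≡1 = ≤-antisym (α≤1 zero x) (≤-trans (s≤s z≤n) hx)
      rich : ∀ j → S j ≤ 2 * (e * deg (α (suc j)) (c j) x)
      rich j with bad? j x | sum-≥-at (λ j → ⟦ bad? j x ⟧) j
      ... | yes h | le = contradiction (≤-trans le (≤-reflexive bad0)) λ ()
      ... | no ¬h | _ = ≮⇒≥ ¬h
      α' : Fin m → Fin p → ℕ
      α' j a = α (suc j) a * χ (c j) (a ⊖ x)
      α'≤1 : ∀ j a → α' j a ≤ 1
      α'≤1 j a = *-mono-≤ {y = 1} {v = 1} (α≤1 (suc j) a) (⟦⟧≤1 (Col? (c j) (a ⊖ x)))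
      dense' : ∀ j → p ≤ Δ * (2 * e) * sum (α' j)
      dense' j = ≤-trans (dense (suc j)) (≤-trans (*-monoʳ-≤ Δ (rich j)) (≤-reflexive (l4 Δ e (sum (α' j)))))
        where
        l4 : ∀ Δ e s → Δ * (2 * (e * s)) ≡ Δ * (2 * e) * s
        l4 = ℕ-Ring.solve-∀
      finish : (∃ λ (a : Fin m → Fin p) → (∀ j → α' j (a j) ≡ 1) × (∀ i j → i Fin.< j → Col (σ (suc i) (suc j)) (a j ⊖ a i))) →
        ∃ λ (a : Fin (suc m) → Fin p) → (∀ j → α j (a j) ≡ 1) × (∀ i j → i Fin.< j → Col (σ i j) (a j ⊖ a i))
      finish (a , sat , col) = a⁺ , sat⁺ , col⁺
        where
        a⁺ : Fin (suc m) → Fin p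
        a⁺ zero = x
        a⁺ (suc j) = a j
        sat⁺ : ∀ j → α j (a⁺ j) ≡ 1
        sat⁺ zero = αx≡1
        sat⁺ (suc j) = m*n≡1⇒m≡1 (α (suc j) (a j)) (χ (c j) (a j ⊖ x)) (sat j)
        col⁺ : ∀ i j → i Fin.< j → Col (σ i j) (a⁺ j ⊖ a⁺ i)
        col⁺ zero (suc j) _ = ⟦⟧-holds (Col? (c j) (a j ⊖ x)) (≤-reflexive (sym (m*n≡1⇒n≡1 (α (suc j) (a j)) (χ (c j) (a j ⊖ x)) (sat j))))
        col⁺ (suc i) (suc j) (s≤s i<j) = col i j i<j

-- The difference family over ℤ/p

-- A packing by blocks of size w in which points of one block are never related. Equality as
-- relation gives plain packings, `Fibre` gives partial group divisible designs; completeness is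
-- expressed by the number of blocks.
record Design (w : ℕ) (X : Set) (_~_ : X → X → Set) (I : Set) : Set where
  field
    blk         : I → Fin w → X
    transversal : ∀ i {k l} → k ≢ l → ¬ (blk i k ~ blk i l)
    linear      : ∀ {i i' k l k' l'} → k ≢ l → blk i k ≡ blk i' k' → blk i l ≡ blk i' l' → i ≡ i'

Fibre : ∀ {A B : Set} → A × B → A × B → Set
Fibre x y = proj₁ x ≡ proj₁ y

-- The binomial coefficient C(n,2). A pair i < j < w has the code i + tri j, which lies below tri w.
tri : ℕ → ℕ
tri zero = 0
tri (suc n) = n + tri n

tri-mono : ∀ {m n} → m ≤ n → tri m ≤ tri n
tri-mono z≤n = z≤n
tri-mono (s≤s m≤n) = +-mono-≤ m≤n (tri-mono m≤n)

2tri : ∀ k → tri (suc k) * 2 ≡ suc k * k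
2tri zero = refl
2tri (suc k) = trans (*-distribʳ-+ 2 (suc k) (tri (suc k))) (trans (cong (λ z → suc k * 2 + z) (2tri k)) (lem k))
  where
  lem : ∀ k → suc k * 2 + suc k * k ≡ suc (suc k) * suc k
  lem = ℕ-Ring.solve-∀

tri-bound : ∀ {i j w} → i < j → j < w → i + tri j < tri w
tri-bound {i} {j} {w} i<j j<w = ≤-trans (+-monoˡ-≤ (tri j) i<j) (tri-mono j<w)

tri-code-< : ∀ {i j i' j'} → i < j → i' < j' → i + tri j ≡ i' + tri j' → ¬ j < j'
tri-code-< {i} {j} {i'} {j'} i<j i'<j' eq j<j' = <⇒≱ (tri-bound i<j j<j') (≤-trans (m≤n+m (tri j') i') (≤-reflexive (sym eq)))

tri-code : ∀ {i j i' j'} → i < j → i' < j' → i + tri j ≡ i' + tri j' → i ≡ i' × j ≡ j'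
tri-code {i} {j} {i'} {j'} i<j i'<j' eq with <-cmp j j'
... | tri< h _ _ = contradiction h (tri-code-< i<j i'<j' eq)
... | tri> _ _ h = contradiction h (tri-code-< i'<j' i<j (sym eq))
... | tri≈ _ refl _ = +-cancelʳ-≡ (tri j) i i' eq , refl

module PairColour (w : ℕ) where
  colour< : ∀ (i j : Fin w) → i Fin.< j → Fin (tri w)
  colour< i j i<j = fromℕ< (tri-bound i<j (Fin.toℕ<n j))

  colour<-inj : ∀ {i j i' j'} (h : i Fin.< j) (h' : i' Fin.< j') → colour< i j h ≡ colour< i' j' h' → i ≡ i' × j ≡ j'
  colour<-inj {i} {j} {i'} {j'} h h' eq with tri-code h h'
    (trans (sym (Fin.toℕ-fromℕ< (tri-bound h (Fin.toℕ<n j)))) (trans (cong toℕ eq) (Fin.toℕ-fromℕ< (tri-bound h' (Fin.toℕ<n j')))))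
  ... | e , e' = Fin.toℕ-injective e , Fin.toℕ-injective e'

  colour : ∀ (i j : Fin w) → i ≢ j → Fin (tri w)
  colour i j i≢j with Fin.<-cmp i j
  ... | tri< h _ _ = colour< i j h
  ... | tri≈ _ e _ = contradiction e i≢j
  ... | tri> _ _ h = colour< j i h

  colour-inj : ∀ {i j i' j'} (h : i ≢ j) (h' : i' ≢ j') → colour i j h ≡ colour i' j' h' → (i ≡ i' × j ≡ j') ⊎ (i ≡ j' × j ≡ i')
  colour-inj {i} {j} {i'} {j'} h h' eq with Fin.<-cmp i j | Fin.<-cmp i' j'
  ... | tri≈ _ e _ | _ = contradiction e h
  ... | _ | tri≈ _ e _ = contradiction e h'
  ... | tri< l _ _ | tri< l' _ _ = inj₁ (colour<-inj l l' eq)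
  ... | tri< l _ _ | tri> _ _ l' = inj₂ (colour<-inj l l' eq)
  ... | tri> _ _ l | tri< l' _ _ = let (a , b) = colour<-inj l l' eq in inj₂ (b , a)
  ... | tri> _ _ l | tri> _ _ l' = let (a , b) = colour<-inj l l' eq in inj₁ (b , a)

  -- A total matrix of colours in the form that `embed` expects. Only its entries with i < j are
  -- read there, and the default fills the others.
  σ : Fin (tri w) → Fin w → Fin w → Fin (tri w)
  σ default i j with i Fin.<? j
  ... | yes h = colour< i j h
  ... | no _ = default

  σ-< : ∀ d i j (h : i Fin.< j) → σ d i j ≡ colour< i j h
  σ-< d i j h with i Fin.<? j
  ... | yes h' = cong (λ z → colour< i j z) (<-irrelevant h' h)
  ... | no ¬h = contradiction h ¬h

⟦⟧-complement : ∀ {A : Set} (d : Dec A) → 1 ≡ ⟦ d ⟧ + ⟦ ¬? d ⟧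
⟦⟧-complement (yes _) = refl
⟦⟧-complement (no _) = refl

search : ∀ {n} {P : Fin n → Set} → (∀ i → Dec (P i)) → ¬ (∀ i → ¬ P i) → ∃ P
search P? h with Fin.any? P?
... | yes r = r
... | no ¬r = contradiction (λ i z → ¬r (i , z)) h

-- Representatives of the unit class modulo sign. A block contains each difference together with its
-- negative, so multipliers differing by sign would repeat the same differences.
record HalfClass {p e κ} (C : Colouring p e κ) (τ : ℕ) : Set where
  open Colouring C
  field
    elt     : Fin τ → ℤ
    elt-col : ∀ t → Col unit (elt t)
    elt-inj : ∀ {t t'} → elt t ≈[ p ] elt t' → t ≡ t'
    elt-neg : ∀ {t t'} → ¬ elt t ℤ.+ elt t' ≈[ p ] ℤ.0ℤ

-- The residues below p / 2 serve. Negation maps the other members of the class injectively to them,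
-- and p is odd, so they make up at least half of the class.
halfClass : ∀ {p e τ} (C : Colouring p e (2 * τ)) → HalfClass C τ
halfClass {p} {e} {τ} C = record
  { elt = λ t → ι (el t)
  ; elt-col = λ t → proj₁ (E.sat (up t))
  ; elt-inj = λ h → Fin.inject≤-injective τ≤ τ≤ _ _ (E.to-inj (ι-injective h))
  ; elt-neg = λ {t} {t'} h → neg t t' h }
  where
  open Colouring C
  open PrimeField p-prime
  Small : Fin p → Set
  Small i = Col unit (ι i) × (2 * toℕ i < p)
  small? : ∀ i → Dec (Small i)
  small? i = Col? unit (ι i) ×-dec (2 * toℕ i <? p)
  Large : Fin p → Set
  Large i = Col unit (ι i) × ¬ (2 * toℕ i < p)
  large? : ∀ i → Dec (Large i)
  large? i = Col? unit (ι i) ×-dec ¬? (2 * toℕ i <? p)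
  split : ∀ i → ⟦ Col? unit (ι i) ⟧ ≡ ⟦ small? i ⟧ + ⟦ large? i ⟧
  split i with Col? unit (ι i) | 2 * toℕ i <? p
  ... | no _ | yes _ = refl
  ... | no _ | no _ = refl
  ... | yes _ | yes _ = refl
  ... | yes _ | no _ = refl
  total : 2 * τ ≡ count small? + count large?
  total = trans (sym (col-count unit)) (trans (sum-cong-≗ split) (∑-distrib-+ (λ i → ⟦ small? i ⟧) (λ i → ⟦ large? i ⟧)))
  pos : ∀ i → Col unit (ι i) → 0 < toℕ i
  pos i h = n≢0⇒n>0 λ e → col-nonzero h (≈-reflexive (trans (ι-toℕ i) (cong +_ e)))
  p∸i<p : ∀ i → Col unit (ι i) → p ∸ toℕ i < p
  p∸i<p i h = ∸-monoʳ-< (pos i h) (<⇒≤ (Fin.toℕ<n i))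
  opp : ∀ i → Large i → Fin p
  opp i (h , _) = fromℕ< (p∸i<p i h)
  toℕ-opp : ∀ i l → toℕ (opp i l) ≡ p ∸ toℕ i
  toℕ-opp i (h , _) = Fin.toℕ-fromℕ< (p∸i<p i h)
  opp-≈ : ∀ i l → ι (opp i l) ≈[ p ] ℤ.- ι i
  opp-≈ i l = mod-eq ℤ.1ℤ (trans (ι-toℕ (opp i l)) (trans (cong +_ (toℕ-opp i l))
    (trans (trans (sym (ℤ.⊖-≥ (<⇒≤ (Fin.toℕ<n i)))) (sym (ℤ.m-n≡m⊖n p (toℕ i)))) (trans (lem (+ p) (+ toℕ i)) (cong (λ z → ℤ.- z ℤ.+ ℤ.1ℤ ℤ.* + p) (sym (ι-toℕ i)))))))
    where
    lem : ∀ p i → p ℤ.- i ≡ ℤ.- i ℤ.+ ℤ.1ℤ ℤ.* p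
    lem = ℤ-Ring.solve-∀
  odd : ∀ n → 2 * n ≢ p
  odd n eq = contradiction (trans eq (trans p≡ (cong suc (lem e τ)))) (even≢odd n (e * τ))
    where
    lem : ∀ x y → x * (2 * y) ≡ 2 * (x * y)
    lem = ℕ-Ring.solve-∀
  opp-small : ∀ i l → Small (opp i l)
  opp-small i l@(h , ¬s) = col-cong (≈-sym (opp-≈ i l)) (col-neg h) , ≤∧≢⇒< le (odd (toℕ (opp i l)))
    where
    le : 2 * toℕ (opp i l) ≤ p
    le = ≤-trans (≤-reflexive (trans (cong (2 *_) (toℕ-opp i l)) (*-distribˡ-∸ 2 p (toℕ i))))
      (≤-trans (∸-monoʳ-≤ (2 * p) (≮⇒≥ ¬s)) (≤-reflexive (trans (cong (_∸ p) (cong (λ z → p + z) (+-identityʳ p))) (m+n∸n≡m p p))))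
  opp-inj : ∀ i j l l' → opp i l ≡ opp j l' → i ≡ j
  opp-inj i j l l' eq = Fin.toℕ-injective (∸-cancelˡ-≡ (<⇒≤ (Fin.toℕ<n i)) (<⇒≤ (Fin.toℕ<n j)) (trans (sym (toℕ-opp i l)) (trans (cong toℕ eq) (toℕ-opp j l'))))
  large≤small : count large? ≤ count small?
  large≤small = count-inj large? small? opp opp-small opp-inj
  τ≤ : τ ≤ count small?
  τ≤ = *-cancelˡ-≤ 2 (≤-trans (≤-reflexive total) (≤-trans (+-monoʳ-≤ (count small?) large≤small) (≤-reflexive (cong (λ z → count small? + z) (sym (+-identityʳ _))))))
  module E = Enum (enum small?)
  up : Fin τ → Fin (count small?)
  up t = Fin.inject≤ t τ≤
  el : Fin τ → Fin p
  el t = E.to (up t)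
  neg : ∀ t t' → ¬ ι (el t) ℤ.+ ι (el t') ≈[ p ] ℤ.0ℤ
  neg t t' h = contradiction (∣⇒≤ {{>-nonZero sum>0}} (≈0⇒∣ (≈-trans (≈-reflexive (trans (ℤ.pos-+ u v) (sym (cong₂ ℤ._+_ (ι-toℕ (el t)) (ι-toℕ (el t')))))) h))) (<⇒≱ sum<p)
    where
    u = toℕ (el t)
    v = toℕ (el t')
    sum>0 : 0 < u + v
    sum>0 = ≤-trans (pos (el t) (proj₁ (E.sat (up t)))) (m≤m+n u v)
    sum<p : u + v < p
    sum<p = *-cancelˡ-< 2 (u + v) p (subst₂ _<_ (sym (lem u v)) (cong (λ z → p + z) (sym (+-identityʳ p)))
      (+-mono-<-≤ (proj₂ (E.sat (up t))) (<⇒≤ (proj₂ (E.sat (up t'))))))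
      where
      lem : ∀ u v → 2 * (u + v) ≡ 2 * u + 2 * v
      lem = ℕ-Ring.solve-∀

module DifferenceFamily {p k τ : ℕ} (C : Colouring p (tri (suc k)) (2 * τ)) (a : Fin (suc k) → Fin p)
  (a-col : ∀ i j (h : i Fin.< j) → Colouring.Col C (PairColour.colour< (suc k) i j h) (ι (a j) ℤ.- ι (a i))) where
  open Colouring C
  open PrimeField p-prime
  open PairColour (suc k)
  open HalfClass (halfClass {τ = τ} C)
  w = suc k

  α : Fin w → ℤ
  α i = ι (a i)

  diff-col : ∀ i j (h : i ≢ j) → Col (colour i j h) (α i ℤ.- α j)
  diff-col i j h with Fin.<-cmp i j
  ... | tri< l _ _ = col-cong (≈-reflexive (lem (α i) (α j))) (col-neg (a-col i j l))
    where
    lem : ∀ x y → ℤ.- (y ℤ.- x) ≡ x ℤ.- y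
    lem = ℤ-Ring.solve-∀
  ... | tri≈ _ e _ = contradiction e h
  ... | tri> _ _ l = a-col j i l

  elt≉0 : ∀ t → ¬ elt t ≈[ p ] ℤ.0ℤ
  elt≉0 t = col-nonzero (elt-col t)

  diff≉0 : ∀ {i j} → i ≢ j → ¬ α i ℤ.- α j ≈[ p ] ℤ.0ℤ
  diff≉0 h = col-nonzero (diff-col _ _ h)

  -- Equal scaled differences have the same colour, hence come from the same pair; since -1 has the unit colour, the sign is fixed by the half class.
  diff-unique : ∀ {t t' i j i' j'} → i ≢ j → i' ≢ j' → elt t ℤ.* (α i ℤ.- α j) ≈[ p ] elt t' ℤ.* (α i' ℤ.- α j') → t ≡ t' × i ≡ i' × j ≡ j'
  diff-unique {t} {t'} {i} {j} {i'} {j'} h h' eq = [ same , swapped ]′ (colour-inj h h' colours)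
    where
    colours : colour i j h ≡ colour i' j' h'
    colours = col-unique (col-cong eq (col-* (elt-col t) (diff-col i j h))) (col-* (elt-col t') (diff-col i' j' h'))
    same : i ≡ i' × j ≡ j' → t ≡ t' × i ≡ i' × j ≡ j'
    same (refl , refl) = elt-inj (*-cancelˡ-≈ {α i ℤ.- α j} (elt t) (elt t') (diff≉0 h) (≈-comb₁ ℤ.1ℤ eq (lem (elt t) (elt t') (α i ℤ.- α j)))) , refl , refl
      where
      lem : ∀ t t' d → d ℤ.* t ≡ d ℤ.* t' ℤ.+ ℤ.1ℤ ℤ.* (t ℤ.* d ℤ.- t' ℤ.* d)
      lem = ℤ-Ring.solve-∀
    swapped : i ≡ j' × j ≡ i' → t ≡ t' × i ≡ i' × j ≡ j'
    swapped (refl , refl) = contradiction ([ (λ z → contradiction z (diff≉0 h)) , id ]′ (*≈0 (α i ℤ.- α j) {elt t ℤ.+ elt t'} (≈-comb₁ ℤ.1ℤ eq (lem (elt t) (elt t') (α i) (α j))))) elt-neg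
      where
      lem : ∀ t t' x y → (x ℤ.- y) ℤ.* (t ℤ.+ t') ≡ ℤ.0ℤ ℤ.+ ℤ.1ℤ ℤ.* (t ℤ.* (x ℤ.- y) ℤ.- t' ℤ.* (y ℤ.- x))
      lem = ℤ-Ring.solve-∀

  -- The translates of the τ multiples of one base block: the development of a difference family.
  block : Fin τ → Fin p → Fin w → Fin p
  block t b i = red p (elt t ℤ.* α i ℤ.+ ι b)

  block-≈ : ∀ t b i → ι (block t b i) ≈[ p ] elt t ℤ.* α i ℤ.+ ι b
  block-≈ t b i = red-≈ p (elt t ℤ.* α i ℤ.+ ι b)

  block-diff : ∀ t b i j → ι (block t b i) ℤ.- ι (block t b j) ≈[ p ] elt t ℤ.* (α i ℤ.- α j)
  block-diff t b i j = ≈-comb₂ ℤ.1ℤ (ℤ.- ℤ.1ℤ) (block-≈ t b i) (block-≈ t b j) (lem (ι (block t b i)) (ι (block t b j)) (elt t) (α i) (α j) (ι b))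
    where
    lem : ∀ x y t u v b → x ℤ.- y ≡ t ℤ.* (u ℤ.- v) ℤ.+ ℤ.1ℤ ℤ.* (x ℤ.- (t ℤ.* u ℤ.+ b)) ℤ.+ ℤ.- ℤ.1ℤ ℤ.* (y ℤ.- (t ℤ.* v ℤ.+ b))
    lem = ℤ-Ring.solve-∀

  block-shift : ∀ t b b' i → ι (block t b i) ≈[ p ] ι (block t b' i) → b ≡ b'
  block-shift t b b' i e = ι-injective (≈-comb₃ ℤ.1ℤ (ℤ.- ℤ.1ℤ) ℤ.1ℤ e (block-≈ t b i) (block-≈ t b' i)
    (lem (elt t ℤ.* α i) (ι b) (ι b') (ι (block t b i)) (ι (block t b' i))))
    where
    lem : ∀ x b b' u v → b ≡ b' ℤ.+ ℤ.1ℤ ℤ.* (u ℤ.- v) ℤ.+ ℤ.- ℤ.1ℤ ℤ.* (u ℤ.- (x ℤ.+ b)) ℤ.+ ℤ.1ℤ ℤ.* (v ℤ.- (x ℤ.+ b'))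
    lem = ℤ-Ring.solve-∀

  block-injective : ∀ t b {i j} → i ≢ j → block t b i ≢ block t b j
  block-injective t b {i} {j} h eq = *≉0 (elt≉0 t) (diff≉0 h) (≈-trans (≈-sym (block-diff t b i j)) (≈⇒-≈0 (≈-reflexive (cong ι eq))))

  block-linear : ∀ {t b t' b' i j i' j'} → i ≢ j → block t b i ≡ block t' b' i' → block t b j ≡ block t' b' j' → t ≡ t' × b ≡ b'
  block-linear {t} {b} {t'} {b'} {i} {j} {i'} {j'} h e e' = finish (diff-unique h i'≢j' diff-eq) e
    where
    diff-eq : elt t ℤ.* (α i ℤ.- α j) ≈[ p ] elt t' ℤ.* (α i' ℤ.- α j')
    diff-eq = ≈-trans (≈-sym (block-diff t b i j)) (≈-trans (≈-reflexive (cong₂ (λ x y → ι x ℤ.- ι y) e e')) (block-diff t' b' i' j'))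
    i'≢j' : i' ≢ j'
    i'≢j' refl = block-injective t b h (trans e (sym e'))
    finish : t ≡ t' × i ≡ i' × j ≡ j' → block t b i ≡ block t' b' i' → t ≡ t' × b ≡ b'
    finish (refl , refl , refl) e = refl , block-shift t b b' i (≈-reflexive (cong ι e))

  planar : Design w (Fin p) _≡_ (Fin τ × Fin p)
  planar = record
    { blk = λ (t , b) → block t b
    ; transversal = λ (t , b) h → block-injective t b h
    ; linear = λ h e e' → let (x , y) = block-linear h e e' in cong₂ _,_ x y }

  Avoids : Fin τ → Fin p → Set
  Avoids t b = ∀ i → ¬ ι (block t b i) ≈[ p ] ℤ.0ℤ
  avoids? : ∀ t b → Dec (Avoids t b)
  avoids? t b = Fin.all? (λ i → ¬? (ι (block t b i) ≈? ℤ.0ℤ))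
  hits? : ∀ t b → Dec (¬ Avoids t b)
  hits? t b = ¬? (avoids? t b)

  -- For each position i only one translate has 0 there, so at most w of the p translates contain 0.
  p∸w≤ : ∀ t → p ∸ w ≤ count (avoids? t)
  p∸w≤ t = ≤-trans (∸-monoˡ-≤ w (≤-reflexive total)) (≤-trans (∸-monoʳ-≤ (count (avoids? t) + count (hits? t)) few) (≤-reflexive (m+n∸n≡m (count (avoids? t)) (count (hits? t)))))
    where
    total : p ≡ count (avoids? t) + count (hits? t)
    total = trans (trans (sym (*-identityʳ p)) (sym (sum-const p 1))) (trans (sum-cong-≗ (λ b → ⟦⟧-complement (avoids? t b))) (∑-distrib-+ (λ b → ⟦ avoids? t b ⟧) (λ b → ⟦ hits? t b ⟧)))
    witness : ∀ b → ¬ Avoids t b → ∃ λ i → ι (block t b i) ≈[ p ] ℤ.0ℤ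
    witness b = search (λ i → ι (block t b i) ≈? ℤ.0ℤ)
    same-b : ∀ i b b' → ι (block t b i) ≈[ p ] ℤ.0ℤ → ι (block t b' i) ≈[ p ] ℤ.0ℤ → b ≡ b'
    same-b i b b' z z' = block-shift t b b' i (≈-trans z (≈-sym z'))
    few : count (hits? t) ≤ w
    few = ≤-trans (count-inj {Q = λ _ → ⊤} (hits? t) (λ (_ : Fin w) → yes tt) (λ b h → proj₁ (witness b h)) (λ _ _ → tt)
      (λ b b' h h' e → same-b (proj₁ (witness b' h')) b b' (subst (λ i → ι (block t b i) ≈[ p ] ℤ.0ℤ) e (proj₂ (witness b h))) (proj₂ (witness b' h'))))
      (≤-reflexive (trans (sum-const w 1) (*-identityʳ w)))

-- Deleting the point 0 from the planar design: the blocks through 0 become fibres.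
module Derived {k τ : ℕ} (C : Colouring (suc (τ * suc k * k)) (tri (suc k)) (2 * τ)) (a : Fin (suc k) → Fin (suc (τ * suc k * k)))
  (a-col : ∀ i j (h : i Fin.< j) → Colouring.Col C (PairColour.colour< (suc k) i j h) (ι (a j) ℤ.- ι (a i))) where
  open DifferenceFamily {τ = τ} C a a-col public
  open Colouring C using (p-prime)
  open PrimeField p-prime
  open HalfClass (halfClass {τ = τ} C)
  m p : ℕ
  m = τ * w * k
  p = suc m

  -- The nonzero points of the block through 0 whose j-th point is 0. These τ * w * k = p - 1
  -- residues are distinct, so every nonzero residue is one of them: (t, j) becomes its fibre and i
  -- its place there.
  ψ : Fin τ → Fin w → Fin k → Fin p
  ψ t j i = red p (elt t ℤ.* (α (punchIn j i) ℤ.- α j))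

  ψ-≈ : ∀ t j i → ι (ψ t j i) ≈[ p ] elt t ℤ.* (α (punchIn j i) ℤ.- α j)
  ψ-≈ t j i = red-≈ p (elt t ℤ.* (α (punchIn j i) ℤ.- α j))

  ψ≢0 : ∀ t j i → zero ≢ ψ t j i
  ψ≢0 t j i e = *≉0 (elt≉0 t) (diff≉0 (Fin.punchInᵢ≢i j i)) (≈-trans (≈-sym (ψ-≈ t j i)) (≈-reflexive (trans (cong ι (sym e)) ι-zero)))

  ψ-inj : ∀ {t j i t' j' i'} → ψ t j i ≡ ψ t' j' i' → t ≡ t' × j ≡ j' × i ≡ i'
  ψ-inj {t} {j} {i} {t'} {j'} {i'} e = finish (diff-unique (Fin.punchInᵢ≢i j i) (Fin.punchInᵢ≢i j' i') (red-injective e))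
    where
    finish : t ≡ t' × punchIn j i ≡ punchIn j' i' × j ≡ j' → t ≡ t' × j ≡ j' × i ≡ i'
    finish (e1 , e2 , refl) = e1 , refl , Fin.punchIn-injective j i i' e2

  unpack : Fin m → (Fin τ × Fin w) × Fin k
  unpack x = let (tj , i) = Fin.remQuot {τ * w} k x in Fin.remQuot {τ} w tj , i

  unpack-inj : ∀ {x y} → unpack x ≡ unpack y → x ≡ y
  unpack-inj {x} {y} e = trans (sym (Fin.combine-remQuot {τ * w} k x)) (trans (cong₂ Fin.combine
    (trans (sym (Fin.combine-remQuot {τ} w (proj₁ (Fin.remQuot {τ * w} k x)))) (trans (cong (λ u → Fin.combine (proj₁ (proj₁ u)) (proj₂ (proj₁ u))) e) (Fin.combine-remQuot {τ} w (proj₁ (Fin.remQuot {τ * w} k y)))))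
    (cong proj₂ e)) (Fin.combine-remQuot {τ * w} k y))

  ψ' : Fin m → Fin m
  ψ' x = punchOut (ψ≢0 (proj₁ (proj₁ (unpack x))) (proj₂ (proj₁ (unpack x))) (proj₂ (unpack x)))

  ψ'-inj : ∀ {x y} → ψ' x ≡ ψ' y → x ≡ y
  ψ'-inj {x} {y} e = unpack-inj (finish (ψ-inj (Fin.punchOut-injective (ψ≢0 (proj₁ (proj₁ (unpack x))) (proj₂ (proj₁ (unpack x))) (proj₂ (unpack x))) (ψ≢0 (proj₁ (proj₁ (unpack y))) (proj₂ (proj₁ (unpack y))) (proj₂ (unpack y))) e)))
    where
    finish : proj₁ (proj₁ (unpack x)) ≡ proj₁ (proj₁ (unpack y)) × proj₂ (proj₁ (unpack x)) ≡ proj₂ (proj₁ (unpack y)) × proj₂ (unpack x) ≡ proj₂ (unpack y) → unpack x ≡ unpack y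
    finish (e1 , e2 , e3) = cong₂ _,_ (cong₂ _,_ e1 e2) e3

  Located : Fin p → Set
  Located x = Σ (Fin τ × Fin w × Fin k) λ (t , j , i) → ι x ≈[ p ] elt t ℤ.* (α (punchIn j i) ℤ.- α j)

  locate : ∀ x → ¬ ι x ≈[ p ] ℤ.0ℤ → Located x
  locate zero h = contradiction (≈-reflexive ι-zero) h
  locate (suc x) h = finish (injective⇒surjective ψ' ψ'-inj x)
    where
    finish : (∃ λ y → ψ' y ≡ x) → Located (suc x)
    finish (y , e) = (t , j , i) , (≈-trans (≈-reflexive (cong ι (trans (cong suc (sym e)) (Fin.punchIn-punchOut (ψ≢0 t j i))))) (ψ-≈ t j i))
      where
      t = proj₁ (proj₁ (unpack y))
      j = proj₂ (proj₁ (unpack y))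
      i = proj₂ (unpack y)

  fibreOf : ∀ x → Located x → Fin (τ * w) × Fin k
  fibreOf x ((t , j , i) , _) = Fin.combine t j , i

  point-inj : ∀ x y (l : Located x) (l' : Located y) → fibreOf x l ≡ fibreOf y l' → x ≡ y
  point-inj x y ((t , j , i) , at) ((t' , j' , i') , at') e = finish (Fin.combine-injective t j t' j' (cong proj₁ e)) (cong proj₂ e)
    where
    finish : t ≡ t' × j ≡ j' → i ≡ i' → x ≡ y
    finish (refl , refl) refl = ι-injective (≈-trans at (≈-sym at'))

  derived : Design w (Fin (τ * w) × Fin k) Fibre (Fin τ × Fin (p ∸ w))
  derived = record { blk = blk ; transversal = tr ; linear = lin }
    where
    module E (t : Fin τ) = Enum (enum (avoids? t))
    up : ∀ t → Fin (p ∸ w) → Fin (count (avoids? t))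
    up t b = Fin.inject≤ b (p∸w≤ t)
    bb : ∀ t → Fin (p ∸ w) → Fin p
    bb t b = E.to t (up t b)
    bb-inj : ∀ t {b b'} → bb t b ≡ bb t b' → b ≡ b'
    bb-inj t {b} {b'} e = Fin.inject≤-injective (p∸w≤ t) (p∸w≤ t) b b' (E.to-inj t e)
    loc : ∀ t b i → Located (block t (bb t b) i)
    loc t b i = locate (block t (bb t b) i) (E.sat t (up t b) i)
    blk : Fin τ × Fin (p ∸ w) → Fin w → Fin (τ * w) × Fin k
    blk (t , b) i = fibreOf (block t (bb t b) i) (loc t b i)
    lin : ∀ {x x' i j i' j'} → i ≢ j → blk x i ≡ blk x' i' → blk x j ≡ blk x' j' → x ≡ x'
    lin {t , b} {t' , b'} {i} {j} {i'} {j'} h e e' = finish (block-linear h (point-inj _ _ (loc t b i) (loc t' b' i') e) (point-inj _ _ (loc t b j) (loc t' b' j') e'))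
      where
      finish : t ≡ t' × bb t b ≡ bb t' b' → (t , b) ≡ (t' , b')
      finish (refl , e) = cong (t ,_) (bb-inj t e)
    -- Two points in the fibre (t₀, j₀) have a difference that also occurs in the block through 0
    -- defining this fibre. By `diff-unique` the two blocks share multiplier and positions, so the
    -- given block has 0 at position j₀, although it was chosen to avoid 0.
    tr : ∀ x {i j} → i ≢ j → ¬ Fibre (blk x i) (blk x j)
    tr (t , b) {i} {j} i≢j e = go (loc t b i) (loc t b j) e
      where
      B = bb t b
      go : (l : Located (block t B i)) (l' : Located (block t B j)) → Fibre (fibreOf _ l) (fibreOf _ l') → ⊥
      go ((t₀ , j₀ , i₀) , at) ((t₁ , j₁ , i₁) , at') e = go' t₀ j₀ i₀ i₁ at (same-fibre (Fin.combine-injective t₀ j₀ t₁ j₁ e) at')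
        where
        same-fibre : t₀ ≡ t₁ × j₀ ≡ j₁ → ι (block t B j) ≈[ p ] elt t₁ ℤ.* (α (punchIn j₁ i₁) ℤ.- α j₁) → ι (block t B j) ≈[ p ] elt t₀ ℤ.* (α (punchIn j₀ i₁) ℤ.- α j₀)
        same-fibre (refl , refl) h = h
        go' : ∀ t₀ j₀ i₀ i₁ → ι (block t B i) ≈[ p ] elt t₀ ℤ.* (α (punchIn j₀ i₀) ℤ.- α j₀) → ι (block t B j) ≈[ p ] elt t₀ ℤ.* (α (punchIn j₀ i₁) ℤ.- α j₀) → ⊥
        go' t₀ j₀ i₀ i₁ at at' = finish (diff-unique i≢j i₀≢i₁ diff-eq)
          where
          diff-eq : elt t ℤ.* (α i ℤ.- α j) ≈[ p ] elt t₀ ℤ.* (α (punchIn j₀ i₀) ℤ.- α (punchIn j₀ i₁))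
          diff-eq = ≈-comb₃ (ℤ.- ℤ.1ℤ) ℤ.1ℤ (ℤ.- ℤ.1ℤ) (block-diff t B i j) at at'
            (lem (elt t ℤ.* (α i ℤ.- α j)) (ι (block t B i)) (ι (block t B j)) (elt t₀) (α (punchIn j₀ i₀)) (α (punchIn j₀ i₁)) (α j₀))
            where
            lem : ∀ D x y t u v c → D ≡ t ℤ.* (u ℤ.- v) ℤ.+ ℤ.- ℤ.1ℤ ℤ.* ((x ℤ.- y) ℤ.- D) ℤ.+ ℤ.1ℤ ℤ.* (x ℤ.- t ℤ.* (u ℤ.- c)) ℤ.+ ℤ.- ℤ.1ℤ ℤ.* (y ℤ.- t ℤ.* (v ℤ.- c))
            lem = ℤ-Ring.solve-∀
          i₀≢i₁ : punchIn j₀ i₀ ≢ punchIn j₀ i₁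
          i₀≢i₁ eq = block-injective t B i≢j (ι-injective (≈-trans at (≈-trans (≈-reflexive (cong (λ z → elt t₀ ℤ.* (α z ℤ.- α j₀)) eq)) (≈-sym at'))))
          finish : t ≡ t₀ × i ≡ punchIn j₀ i₀ × j ≡ punchIn j₀ i₁ → ⊥
          finish (refl , ei , _) = E.sat t (up t b) j₀ (≈-comb₃ ℤ.1ℤ (ℤ.- ℤ.1ℤ) ℤ.1ℤ (block-≈ t B j₀) (block-≈ t B i)
              (≈-trans at (≈-reflexive (cong (λ z → elt t ℤ.* (α z ℤ.- α j₀)) (sym ei))))
              (lem (ι (block t B j₀)) (ι (block t B i)) (elt t) (α i) (α j₀) (ι B)))
            where
            lem : ∀ z x t u c b → z ≡ ℤ.0ℤ ℤ.+ ℤ.1ℤ ℤ.* (z ℤ.- (t ℤ.* c ℤ.+ b)) ℤ.+ ℤ.- ℤ.1ℤ ℤ.* (x ℤ.- (t ℤ.* u ℤ.+ b)) ℤ.+ ℤ.1ℤ ℤ.* (x ℤ.- t ℤ.* (u ℤ.- c))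
            lem = ℤ-Ring.solve-∀

record Seed (k τ : ℕ) : Set where
  field
    p-prime : Prime (suc (τ * suc k * k))
    planar  : Design (suc k) (Fin (suc (τ * suc k * k))) _≡_ (Fin τ × Fin (suc (τ * suc k * k)))
    derived : Design (suc k) (Fin (τ * suc k) × Fin k) Fibre (Fin τ × Fin (suc (τ * suc k * k) ∸ suc k))

seed-from : ∀ {p e κ} k τ → p ≡ suc (τ * suc k * k) → e ≡ tri (suc k) → κ ≡ 2 * τ → Colouring p e κ → 0 < e →
  suc k * (8 * (e * e)) * ((2 * e) ^ suc k * (2 * e) ^ suc k) < p → Seed k τ
seed-from {p} {e} k τ refl refl refl C 0<e big = build (embed w D 0<e big w 1 ≤-refl (s≤s z≤n) (≤-reflexive (*-identityˡ D)) (λ _ _ → 1) (λ _ _ → ≤-refl)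
    (λ _ → ≤-reflexive (sym (trans (*-identityˡ _) (trans (sum-const p 1) (*-identityʳ p))))) (σ unit))
  where
  open SecondMoment C
  open Colouring C
  open PairColour (suc k)
  w = suc k
  D = (2 * e) ^ w
  build : (∃ λ (a : Fin w → Fin p) → (∀ j → 1 ≡ 1) × (∀ i j → i Fin.< j → Col (σ unit i j) (a j ⊖ a i))) → Seed k τ
  build (a , _ , col) = record { p-prime = p-prime ; planar = planar ; derived = derived }
    where open Derived {k} {τ} C a (λ i j h → subst (λ c → Col c (a j ⊖ a i)) (σ-< unit i j h) (col i j h))

∃Seed : ∀ k → 1 ≤ k → ∀ K → 0 < K → ∃ λ τ → 0 < τ × K ∣ τ × Seed k τ
∃Seed k 1≤k K 0<K = build (∃Colouring e (B * K) 0<e (*-mono-≤ {1} {B} {1} {K} (s≤s z≤n) 0<K))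
  where
  e = tri (suc k)
  0<e : 0 < e
  0<e = ≤-trans 1≤k (m≤m+n k (tri k))
  -- The lower bound for p that `embed` demands when it starts from all residues, with density 1 and
  -- `Dmax` = (2 * e) ^ w. Making B a factor of τ enforces it.
  B₀ = suc k * (8 * (e * e)) * ((2 * e) ^ suc k * (2 * e) ^ suc k)
  B = suc B₀
  build : (∃₂ λ κ h → Colouring (suc (e * κ)) e κ × κ ≡ 2 * (B * K * h) × 0 < h) → ∃ λ τ → 0 < τ × K ∣ τ × Seed k τ
  build (κ , h , C , κ≡ , 0<h) = B * K * h , 0<τ , divides (B * h) (lem B K h) ,
    seed-from k (B * K * h) p≡ refl κ≡ C 0<e (s≤s (≤-trans (≤-trans (n≤1+n B₀) (≤-trans (m≤m*n B (K * h) {{m*n≢0 K h {{>-nonZero 0<K}} {{>-nonZero 0<h}}}}) (≤-reflexive (sym (*-assoc B K h)))))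
      (≤-trans (m≤n*m (B * K * h) 2) (≤-trans (≤-reflexive (sym κ≡)) (m≤n*m κ e {{>-nonZero 0<e}})))))
    where
    lem : ∀ B K h → B * K * h ≡ B * h * K
    lem = ℕ-Ring.solve-∀
    0<τ : 0 < B * K * h
    0<τ = *-mono-≤ {1} {B * K} {1} {h} (*-mono-≤ {1} {B} {1} {K} (s≤s z≤n) 0<K) 0<h
    p≡ : suc (e * κ) ≡ suc (B * K * h * suc k * k)
    p≡ = cong suc (trans (cong (e *_) κ≡) (trans (lem2 e (B * K * h)) (trans (cong (_* (B * K * h)) (2tri k)) (lem3 (suc k) k (B * K * h)))))
      where
      lem2 : ∀ e τ → e * (2 * τ) ≡ e * 2 * τ
      lem2 = ℕ-Ring.solve-∀
      lem3 : ∀ w k τ → w * k * τ ≡ τ * w * k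
      lem3 = ℕ-Ring.solve-∀

-- Group divisible designs and transversal designs

-- Only an injection, since block numbers are always estimated from below.
record Sized (I : Set) (b : ℕ) : Set where
  constructor sized
  field
    pick     : Fin b → I
    pick-inj : ∀ {x y} → pick x ≡ pick y → x ≡ y

Sized-Fin : ∀ {n} → Sized (Fin n) n
Sized-Fin = sized id id

Sized-× : ∀ {I J a b} → Sized I a → Sized J b → Sized (I × J) (a * b)
Sized-× {a = a} {b} (sized f f-inj) (sized g g-inj) = sized (λ x → let (i , j) = Fin.remQuot {a} b x in f i , g j)
  λ {x} {y} e → trans (sym (Fin.combine-remQuot {a} b x)) (trans (cong₂ Fin.combine (f-inj (cong proj₁ e)) (g-inj (cong proj₂ e))) (Fin.combine-remQuot {a} b y))

Sized-⊎ : ∀ {I J a b} → Sized I a → Sized J b → Sized (I ⊎ J) (a + b)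
Sized-⊎ {I} {J} {a} {b} (sized f f-inj) (sized g g-inj) = sized (λ x → h (Fin.splitAt a x))
  λ {x} {y} e → trans (sym (Fin.join-splitAt a b x)) (trans (cong (Fin.join a b) (h-inj _ _ e)) (Fin.join-splitAt a b y))
  where
  h : Fin a ⊎ Fin b → I ⊎ J
  h (inj₁ i) = inj₁ (f i)
  h (inj₂ j) = inj₂ (g j)
  h-inj : ∀ x y → h x ≡ h y → x ≡ y
  h-inj (inj₁ x) (inj₁ y) e = cong inj₁ (f-inj (inj₁-injective e))
  h-inj (inj₂ x) (inj₂ y) e = cong inj₂ (g-inj (inj₂-injective e))

Sized-map : ∀ {I J a} (f : I → J) → (∀ {x y} → f x ≡ f y → x ≡ y) → Sized I a → Sized J a
Sized-map f f-inj (sized g g-inj) = sized (f ∘ g) (g-inj ∘ f-inj)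

Design-reindex : ∀ {w X R I b} → Sized I b → Design w X R I → Design w X R (Fin b)
Design-reindex (sized f f-inj) D = record
  { blk = blk ∘ f ; transversal = λ i → transversal (f i) ; linear = λ h e e' → f-inj (linear h e e') }
  where open Design D

Design-map : ∀ {w X Y I} {R : X → X → Set} {S : Y → Y → Set} (f : X → Y) → (∀ {x y} → f x ≡ f y → x ≡ y) →
  (∀ {x y} → S (f x) (f y) → R x y) → Design w X R I → Design w Y S I
Design-map f f-inj rel D = record
  { blk = λ i l → f (blk i l) ; transversal = λ i h s → transversal i h (rel s)
  ; linear = λ h e e' → linear h (f-inj e) (f-inj e') }
  where open Design D

-- f / (k + 1) bounds the number of blocks by which a group divisible design of type k ^ N is missed.
record GDD (k N f : ℕ) : Set where
  constructor gdd
  field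
    size   : ℕ
    design : Design (suc k) (Fin N × Fin k) Fibre (Fin size)
    bound  : k * (N * N) ≤ suc k * size + f + k * N

GDD-from : ∀ {k N f P I} b → (g : P → Fin N) → (∀ {x y} → g x ≡ g y → x ≡ y) → Design (suc k) (P × Fin k) Fibre I →
  Sized I b → k * (N * N) ≤ suc k * b + f + k * N → GDD k N f
GDD-from b g g-inj D sz bd = gdd b (Design-map (λ (x , s) → g x , s)
  (λ e → cong₂ _,_ (g-inj (cong proj₁ e)) (cong proj₂ e)) g-inj (Design-reindex sz D)) bd

Design-injective : ∀ {w X R I} (D : Design w X R I) → (∀ x → R x x) → ∀ i {l m} → Design.blk D i l ≡ Design.blk D i m → l ≡ m
Design-injective {R = R} D R-refl i {l} {m} e with l Fin.≟ m
... | yes h = h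
... | no h = contradiction (subst (R (Design.blk D i l)) e (R-refl _)) (Design.transversal D i h)

-- The blocks are indexed by their two parameters, so there are q * q of them; `lin` then makes them
-- cover each pair of points on different levels exactly once.
record TD (w q : ℕ) : Set where
  field
    row : Fin q → Fin q → Fin w → Fin q
    lin : ∀ {a b a' b' i j} → i ≢ j → row a b i ≡ row a' b' i → row a b j ≡ row a' b' j → a ≡ a' × b ≡ b'

-- A transversal design with one more group, whose point on the block (a , c) is c.
record TD⁺ (w q : ℕ) : Set where
  field
    row  : Fin q → Fin q → Fin w → Fin q
    lin  : ∀ {a b a' b' i j} → i ≢ j → row a b i ≡ row a' b' i → row a b j ≡ row a' b' j → a ≡ a' × b ≡ b'
    last : ∀ {a a' c i} → row a c i ≡ row a' c i → a ≡ a'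

TD⁺⇒TD : ∀ {w q} → TD⁺ w q → TD w q
TD⁺⇒TD T = record { row = TD⁺.row T ; lin = TD⁺.lin T }

Rough : ℕ → ℕ → Set
Rough u q = ∀ d → 0 < d → d ≤ u → Coprime q d

abs-diff : ∀ {w} (i j : Fin w) → i ≢ j → 0 < ∣ + toℕ i ℤ.- + toℕ j ∣ × ∣ + toℕ i ℤ.- + toℕ j ∣ < w
abs-diff {w} i j i≢j = n≢0⇒n>0 (λ e → i≢j (Fin.toℕ-injective (ℤ.+-injective (ℤ.i-j≡0⇒i≡j _ _ (ℤ.∣i∣≡0⇒i≡0 e))))) ,
  ≤-<-trans (subst (λ z → ∣ z ∣ ≤ toℕ i ⊔ toℕ j) (sym (ℤ.m-n≡m⊖n (toℕ i) (toℕ j))) (ℤ.∣m⊝n∣≤m⊔n (toℕ i) (toℕ j))) (⊔-lub (Fin.toℕ<n i) (Fin.toℕ<n j))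

module CyclicTD (w q : ℕ) .{{_ : NonZero q}} (rough : Rough w q) where
  -- Blocks are the lines with slope a and offset c. Levels start at 1, not 0, so that the level
  -- itself is invertible modulo q; this gives `last`, and differences of levels are invertible in
  -- any case.
  lvl : Fin w → ℤ
  lvl i = + suc (toℕ i)

  row : Fin q → Fin q → Fin w → Fin q
  row a c i = red q (ι a ℤ.* lvl i ℤ.+ ι c)

  row-≈ : ∀ a c i → ι (row a c i) ≈[ q ] ι a ℤ.* lvl i ℤ.+ ι c
  row-≈ a c i = red-≈ q (ι a ℤ.* lvl i ℤ.+ ι c)

  cancel : ∀ d {x y : Fin q} → 0 < ∣ d ∣ → ∣ d ∣ ≤ w → d ℤ.* (ι x ℤ.- ι y) ≈[ q ] ℤ.0ℤ → x ≡ y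
  cancel d {x} {y} h h' e = ι-injective (-≈0⇒≈ (*-cancel-coprime d (rough ∣ d ∣ h h') e))

  last : ∀ {a a' c i} → row a c i ≡ row a' c i → a ≡ a'
  last {a} {a'} {c} {i} e = cancel (lvl i) (s≤s z≤n) (Fin.toℕ<n i)
    (≈-comb₃ ℤ.1ℤ (ℤ.- ℤ.1ℤ) ℤ.1ℤ (≈-reflexive (cong ι e)) (row-≈ a c i) (row-≈ a' c i) (lem (ι a) (ι a') (ι c) (lvl i) (ι (row a c i)) (ι (row a' c i))))
    where
    lem : ∀ a a' c l u v → l ℤ.* (a ℤ.- a') ≡ ℤ.0ℤ ℤ.+ ℤ.1ℤ ℤ.* (u ℤ.- v) ℤ.+ ℤ.- ℤ.1ℤ ℤ.* (u ℤ.- (a ℤ.* l ℤ.+ c)) ℤ.+ ℤ.1ℤ ℤ.* (v ℤ.- (a' ℤ.* l ℤ.+ c))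
    lem = ℤ-Ring.solve-∀

  shift : ∀ {a b a' b'} i → row a b i ≡ row a' b' i → ι a ℤ.* lvl i ℤ.+ ι b ≈[ q ] ι a' ℤ.* lvl i ℤ.+ ι b'
  shift {a} {b} {a'} {b'} i e = ≈-trans (≈-sym (row-≈ a b i)) (≈-trans (≈-reflexive (cong ι e)) (row-≈ a' b' i))

  lvl-diff : ∀ i j → + toℕ i ℤ.- + toℕ j ≡ lvl i ℤ.- lvl j
  lvl-diff i j = trans (lem (+ toℕ i) (+ toℕ j)) (cong₂ ℤ._-_ (sym (ℤ.pos-+ 1 (toℕ i))) (sym (ℤ.pos-+ 1 (toℕ j))))
    where
    lem : ∀ x y → x ℤ.- y ≡ (ℤ.1ℤ ℤ.+ x) ℤ.- (ℤ.1ℤ ℤ.+ y)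
    lem = ℤ-Ring.solve-∀

  slope : ∀ {a b a' b' i j} → i ≢ j → row a b i ≡ row a' b' i → row a b j ≡ row a' b' j → a ≡ a'
  slope {a} {b} {a'} {b'} {i} {j} h e e' = cancel (+ toℕ i ℤ.- + toℕ j) (proj₁ (abs-diff i j h)) (<⇒≤ (proj₂ (abs-diff i j h)))
    (≈-trans (≈-reflexive (cong (ℤ._* (ι a ℤ.- ι a')) (lvl-diff i j)))
      (≈-comb₂ ℤ.1ℤ (ℤ.- ℤ.1ℤ) (shift {a} {b} {a'} {b'} i e) (shift {a} {b} {a'} {b'} j e') (lem (ι a) (ι a') (ι b) (ι b') (lvl i) (lvl j))))
    where
    lem : ∀ a a' b b' l m → (l ℤ.- m) ℤ.* (a ℤ.- a') ≡ ℤ.0ℤ ℤ.+ ℤ.1ℤ ℤ.* ((a ℤ.* l ℤ.+ b) ℤ.- (a' ℤ.* l ℤ.+ b')) ℤ.+ ℤ.- ℤ.1ℤ ℤ.* ((a ℤ.* m ℤ.+ b) ℤ.- (a' ℤ.* m ℤ.+ b'))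
    lem = ℤ-Ring.solve-∀

  offset : ∀ {a b b'} i → row a b i ≡ row a b' i → b ≡ b'
  offset {a} {b} {b'} i e = ι-injective (≈-comb₁ ℤ.1ℤ (shift {a} {b} {a} {b'} i e) (lem (ι a ℤ.* lvl i) (ι b) (ι b')))
    where
    lem : ∀ x b b' → b ≡ b' ℤ.+ ℤ.1ℤ ℤ.* ((x ℤ.+ b) ℤ.- (x ℤ.+ b'))
    lem = ℤ-Ring.solve-∀

  td : TD⁺ w q
  td = record { row = row ; lin = lin ; last = last }
    where
    lin : ∀ {a b a' b' i j} → i ≢ j → row a b i ≡ row a' b' i → row a b j ≡ row a' b' j → a ≡ a' × b ≡ b'
    lin {a} {b} {a'} {b'} {i} {j} h e e' = finish (slope h e e')
      where
      finish : a ≡ a' → a ≡ a' × b ≡ b'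
      finish refl = refl , offset i e

record Lines (P Λ : Set) (n : Λ → ℕ) : Set₁ where
  field
    emb     : ∀ ℓ → Fin (n ℓ) → P
    emb-inj : ∀ ℓ {x y} → emb ℓ x ≡ emb ℓ y → x ≡ y
    at-most-one : ∀ {ℓ ℓ' x y x' y'} → x ≢ y → emb ℓ x ≡ emb ℓ' x' → emb ℓ y ≡ emb ℓ' y' → ℓ ≡ ℓ'

-- Wilson's fundamental construction with weight k: every point becomes a fibre of size k, and every
-- line is replaced by a design on its fibres. Two fibres lie on at most one common line, so blocks
-- of different lines cannot share a pair.
glue : ∀ {k P Λ n} {J : Λ → Set} → Lines P Λ n → (∀ ℓ → Design (suc k) (Fin (n ℓ) × Fin k) Fibre (J ℓ)) →
  Design (suc k) (P × Fin k) Fibre (Σ Λ J)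
glue {k} {P} {Λ} {n} {J} L D = record { blk = blk ; transversal = tr ; linear = lin }
  where
  open Lines L
  module D ℓ = Design (D ℓ)
  blk : Σ Λ J → Fin (suc k) → P × Fin k
  blk (ℓ , j) l = emb ℓ (proj₁ (D.blk ℓ j l)) , proj₂ (D.blk ℓ j l)
  tr : ∀ i {l m} → l ≢ m → ¬ Fibre (blk i l) (blk i m)
  tr (ℓ , j) h e = D.transversal ℓ j h (emb-inj ℓ e)
  lin : ∀ {i i' l m l' m'} → l ≢ m → blk i l ≡ blk i' l' → blk i m ≡ blk i' m' → i ≡ i'
  lin {ℓ , j} {ℓ' , j'} {l} {m} {l'} {m'} h e e' = finish (at-most-one (D.transversal ℓ j h) (cong proj₁ e) (cong proj₁ e')) j' e e'
    where
    finish : ∀ {ℓ'} → ℓ ≡ ℓ' → ∀ j' → blk (ℓ , j) l ≡ blk (ℓ' , j') l' → blk (ℓ , j) m ≡ blk (ℓ' , j') m' → (ℓ , j) ≡ (ℓ' , j')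
    finish refl j' e e' = cong (ℓ ,_) (D.linear ℓ h (cong₂ _,_ (emb-inj ℓ (cong proj₁ e)) (cong proj₂ e)) (cong₂ _,_ (emb-inj ℓ (cong proj₁ e')) (cong proj₂ e')))

-- The last group keeps t of its q points. In `C` the left summand holds the deleted points and the
-- right one the kept points, so a transverse line has u or u + 1 points accordingly.
module Truncated {u q t : ℕ} (T : TD⁺ u q) (t≤q : t ≤ q) where
  open TD⁺ T
  C = Fin (q ∸ t) ⊎ Fin t

  class : C → Fin q
  class c = Fin.cast (m∸n+n≡m t≤q) (Fin.join (q ∸ t) t c)

  class-inj : ∀ {c c'} → class c ≡ class c' → c ≡ c'
  class-inj {c} {c'} e = trans (sym (Fin.splitAt-join (q ∸ t) t c)) (trans (cong (Fin.splitAt (q ∸ t)) (cast-inj e)) (Fin.splitAt-join (q ∸ t) t c'))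
    where
    cast-inj : ∀ {x y} → Fin.cast (m∸n+n≡m t≤q) x ≡ Fin.cast (m∸n+n≡m t≤q) y → x ≡ y
    cast-inj {x} {y} e = Fin.toℕ-injective (trans (sym (Fin.toℕ-cast _ x)) (trans (cong toℕ e) (Fin.toℕ-cast _ y)))

  P = (Fin u × Fin q) ⊎ Fin t

  data Λ : Set where
    transverse : Fin q → C → Λ
    group      : Fin u → Λ
    short      : Λ

  n : Λ → ℕ
  n (transverse a (inj₁ _)) = u
  n (transverse a (inj₂ _)) = suc u
  n (group _) = q
  n short = t

  -- Incidence in coordinates. It lets `meet` compare two lines by cases on their common points,
  -- independently of the positions that the points have on the lines.
  On : Λ → P → Set
  On (transverse a c) (inj₁ (i , y)) = y ≡ row a (class c) i
  On (transverse a c) (inj₂ x) = c ≡ inj₂ x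
  On (group j) (inj₁ (i , y)) = i ≡ j
  On (group j) (inj₂ x) = ⊥
  On short (inj₁ _) = ⊥
  On short (inj₂ _) = ⊤

  emb : ∀ ℓ → Fin (n ℓ) → P
  emb (transverse a c@(inj₁ _)) i = inj₁ (i , row a (class c) i)
  emb (transverse a c@(inj₂ x)) zero = inj₂ x
  emb (transverse a c@(inj₂ x)) (suc i) = inj₁ (i , row a (class c) i)
  emb (group j) y = inj₁ (j , y)
  emb short x = inj₂ x

  emb-On : ∀ ℓ x → On ℓ (emb ℓ x)
  emb-On (transverse a (inj₁ _)) i = refl
  emb-On (transverse a (inj₂ x)) zero = refl
  emb-On (transverse a (inj₂ x)) (suc i) = refl
  emb-On (group j) y = refl
  emb-On short x = tt

  emb-inj : ∀ ℓ {x y} → emb ℓ x ≡ emb ℓ y → x ≡ y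
  emb-inj (transverse a (inj₁ _)) e = cong proj₁ (inj₁-injective e)
  emb-inj (transverse a (inj₂ x)) {zero} {zero} e = refl
  emb-inj (transverse a (inj₂ x)) {suc i} {suc j} e = cong suc (cong proj₁ (inj₁-injective e))
  emb-inj (group j) e = cong proj₂ (inj₁-injective e)
  emb-inj short e = inj₂-injective e

  meet : ∀ ℓ ℓ' p p' → p ≢ p' → On ℓ p → On ℓ p' → On ℓ' p → On ℓ' p' → ℓ ≡ ℓ'
  meet (transverse a c) (transverse a' c') (inj₁ (i , y)) (inj₁ (i' , y')) p≢p' o1 o2 o3 o4 with i Fin.≟ i'
  ... | yes refl = contradiction (cong (λ z → inj₁ (i , z)) (trans o1 (sym o2))) p≢p'
  ... | no i≢i' with lin i≢i' (trans (sym o1) o3) (trans (sym o2) o4)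
  ...   | refl , e = cong (transverse a) (class-inj e)
  meet (transverse a c) (group j) (inj₁ (i , y)) (inj₁ (i' , y')) p≢p' o1 o2 refl refl = contradiction (cong (λ z → inj₁ (i , z)) (trans o1 (sym o2))) p≢p'
  meet (group j) (transverse a' c') (inj₁ (i , y)) (inj₁ (i' , y')) p≢p' refl refl o3 o4 = contradiction (cong (λ z → inj₁ (i , z)) (trans o3 (sym o4))) p≢p'
  meet (group j) (group j') (inj₁ _) (inj₁ _) p≢p' refl refl refl refl = refl
  meet short _ (inj₁ _) _ _ () _ _ _
  meet _ short (inj₁ _) _ _ _ _ () _
  meet (transverse a c) (transverse a' c') (inj₁ (i , y)) (inj₂ x) p≢p' o1 refl o3 refl = cong (λ z → transverse z (inj₂ x)) (last (trans (sym o1) o3))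
  meet (transverse _ _) (group _) (inj₁ _) (inj₂ _) _ _ _ _ ()
  meet (group _) _ (inj₁ _) (inj₂ _) _ _ () _ _
  meet (transverse a c) (transverse a' c') (inj₂ x) (inj₁ (i , y)) p≢p' refl o2 refl o4 = cong (λ z → transverse z (inj₂ x)) (last (trans (sym o2) o4))
  meet (transverse _ _) (group _) (inj₂ _) _ _ _ _ () _
  meet (transverse _ _) short (inj₂ _) (inj₁ _) _ _ _ _ ()
  meet (group _) _ (inj₂ _) _ _ () _ _ _
  meet short _ (inj₂ _) (inj₁ _) _ _ () _ _
  meet (transverse a c) _ (inj₂ x) (inj₂ x') p≢p' refl refl _ _ = contradiction refl p≢p'
  meet short (transverse a' c') (inj₂ x) (inj₂ x') p≢p' _ _ refl refl = contradiction refl p≢p'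
  meet short (group _) (inj₂ _) (inj₂ _) _ _ _ () _
  meet short short (inj₂ _) (inj₂ _) _ _ _ _ _ = refl

  lines : Lines P Λ n
  lines = record
    { emb = emb ; emb-inj = emb-inj
    ; at-most-one = λ {ℓ} {ℓ'} {x} {y} {x'} {y'} h e e' → meet ℓ ℓ' (emb ℓ x) (emb ℓ y) (λ eq → h (emb-inj ℓ eq)) (emb-On ℓ x) (emb-On ℓ y)
        (subst (On ℓ') (sym e) (emb-On ℓ' x')) (subst (On ℓ') (sym e') (emb-On ℓ' y')) }

  module _ {k bu bv bq bt : ℕ} (Du : Design (suc k) (Fin u × Fin k) Fibre (Fin bu)) (Dv : Design (suc k) (Fin (suc u) × Fin k) Fibre (Fin bv))
    (Dq : Design (suc k) (Fin q × Fin k) Fibre (Fin bq)) (Dt : Design (suc k) (Fin t × Fin k) Fibre (Fin bt)) where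
    Ix : Λ → Set
    Ix (transverse a (inj₁ _)) = Fin bu
    Ix (transverse a (inj₂ _)) = Fin bv
    Ix (group _) = Fin bq
    Ix short = Fin bt

    D : ∀ ℓ → Design (suc k) (Fin (n ℓ) × Fin k) Fibre (Ix ℓ)
    D (transverse a (inj₁ _)) = Du
    D (transverse a (inj₂ _)) = Dv
    D (group _) = Dq
    D short = Dt

    index : (((Fin q × Fin (q ∸ t)) × Fin bu) ⊎ ((Fin q × Fin t) × Fin bv)) ⊎ ((Fin u × Fin bq) ⊎ Fin bt) → Σ Λ Ix
    index (inj₁ (inj₁ ((a , c) , x))) = transverse a (inj₁ c) , x
    index (inj₁ (inj₂ ((a , c) , x))) = transverse a (inj₂ c) , x
    index (inj₂ (inj₁ (i , x))) = group i , x
    index (inj₂ (inj₂ x)) = short , x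

    index-inj : ∀ x y → index x ≡ index y → x ≡ y
    index-inj (inj₁ (inj₁ _)) (inj₁ (inj₁ _)) refl = refl
    index-inj (inj₁ (inj₂ _)) (inj₁ (inj₂ _)) refl = refl
    index-inj (inj₂ (inj₁ _)) (inj₂ (inj₁ _)) refl = refl
    index-inj (inj₂ (inj₂ _)) (inj₂ (inj₂ _)) refl = refl
    index-inj (inj₁ (inj₁ _)) (inj₂ (inj₁ _)) ()
    index-inj (inj₁ (inj₁ _)) (inj₂ (inj₂ _)) ()
    index-inj (inj₁ (inj₂ _)) (inj₂ (inj₁ _)) ()
    index-inj (inj₁ (inj₂ _)) (inj₂ (inj₂ _)) ()
    index-inj (inj₂ (inj₁ _)) (inj₁ (inj₁ _)) ()
    index-inj (inj₂ (inj₁ _)) (inj₁ (inj₂ _)) ()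
    index-inj (inj₂ (inj₂ _)) (inj₁ (inj₁ _)) ()
    index-inj (inj₂ (inj₂ _)) (inj₁ (inj₂ _)) ()

    truncated : Design (suc k) (P × Fin k) Fibre (Σ Λ Ix)
    truncated = glue lines D

    truncated-size : Sized (Σ Λ Ix) ((q * (q ∸ t) * bu + q * t * bv) + (u * bq + bt))
    truncated-size = Sized-map index (λ {x} {y} → index-inj x y)
      (Sized-⊎ (Sized-⊎ (Sized-× (Sized-× Sized-Fin Sized-Fin) Sized-Fin) (Sized-× (Sized-× Sized-Fin Sized-Fin) Sized-Fin))
        (Sized-⊎ (Sized-× Sized-Fin Sized-Fin) Sized-Fin))

-- Every two points lie on a line, so the inequalities of the ingredients add up to that of the
-- result. The transverse lines carry designs without deficiency; only the u long groups and the
-- short one contribute.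
GDD-truncated : ∀ {k u q t f g} → GDD k u 0 → GDD k (suc u) 0 → TD⁺ u q → t ≤ q → GDD k q f → GDD k t g → GDD k (u * q + t) (u * f + g)
GDD-truncated {k} {u} {q} {t} {f} {g} (gdd bu Du hu) (gdd bv Dv hv) T t≤q (gdd bq Dq hq) (gdd bt Dt ht) =
  GDD-from _ (λ x → Fin.join (u * q) t (pt x)) (λ {x} {y} e → pt-inj x y (trans (sym (Fin.splitAt-join (u * q) t (pt x))) (trans (cong (Fin.splitAt (u * q)) e) (Fin.splitAt-join (u * q) t (pt y)))))
    (truncated Du Dv Dq Dt) (truncated-size Du Dv Dq Dt) (arithmetic (q ∸ t) (m+[n∸m]≡n t≤q))
  where
  open Truncated T t≤q
  pt : P → Fin (u * q) ⊎ Fin t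
  pt (inj₁ (i , y)) = inj₁ (Fin.combine i y)
  pt (inj₂ x) = inj₂ x
  pt-inj : ∀ x y → pt x ≡ pt y → x ≡ y
  pt-inj (inj₁ (i , y)) (inj₁ (i' , y')) e with Fin.combine-injective i y i' y' (inj₁-injective e)
  ... | refl , refl = refl
  pt-inj (inj₂ x) (inj₂ y) e = cong inj₂ (inj₂-injective e)
  arithmetic : ∀ r → t + r ≡ q → k * ((u * q + t) * (u * q + t)) ≤ suc k * (q * r * bu + q * t * bv + (u * bq + bt)) + (u * f + g) + k * (u * q + t)
  arithmetic r refl = +-cancelʳ-≤ (q * r * (k * u) + q * t * (k * suc u) + u * (k * q) + k * t) _ _ (begin
    k * ((u * q + t) * (u * q + t)) + (q * r * (k * u) + q * t * (k * suc u) + u * (k * q) + k * t) ≡⟨ lem1 k u t r ⟩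
    q * r * (k * (u * u)) + q * t * (k * (suc u * suc u)) + u * (k * (q * q)) + k * (t * t) + k * (u * q + t)
      ≤⟨ +-monoˡ-≤ (k * (u * q + t)) (+-mono-≤ (+-mono-≤ (+-mono-≤ (*-monoʳ-≤ (q * r) hu) (*-monoʳ-≤ (q * t) hv)) (*-monoʳ-≤ u hq)) ht) ⟩
    q * r * (suc k * bu + 0 + k * u) + q * t * (suc k * bv + 0 + k * suc u) + u * (suc k * bq + f + k * q) + (suc k * bt + g + k * t) + k * (u * q + t)
      ≡⟨ lem2 k u t r bu bv bq bt f g ⟩
    suc k * (q * r * bu + q * t * bv + (u * bq + bt)) + (u * f + g) + k * (u * q + t) + (q * r * (k * u) + q * t * (k * suc u) + u * (k * q) + k * t) ∎)
    where
    open ≤-Reasoning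
    lem1 : ∀ k u t r → k * ((u * (t + r) + t) * (u * (t + r) + t)) + ((t + r) * r * (k * u) + (t + r) * t * (k * suc u) + u * (k * (t + r)) + k * t) ≡
      (t + r) * r * (k * (u * u)) + (t + r) * t * (k * (suc u * suc u)) + u * (k * ((t + r) * (t + r))) + k * (t * t) + k * (u * (t + r) + t)
    lem1 = ℕ-Ring.solve-∀
    lem2 : ∀ k u t r bu bv bq bt f g → (t + r) * r * (suc k * bu + 0 + k * u) + (t + r) * t * (suc k * bv + 0 + k * suc u) + u * (suc k * bq + f + k * (t + r)) + (suc k * bt + g + k * t) + k * (u * (t + r) + t) ≡
      suc k * ((t + r) * r * bu + (t + r) * t * bv + (u * bq + bt)) + (u * f + g) + k * (u * (t + r) + t) + ((t + r) * r * (k * u) + (t + r) * t * (k * suc u) + u * (k * (t + r)) + k * t)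
    lem2 = ℕ-Ring.solve-∀

join-injective : ∀ {m n} {x y : Fin m ⊎ Fin n} → Fin.join m n x ≡ Fin.join m n y → x ≡ y
join-injective {m} {n} {x} {y} e = trans (sym (Fin.splitAt-join m n x)) (trans (cong (Fin.splitAt m) e) (Fin.splitAt-join m n y))

combine-injective : ∀ {m n} {x y : Fin m × Fin n} → Fin.combine (proj₁ x) (proj₂ x) ≡ Fin.combine (proj₁ y) (proj₂ y) → x ≡ y
combine-injective {x = i , j} {i' , j'} e = let (a , b) = Fin.combine-injective i j i' j' e in cong₂ _,_ a b

remQuot-injective : ∀ {m} n {x y : Fin (m * n)} → Fin.remQuot {m} n x ≡ Fin.remQuot {m} n y → x ≡ y
remQuot-injective {m} n {x} {y} e = trans (sym (Fin.combine-remQuot {m} n x)) (trans (cong (λ z → Fin.combine (proj₁ z) (proj₂ z)) e) (Fin.combine-remQuot {m} n y))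

-- Every old group is inflated to M groups: a block of D is spread over them by the transversal
-- design, and a copy of E is placed over each old group.
module Product {k N M : ℕ} {I J : Set} (D : Design (suc k) (Fin N × Fin k) Fibre I) (E : Design (suc k) (Fin M × Fin k) Fibre J) (T : TD (suc k) M) where
  open TD T using (row)
  module D = Design D
  module E = Design E
  Ix = (I × (Fin M × Fin M)) ⊎ (Fin N × J)

  blk : Ix → Fin (suc k) → (Fin N × Fin M) × Fin k
  blk (inj₁ (i , a , b)) l = (proj₁ (D.blk i l) , row a b l) , proj₂ (D.blk i l)
  blk (inj₂ (x , j)) l = (x , proj₁ (E.blk j l)) , proj₂ (E.blk j l)

  tr : ∀ i {l m} → l ≢ m → ¬ Fibre (blk i l) (blk i m)
  tr (inj₁ (i , a , b)) h e = D.transversal i h (cong proj₁ e)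
  tr (inj₂ (x , j)) h e = E.transversal j h (cong proj₂ e)

  lin : ∀ i i' {l m l' m'} → l ≢ m → blk i l ≡ blk i' l' → blk i m ≡ blk i' m' → i ≡ i'
  lin (inj₁ (i , a , b)) (inj₁ (i' , a' , b')) {l} {m} {l'} {m'} h e e' = finish (D.linear h (part e) (part e')) (cong (proj₂ ∘ proj₁) e) (cong (proj₂ ∘ proj₁) e')
    where
    part : ∀ {l l'} → blk (inj₁ (i , a , b)) l ≡ blk (inj₁ (i' , a' , b')) l' → D.blk i l ≡ D.blk i' l'
    part e = cong₂ _,_ (cong (proj₁ ∘ proj₁) e) (cong proj₂ e)
    finish : i ≡ i' → row a b l ≡ row a' b' l' → row a b m ≡ row a' b' m' → inj₁ (i , a , b) ≡ inj₁ (i' , a' , b')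
    finish refl r r' with Design-injective D (λ _ → refl) i (part e) | Design-injective D (λ _ → refl) i (part e')
    ... | refl | refl = let (x , y) = lin' r r' in cong₂ (λ x y → inj₁ (i , x , y)) x y
      where
      lin' : row a b l ≡ row a' b' l → row a b m ≡ row a' b' m → a ≡ a' × b ≡ b'
      lin' = TD.lin T h
  lin (inj₁ (i , a , b)) (inj₂ (x , j)) h e e' = contradiction (trans (cong (proj₁ ∘ proj₁) e) (sym (cong (proj₁ ∘ proj₁) e'))) (D.transversal i h)
  lin (inj₂ (x , j)) (inj₁ (i , a , b)) {l} {m} {l'} {m'} h e e' = contradiction (trans (sym (cong (proj₁ ∘ proj₁) e)) (cong (proj₁ ∘ proj₁) e')) (D.transversal i l'≢m')
    where
    l'≢m' : l' ≢ m'
    l'≢m' refl = h (Design-injective E (λ _ → refl) j (cong (λ z → proj₂ (proj₁ z) , proj₂ z) (trans e (sym e'))))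
  lin (inj₂ (x , j)) (inj₂ (x' , j')) h e e' = cong₂ (λ x y → inj₂ (x , y)) (cong (proj₁ ∘ proj₁) e)
    (E.linear h (cong (λ z → proj₂ (proj₁ z) , proj₂ z) e) (cong (λ z → proj₂ (proj₁ z) , proj₂ z) e'))

  product-design : Design (suc k) ((Fin N × Fin M) × Fin k) Fibre Ix
  product-design = record { blk = blk ; transversal = tr ; linear = λ {i} {i'} → lin i i' }

GDD-product : ∀ {k N M} → GDD k N 0 → GDD k M 0 → TD (suc k) M → GDD k (N * M) 0
GDD-product {k} {N} {M} (gdd b D hb) (gdd c E hc) T = GDD-from (b * (M * M) + N * c) (λ (x , y) → Fin.combine x y) combine-injective
  (Product.product-design D E T) (Sized-⊎ (Sized-× Sized-Fin (Sized-× Sized-Fin Sized-Fin)) (Sized-× Sized-Fin Sized-Fin))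
  (+-cancelʳ-≤ (k * N * (M * M) + N * (k * M)) _ _ (begin
    k * (N * M * (N * M)) + (k * N * (M * M) + N * (k * M)) ≡⟨ l1 k N M ⟩
    k * (N * N) * (M * M) + N * (k * (M * M)) + k * (N * M) ≤⟨ +-monoˡ-≤ (k * (N * M)) (+-mono-≤ (*-monoˡ-≤ (M * M) hb) (*-monoʳ-≤ N hc)) ⟩
    (suc k * b + 0 + k * N) * (M * M) + N * (suc k * c + 0 + k * M) + k * (N * M) ≡⟨ l2 k N M b c ⟩
    suc k * (b * (M * M) + N * c) + 0 + k * (N * M) + (k * N * (M * M) + N * (k * M)) ∎))
  where
  open ≤-Reasoning
  l1 : ∀ k N M → k * (N * M * (N * M)) + (k * N * (M * M) + N * (k * M)) ≡ k * (N * N) * (M * M) + N * (k * (M * M)) + k * (N * M)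
  l1 = ℕ-Ring.solve-∀
  l2 : ∀ k N M b c → (suc k * b + 0 + k * N) * (M * M) + N * (suc k * c + 0 + k * M) + k * (N * M) ≡ suc k * (b * (M * M) + N * c) + 0 + k * (N * M) + (k * N * (M * M) + N * (k * M))
  l2 = ℕ-Ring.solve-∀

-- The a * k points of a layer form one group of the transversal design, which joins different
-- layers; inside each layer E is used.
module Layers {k a : ℕ} {J : Set} (E : Design (suc k) (Fin a × Fin k) Fibre J) (T : TD (suc k) (a * k)) where
  open TD T using (row)
  module E = Design E
  w = suc k
  Ix = (Fin (a * k) × Fin (a * k)) ⊎ (Fin w × J)

  val : Fin (a * k) → Fin (a * k) → Fin w → Fin a × Fin k
  val x y l = Fin.remQuot {a} k (row x y l)

  blk : Ix → Fin w → (Fin w × Fin a) × Fin k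
  blk (inj₁ (x , y)) l = (l , proj₁ (val x y l)) , proj₂ (val x y l)
  blk (inj₂ (i , j)) l = (i , proj₁ (E.blk j l)) , proj₂ (E.blk j l)

  lin : ∀ i i' {l m l' m'} → l ≢ m → blk i l ≡ blk i' l' → blk i m ≡ blk i' m' → i ≡ i'
  lin (inj₁ (x , y)) (inj₁ (x' , y')) {l} {m} h e e' = finish (cong (proj₁ ∘ proj₁) e) (cong (proj₁ ∘ proj₁) e') (val-eq e) (val-eq e')
    where
    val-eq : ∀ {l l'} → blk (inj₁ (x , y)) l ≡ blk (inj₁ (x' , y')) l' → row x y l ≡ row x' y' l'
    val-eq e = remQuot-injective {a} k (cong₂ _,_ (cong (proj₂ ∘ proj₁) e) (cong proj₂ e))
    finish : ∀ {l' m'} → l ≡ l' → m ≡ m' → row x y l ≡ row x' y' l' → row x y m ≡ row x' y' m' → inj₁ (x , y) ≡ inj₁ (x' , y')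
    finish refl refl r r' = let (a , b) = TD.lin T h r r' in cong₂ (λ a b → inj₁ (a , b)) a b
  lin (inj₁ (x , y)) (inj₂ (i , j)) h e e' = contradiction (trans (cong (proj₁ ∘ proj₁) e) (sym (cong (proj₁ ∘ proj₁) e'))) h
  lin (inj₂ (i , j)) (inj₁ (x , y)) {l} {m} {l'} {m'} h e e' = contradiction (Design-injective E (λ _ → refl) j (cong (λ z → proj₂ (proj₁ z) , proj₂ z) (trans e (trans (cong (blk (inj₁ (x , y))) l'≡m') (sym e'))))) h
    where
    l'≡m' : l' ≡ m'
    l'≡m' = trans (sym (cong (proj₁ ∘ proj₁) e)) (cong (proj₁ ∘ proj₁) e')
  lin (inj₂ (i , j)) (inj₂ (i' , j')) h e e' = cong₂ (λ x y → inj₂ (x , y)) (cong (proj₁ ∘ proj₁) e)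
    (E.linear h (cong (λ z → proj₂ (proj₁ z) , proj₂ z) e) (cong (λ z → proj₂ (proj₁ z) , proj₂ z) e'))

  tr : ∀ i {l m} → l ≢ m → ¬ Fibre (blk i l) (blk i m)
  tr (inj₁ _) h e = h (cong proj₁ e)
  tr (inj₂ (i , j)) h e = E.transversal j h (cong proj₂ e)

  layered : Design w ((Fin w × Fin a) × Fin k) Fibre Ix
  layered = record { blk = blk ; transversal = tr ; linear = λ {i} {i'} → lin i i' }

GDD-layers : ∀ {k a} → GDD k a 0 → TD (suc k) (a * k) → GDD k (suc k * a) 0
GDD-layers {k} {a} (gdd b D hb) T = GDD-from (a * k * (a * k) + suc k * b) (λ (x , y) → Fin.combine x y) combine-injective
  (Layers.layered D T) (Sized-⊎ (Sized-× Sized-Fin Sized-Fin) (Sized-× Sized-Fin Sized-Fin))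
  (+-cancelʳ-≤ (suc k * (k * a)) _ _ (begin
    k * (suc k * a * (suc k * a)) + suc k * (k * a) ≡⟨ l1 k a ⟩
    suc k * (k * (a * a)) + (suc k * (a * k * (a * k)) + k * (suc k * a)) ≤⟨ +-monoˡ-≤ _ (*-monoʳ-≤ (suc k) hb) ⟩
    suc k * (suc k * b + 0 + k * a) + (suc k * (a * k * (a * k)) + k * (suc k * a)) ≡⟨ l2 k a b ⟩
    suc k * (a * k * (a * k) + suc k * b) + 0 + k * (suc k * a) + suc k * (k * a) ∎))
  where
  open ≤-Reasoning
  l1 : ∀ k a → k * (suc k * a * (suc k * a)) + suc k * (k * a) ≡ suc k * (k * (a * a)) + (suc k * (a * k * (a * k)) + k * (suc k * a))
  l1 = ℕ-Ring.solve-∀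
  l2 : ∀ k a b → suc k * (suc k * b + 0 + k * a) + (suc k * (a * k * (a * k)) + k * (suc k * a)) ≡ suc k * (a * k * (a * k) + suc k * b) + 0 + k * (suc k * a) + suc k * (k * a)
  l2 = ℕ-Ring.solve-∀

-- The transversal design on k + 1 copies of ℤ/p with a point of the last copy deleted; the p blocks through that point become
-- the fibres Fin p, the remaining residues of its group carry the derived design with fibres Fin a.
module OneMore {k a : ℕ} {I J : Set} (pp : Prime (suc (a * k))) (k<p : k ≤ suc (a * k)) (D : Design (suc k) (Fin (suc (a * k))) _≡_ I) (E : Design (suc k) (Fin a × Fin k) Fibre J) where
  open PrimeField pp
  module D = Design D
  module E = Design E
  m p w : ℕ
  m = a * k
  p = suc m
  w = suc k
  P = Fin p ⊎ Fin a
  Ix = (Fin p × Fin m) ⊎ ((Fin k × I) ⊎ J)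

  sl : Fin m → ℤ
  sl d = ι (Fin.suc d)

  at : Fin p → Fin m → Fin k → Fin p
  at c d i = red p (ι c ℤ.+ sl d ℤ.* + toℕ i)

  at-≈ : ∀ c d i → ι (at c d i) ≈[ p ] ι c ℤ.+ sl d ℤ.* + toℕ i
  at-≈ c d i = red-≈ p (ι c ℤ.+ sl d ℤ.* + toℕ i)

  lvl≉ : ∀ {i j : Fin k} → i ≢ j → ¬ + toℕ i ℤ.- + toℕ j ≈[ p ] ℤ.0ℤ
  lvl≉ {i} {j} h e = <⇒≱ (<-≤-trans (proj₂ (abs-diff i j h)) k<p) (∣⇒≤ {{>-nonZero (proj₁ (abs-diff i j h))}} (≈0⇒∣ e))

  at-offset : ∀ {c c'} d i → at c d i ≡ at c' d i → c ≡ c'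
  at-offset {c} {c'} d i e = ι-injective (≈-comb₃ ℤ.1ℤ (ℤ.- ℤ.1ℤ) ℤ.1ℤ (≈-reflexive (cong ι e)) (at-≈ c d i) (at-≈ c' d i) (lem (ι c) (ι c') (sl d ℤ.* + toℕ i) (ι (at c d i)) (ι (at c' d i))))
    where
    lem : ∀ c c' x u v → c ≡ c' ℤ.+ ℤ.1ℤ ℤ.* (u ℤ.- v) ℤ.+ ℤ.- ℤ.1ℤ ℤ.* (u ℤ.- (c ℤ.+ x)) ℤ.+ ℤ.1ℤ ℤ.* (v ℤ.- (c' ℤ.+ x))
    lem = ℤ-Ring.solve-∀

  at-eq : ∀ {c d c' d'} i → at c d i ≡ at c' d' i → ι c ℤ.+ sl d ℤ.* + toℕ i ≈[ p ] ι c' ℤ.+ sl d' ℤ.* + toℕ i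
  at-eq {c} {d} {c'} {d'} i e = ≈-trans (≈-sym (at-≈ c d i)) (≈-trans (≈-reflexive (cong ι e)) (at-≈ c' d' i))

  at-slope : ∀ {c d c' d' i j} → i ≢ j → at c d i ≡ at c' d' i → at c d j ≡ at c' d' j → d ≡ d'
  at-slope {c} {d} {c'} {d'} {i} {j} h e e' = Fin.suc-injective (ι-injective (*-cancelˡ-≈ {+ toℕ i ℤ.- + toℕ j} (sl d) (sl d') (lvl≉ h)
    (≈-comb₂ ℤ.1ℤ (ℤ.- ℤ.1ℤ) (at-eq {c} {d} {c'} {d'} i e) (at-eq {c} {d} {c'} {d'} j e') (lem (ι c) (ι c') (sl d) (sl d') (+ toℕ i) (+ toℕ j)))))
    where
    lem : ∀ c c' s s' i j → (i ℤ.- j) ℤ.* s ≡ (i ℤ.- j) ℤ.* s' ℤ.+ ℤ.1ℤ ℤ.* ((c ℤ.+ s ℤ.* i) ℤ.- (c' ℤ.+ s' ℤ.* i)) ℤ.+ ℤ.- ℤ.1ℤ ℤ.* ((c ℤ.+ s ℤ.* j) ℤ.- (c' ℤ.+ s' ℤ.* j))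
    lem = ℤ-Ring.solve-∀

  at-moves : ∀ c d {i j} → i ≢ j → at c d i ≢ at c d j
  at-moves c d {i} {j} h e = *≉0 {sl d} {+ toℕ i ℤ.- + toℕ j} (ι≉0 d) (lvl≉ h) (≈-comb₃ ℤ.1ℤ (ℤ.- ℤ.1ℤ) ℤ.1ℤ (≈-reflexive (cong ι e)) (at-≈ c d i) (at-≈ c d j)
    (lem (ι c) (sl d) (+ toℕ i) (+ toℕ j) (ι (at c d i)) (ι (at c d j))))
    where
    lem : ∀ c s i j u v → s ℤ.* (i ℤ.- j) ≡ ℤ.0ℤ ℤ.+ ℤ.1ℤ ℤ.* (u ℤ.- v) ℤ.+ ℤ.- ℤ.1ℤ ℤ.* (u ℤ.- (c ℤ.+ s ℤ.* i)) ℤ.+ ℤ.1ℤ ℤ.* (v ℤ.- (c ℤ.+ s ℤ.* j))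
    lem = ℤ-Ring.solve-∀

  blk : Ix → Fin w → P × Fin k
  blk (inj₁ (c , d)) zero = inj₂ (proj₁ (Fin.remQuot {a} k d)) , proj₂ (Fin.remQuot {a} k d)
  blk (inj₁ (c , d)) (suc i) = inj₁ (at c d i) , i
  blk (inj₂ (inj₁ (i , j))) l = inj₁ (D.blk j l) , i
  blk (inj₂ (inj₂ j)) l = inj₂ (proj₁ (E.blk j l)) , proj₂ (E.blk j l)

  tr : ∀ i {l m} → l ≢ m → ¬ Fibre (blk i l) (blk i m)
  tr (inj₁ (c , d)) {zero} {zero} h e = h refl
  tr (inj₁ (c , d)) {suc i} {suc j} h e = at-moves c d (λ eq → h (cong suc eq)) (inj₁-injective e)
  tr (inj₂ (inj₁ (i , j))) h e = D.transversal j h (inj₁-injective e)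
  tr (inj₂ (inj₂ j)) h e = E.transversal j h (inj₂-injective e)

  first : ∀ {d d'} → (inj₂ {A = Fin p} (proj₁ (Fin.remQuot {a} k d)) , proj₂ (Fin.remQuot {a} k d)) ≡ (inj₂ (proj₁ (Fin.remQuot {a} k d')) , proj₂ (Fin.remQuot {a} k d')) → d ≡ d'
  first e = remQuot-injective {a} k (cong₂ _,_ (inj₂-injective (cong proj₁ e)) (cong proj₂ e))

  lin₁ : ∀ c d c' d' {l m l' m'} → l ≢ m → blk (inj₁ (c , d)) l ≡ blk (inj₁ (c' , d')) l' → blk (inj₁ (c , d)) m ≡ blk (inj₁ (c' , d')) m' → (c , d) ≡ (c' , d')
  lin₁ c d c' d' {zero} {zero} h e e' = contradiction refl h
  lin₁ c d c' d' {zero} {suc i} {zero} {suc i'} h e e' with first e | cong proj₂ e'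
  ... | refl | refl = cong (_, d) (at-offset d i (inj₁-injective (cong proj₁ e')))
  lin₁ c d c' d' {suc i} {zero} {suc i'} {zero} h e e' with first e' | cong proj₂ e
  ... | refl | refl = cong (_, d) (at-offset d i (inj₁-injective (cong proj₁ e)))
  lin₁ c d c' d' {suc i} {suc j} {suc i'} {suc j'} h e e' = finish (cong proj₂ e) (cong proj₂ e') (inj₁-injective (cong proj₁ e)) (inj₁-injective (cong proj₁ e'))
    where
    finish : ∀ {i' j'} → i ≡ i' → j ≡ j' → at c d i ≡ at c' d' i' → at c d j ≡ at c' d' j' → (c , d) ≡ (c' , d')
    finish refl refl r r' = finish' (at-slope {c} {d} {c'} {d'} (λ eq → h (cong suc eq)) r r') r
      where
      finish' : ∀ {d'} → d ≡ d' → at c d i ≡ at c' d' i → (c , d) ≡ (c' , d')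
      finish' refl r = cong (_, d) (at-offset d i r)

  not₁₂ : ∀ c d i j {l m l' m'} → l ≢ m → blk (inj₁ (c , d)) l ≡ blk (inj₂ (inj₁ (i , j))) l' → blk (inj₁ (c , d)) m ≡ blk (inj₂ (inj₁ (i , j))) m' → ⊥
  not₁₂ c d i j {suc x} {suc y} h e e' = h (cong suc (trans (cong proj₂ e) (sym (cong proj₂ e'))))

  not₁₃ : ∀ c d j {l m l' m'} → l ≢ m → blk (inj₁ (c , d)) l ≡ blk (inj₂ (inj₂ j)) l' → blk (inj₁ (c , d)) m ≡ blk (inj₂ (inj₂ j)) m' → ⊥
  not₁₃ c d j {zero} {zero} h e e' = h refl

  blk-inj : ∀ i {l m} → blk i l ≡ blk i m → l ≡ m
  blk-inj i {l} {m} e with l Fin.≟ m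
  ... | yes h = h
  ... | no h = contradiction (cong proj₁ e) (tr i h)

  lin : ∀ i i' {l m l' m'} → l ≢ m → blk i l ≡ blk i' l' → blk i m ≡ blk i' m' → i ≡ i'
  lin (inj₁ (c , d)) (inj₁ (c' , d')) h e e' = cong inj₁ (lin₁ c d c' d' h e e')
  lin (inj₁ (c , d)) (inj₂ (inj₁ (i , j))) h e e' = ⊥-elim (not₁₂ c d i j h e e')
  lin (inj₁ (c , d)) (inj₂ (inj₂ j)) h e e' = ⊥-elim (not₁₃ c d j h e e')
  lin i@(inj₂ (inj₁ (x , j))) (inj₁ (c , d)) {l} {m} {l'} {m'} h e e' = ⊥-elim (not₁₂ c d x j (λ { refl → h (blk-inj i (trans e (sym e'))) }) (sym e) (sym e'))
  lin i@(inj₂ (inj₂ j)) (inj₁ (c , d)) {l} {m} {l'} {m'} h e e' = ⊥-elim (not₁₃ c d j (λ { refl → h (blk-inj i (trans e (sym e'))) }) (sym e) (sym e'))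
  lin (inj₂ (inj₁ (i , j))) (inj₂ (inj₁ (i' , j'))) h e e' = cong₂ (λ x y → inj₂ (inj₁ (x , y))) (cong proj₂ e) (D.linear h (inj₁-injective (cong proj₁ e)) (inj₁-injective (cong proj₁ e')))
  lin (inj₂ (inj₁ _)) (inj₂ (inj₂ _)) h () e'
  lin (inj₂ (inj₂ _)) (inj₂ (inj₁ _)) h () e'
  lin (inj₂ (inj₂ j)) (inj₂ (inj₂ j')) h e e' = cong (inj₂ ∘ inj₂) (E.linear h (cong₂ _,_ (inj₂-injective (cong proj₁ e)) (cong proj₂ e)) (cong₂ _,_ (inj₂-injective (cong proj₁ e')) (cong proj₂ e')))

  one-more : Design w (P × Fin k) Fibre Ix
  one-more = record { blk = blk ; transversal = tr ; linear = λ {i} {i'} → lin i i' }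

-- The equation for c says that D has as many blocks as a Steiner system S(2, k + 1, p) with p = a *
-- k + 1. This is what makes the count exact.
GDD-oneMore : ∀ {k a c} → Prime (suc (a * k)) → k ≤ suc (a * k) → Design (suc k) (Fin (suc (a * k))) _≡_ (Fin c) → suc k * c ≡ a * suc (a * k) → GDD k a 0 → GDD k (suc (suc k * a)) 0
GDD-oneMore {k} {a} {c} pp k<p D hc (gdd b E hb) = GDD-from (suc (a * k) * (a * k) + (k * c + b)) (λ x → Fin.cast N≡ (Fin.join (suc (a * k)) a x)) inj
  (OneMore.one-more pp k<p D E) (Sized-⊎ (Sized-× Sized-Fin Sized-Fin) (Sized-⊎ (Sized-× Sized-Fin Sized-Fin) Sized-Fin))
  (+-cancelʳ-≤ (k * a + k * (a * suc (a * k))) _ _ (begin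
    k * (suc (suc k * a) * suc (suc k * a)) + (k * a + k * (a * suc (a * k))) ≡⟨ l1 k a ⟩
    k * (a * a) + (suc k * (suc (a * k) * (a * k)) + k * (a * suc (a * k)) + k * (a * suc (a * k)) + k * suc (suc k * a)) ≤⟨ +-monoˡ-≤ _ hb ⟩
    suc k * b + 0 + k * a + (suc k * (suc (a * k) * (a * k)) + k * (a * suc (a * k)) + k * (a * suc (a * k)) + k * suc (suc k * a))
      ≡⟨ cong (λ z → suc k * b + 0 + k * a + (suc k * (suc (a * k) * (a * k)) + k * z + k * (a * suc (a * k)) + k * suc (suc k * a))) (sym hc) ⟩
    suc k * b + 0 + k * a + (suc k * (suc (a * k) * (a * k)) + k * (suc k * c) + k * (a * suc (a * k)) + k * suc (suc k * a)) ≡⟨ l2 k a b c ⟩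
    suc k * (suc (a * k) * (a * k) + (k * c + b)) + 0 + k * suc (suc k * a) + (k * a + k * (a * suc (a * k))) ∎))
  where
  open ≤-Reasoning
  N≡ : suc (a * k) + a ≡ suc (suc k * a)
  N≡ = cong suc (trans (+-comm (a * k) a) (cong (λ z → a + z) (*-comm a k)))
  inj : ∀ {x y} → Fin.cast N≡ (Fin.join (suc (a * k)) a x) ≡ Fin.cast N≡ (Fin.join (suc (a * k)) a y) → x ≡ y
  inj {x} {y} e = join-injective (Fin.toℕ-injective (trans (sym (Fin.toℕ-cast N≡ (Fin.join (suc (a * k)) a x))) (trans (cong toℕ e) (Fin.toℕ-cast N≡ (Fin.join (suc (a * k)) a y)))))
  l1 : ∀ k a → k * (suc (suc k * a) * suc (suc k * a)) + (k * a + k * (a * suc (a * k))) ≡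
    k * (a * a) + (suc k * (suc (a * k) * (a * k)) + k * (a * suc (a * k)) + k * (a * suc (a * k)) + k * suc (suc k * a))
  l1 = ℕ-Ring.solve-∀
  l2 : ∀ k a b c → suc k * b + 0 + k * a + (suc k * (suc (a * k) * (a * k)) + k * (suc k * c) + k * (a * suc (a * k)) + k * suc (suc k * a)) ≡
    suc k * (suc (a * k) * (a * k) + (k * c + b)) + 0 + k * suc (suc k * a) + (k * a + k * (a * suc (a * k)))
  l2 = ℕ-Ring.solve-∀

-- Transversal designs of highly divisible order

window : (ℕ → ℤ) → ℕ → ℕ → ℤ
window f zero z = ℤ.0ℤ
window f (suc d) z = f z ℤ.+ window f d (suc z)

window-cong : ∀ {f g : ℕ → ℤ} d z → (∀ l → l < d → f (z + l) ≡ g (z + l)) → window f d z ≡ window g d z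
window-cong zero z h = refl
window-cong {f} {g} (suc d) z h = cong₂ ℤ._+_ (subst (λ x → f x ≡ g x) (+-identityʳ z) (h 0 (s≤s z≤n)))
  (window-cong d (suc z) (λ l l<d → subst (λ x → f x ≡ g x) (+-suc z l) (h (suc l) (s≤s l<d))))

window-+ : ∀ f d e z → window f (d + e) z ≡ window f d z ℤ.+ window f e (z + d)
window-+ f zero e z = trans (cong (window f e) (sym (+-identityʳ z))) (sym (ℤ.+-identityˡ _))
window-+ f (suc d) e z = trans (cong (λ ω → f z ℤ.+ ω) (trans (window-+ f d e (suc z)) (cong (λ y → window f d (suc z) ℤ.+ window f e y) (sym (+-suc z d))))) (sym (ℤ.+-assoc (f z) _ _))

window-snoc : ∀ f d z → window f (suc d) z ≡ window f d z ℤ.+ f (z + d)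
window-snoc f d z = trans (cong (λ x → window f x z) (sym (+-comm d 1))) (trans (window-+ f d 1 z) (cong (λ ω → window f d z ℤ.+ ω) (ℤ.+-identityʳ _)))

window-add : ∀ f g d z → window (λ x → f x ℤ.+ g x) d z ≡ window f d z ℤ.+ window g d z
window-add f g zero z = refl
window-add f g (suc d) z = trans (cong (λ ω → f z ℤ.+ g z ℤ.+ ω) (window-add f g d (suc z))) (lem (f z) (g z) _ _)
  where
  lem : ∀ a b c d → a ℤ.+ b ℤ.+ (c ℤ.+ d) ≡ a ℤ.+ c ℤ.+ (b ℤ.+ d)
  lem = ℤ-Ring.solve-∀

window-neg : ∀ f d z → window (λ x → ℤ.- f x) d z ≡ ℤ.- window f d z
window-neg f zero z = refl
window-neg f (suc d) z = trans (cong (λ ω → ℤ.- f z ℤ.+ ω) (window-neg f d (suc z))) (sym (ℤ.neg-distrib-+ (f z) _))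

window-sub : ∀ f g d z → window (λ x → f x ℤ.- g x) d z ≡ window f d z ℤ.- window g d z
window-sub f g d z = trans (window-add f (λ x → ℤ.- g x) d z) (cong (λ ω → window f d z ℤ.+ ω) (window-neg g d z))

window-suc : ∀ f d z → window (f ∘ suc) d z ≡ window f d (suc z)
window-suc f zero z = refl
window-suc f (suc d) z = cong (λ ω → f (suc z) ℤ.+ ω) (window-suc f d (suc z))

window-swap : ∀ f d e z → window (window f d) e z ≡ window (window f e) d z
window-swap f zero e z = zeros e z
  where
  zeros : ∀ e z → window (λ _ → ℤ.0ℤ) e z ≡ ℤ.0ℤ
  zeros zero z = refl
  zeros (suc e) z = trans (ℤ.+-identityˡ _) (zeros e (suc z))
window-swap f (suc d) e z = trans (window-add f (λ x → window f d (suc x)) e z)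
  (cong (λ ω → window f e z ℤ.+ ω) (trans (window-suc (window f d) e z) (window-swap f d e (suc z))))

window-zero : ∀ {f : ℕ → ℤ} → (∀ z → f z ≡ ℤ.0ℤ) → ∀ d z → window f d z ≡ ℤ.0ℤ
window-zero h zero z = refl
window-zero h (suc d) z = trans (cong₂ ℤ._+_ (h z) (window-zero h d (suc z))) refl

window-shift : ∀ f s d z → window f d (z + s) ≡ window (λ x → f (x + s)) d z
window-shift f s zero z = refl
window-shift f s (suc d) z = cong (λ ω → f (z + s) ℤ.+ ω) (window-shift f s d (suc z))

window-≈ : ∀ {μ f e} d z → (∀ l → l < d → f (z + l) ≈[ μ ] e) → window f d z ≈[ μ ] + d ℤ.* e
window-≈ {e = e} zero z h = ≈-reflexive (sym (ℤ.*-zeroˡ e))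
window-≈ {μ} {f} {e} (suc d) z h = ≈-trans (≈-+ {x = f z} {y = e} {u = window f d (suc z)} {v = + d ℤ.* e}
    (subst (λ x → f x ≈[ μ ] e) (+-identityʳ z) (h 0 (s≤s z≤n)))
    (window-≈ d (suc z) (λ l l<d → subst (λ x → f x ≈[ μ ] e) (+-suc z l) (h (suc l) (s≤s l<d)))))
  (≈-reflexive (trans (lem e (+ d)) (cong (ℤ._* e) (sym (ℤ.pos-+ 1 d)))))
  where
  lem : ∀ e d → e ℤ.+ d ℤ.* e ≡ (ℤ.1ℤ ℤ.+ d) ℤ.* e
  lem = ℤ-Ring.solve-∀

solve-first : ∀ {a b c d : ℤ} → a ℤ.+ b ≡ c ℤ.+ d → b ≡ c ℤ.+ (d ℤ.- a)
solve-first {a} {b} {c} {d} e = trans (l1 a b) (trans (cong (ℤ._- a) e) (l2 a c d))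
  where
  l1 : ∀ a b → b ≡ (a ℤ.+ b) ℤ.- a
  l1 = ℤ-Ring.solve-∀
  l2 : ∀ a c d → (c ℤ.+ d) ℤ.- a ≡ c ℤ.+ (d ℤ.- a)
  l2 = ℤ-Ring.solve-∀

record Balanced (n : ℕ) (f : ℕ → ℤ) : Set where
  field
    periodic : ∀ z → f (z + suc n) ≡ f z
    total    : window f (suc n) 0 ≡ ℤ.0ℤ

  periodic* : ∀ q z → f (z + q * suc n) ≡ f z
  periodic* zero z = cong f (+-identityʳ z)
  periodic* (suc q) z = trans (cong f (trans (cong (λ x → z + x) (+-comm (suc n) (q * suc n))) (sym (+-assoc z (q * suc n) (suc n))))) (trans (periodic (z + q * suc n)) (periodic* q z))

  total-at : ∀ z → window f (suc n) z ≡ ℤ.0ℤ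
  total-at zero = total
  total-at (suc z) = trans (solve-first {f z} {window f (suc n) (suc z)} {window f (suc n) z} {f (z + suc n)} (window-snoc f (suc n) z))
    (trans (cong₂ (λ x y → x ℤ.+ (y ℤ.- f z)) (total-at z) (periodic z)) (trans (ℤ.+-identityˡ _) (ℤ.+-inverseʳ (f z))))

Balanced-sub : ∀ {n f g} → Balanced n f → Balanced n g → Balanced n (λ z → f z ℤ.- g z)
Balanced-sub {n} {f} {g} F G = record
  { periodic = λ z → cong₂ ℤ._-_ (Balanced.periodic F z) (Balanced.periodic G z)
  ; total = trans (window-sub f g (suc n) 0) (cong₂ ℤ._-_ (Balanced.total F) (Balanced.total G)) }

-- A balanced sequence whose windows of length d vanish has period d, hence period n, hence (having period n + 1) is constant;
-- the constant is killed by d and by n + 1.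
module Collapse {n μ : ℕ} {δ : ℕ → ℤ} (B : Balanced n δ) (i d c : ℕ) (n≡ : n ≡ c * d)
  (vanish : ∀ y → y < n → window δ d (i + y) ≈[ μ ] ℤ.0ℤ) where
  open Balanced B
  P = suc n
  g = window δ d

  -- Only n consecutive windows are known to vanish. The n + 1 windows of a full period sum to 0,
  -- because δ sums to 0 over every period, and this supplies the last one.
  g-last : g (i + n) ≈[ μ ] ℤ.0ℤ
  g-last = ≈-trans (≈-reflexive eq) (≈-trans (≈-neg (window-≈ {f = g} n i vanish)) (≈-reflexive (trans (cong ℤ.-_ (ℤ.*-zeroʳ (+ n))) refl)))
    where
    total0 : window g P i ≡ ℤ.0ℤ
    total0 = trans (window-swap δ d P i) (window-zero total-at d i)
    eq : g (i + n) ≡ ℤ.- window g n i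
    eq = trans (lem (window g n i) (g (i + n))) (trans (cong (ℤ._- window g n i) (trans (sym (window-snoc g n i)) total0)) (ℤ.+-identityˡ _))
      where
      lem : ∀ a b → b ≡ (a ℤ.+ b) ℤ.- a
      lem = ℤ-Ring.solve-∀

  g-period : ∀ r → r < P → g (i + r) ≈[ μ ] ℤ.0ℤ
  g-period r r<P with m<1+n⇒m<n∨m≡n r<P
  ... | inj₁ r<n = vanish r r<n
  ... | inj₂ refl = g-last

  g-periodic* : ∀ q z → g (z + q * P) ≡ g z
  g-periodic* q z = trans (window-shift δ (q * P) d z) (window-cong d z (λ l _ → periodic* q (z + l)))

  g≈0 : ∀ t → g (i + t) ≈[ μ ] ℤ.0ℤ
  g≈0 t = ≈-trans (≈-reflexive (trans (cong g (trans (cong (λ x → i + x) (m≡m%n+[m/n]*n t P)) (sym (+-assoc i (t % P) (t / P * P))))) (g-periodic* (t / P) (i + t % P))))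
    (g-period (t % P) (m%n<n t P))

  step : ∀ t → δ (i + t + d) ≈[ μ ] δ (i + t)
  step t = ≈-comb₂ ℤ.1ℤ (ℤ.- ℤ.1ℤ) (subst (λ x → g x ≈[ μ ] ℤ.0ℤ) (+-suc i t) (g≈0 (suc t))) (g≈0 t)
    (trans (lem (g (i + t)) (δ (i + t + d)) (δ (i + t)) (g (suc (i + t))) (sym (window-snoc δ d (i + t)))) refl)
    where
    alg : ∀ a c e → (c ℤ.+ e) ℤ.- a ≡ c ℤ.+ ℤ.1ℤ ℤ.* (e ℤ.- ℤ.0ℤ) ℤ.+ ℤ.- ℤ.1ℤ ℤ.* (a ℤ.- ℤ.0ℤ)
    alg = ℤ-Ring.solve-∀
    l1 : ∀ a b → b ≡ (a ℤ.+ b) ℤ.- a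
    l1 = ℤ-Ring.solve-∀
    lem : ∀ a b c e → a ℤ.+ b ≡ c ℤ.+ e → b ≡ c ℤ.+ ℤ.1ℤ ℤ.* (e ℤ.- ℤ.0ℤ) ℤ.+ ℤ.- ℤ.1ℤ ℤ.* (a ℤ.- ℤ.0ℤ)
    lem a b c e eq = trans (l1 a b) (trans (cong (ℤ._- a) eq) (alg a c e))

  steps : ∀ m t → δ (i + t + m * d) ≈[ μ ] δ (i + t)
  steps zero t = ≈-reflexive (cong δ (+-identityʳ (i + t)))
  steps (suc m) t = ≈-trans (≈-reflexive (cong δ (lem i t d (m * d)))) (≈-trans (steps m (t + d)) (≈-trans (≈-reflexive (cong δ (sym (+-assoc i t d)))) (step t)))
    where
    lem : ∀ i t d x → i + t + (d + x) ≡ i + (t + d) + x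
    lem = ℕ-Ring.solve-∀

  next : ∀ t → δ (i + suc t) ≈[ μ ] δ (i + t)
  next t = ≈-sym (≈-trans (≈-reflexive (trans (sym (periodic (i + t))) (cong δ (lem i t n)))) (≈-trans (≈-reflexive (cong (λ x → δ (i + suc t + x)) n≡)) (steps c (suc t))))
    where
    lem : ∀ i t n → i + t + suc n ≡ i + suc t + n
    lem = ℕ-Ring.solve-∀

  const : ∀ t → δ (i + t) ≈[ μ ] δ i
  const zero = ≈-reflexive (cong δ (+-identityʳ i))
  const (suc t) = ≈-trans (next t) (const t)

  de≈0 : + d ℤ.* δ i ≈[ μ ] ℤ.0ℤ
  de≈0 = ≈-trans (≈-sym (window-≈ {f = δ} d i (λ l _ → const l))) (≈-trans (≈-reflexive (cong g (sym (+-identityʳ i)))) (g≈0 0))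

  e≈0 : δ i ≈[ μ ] ℤ.0ℤ
  e≈0 = ≈-comb₂ ℤ.1ℤ (ℤ.- (+ c)) (≈-trans (≈-sym (window-≈ {f = δ} P i (λ l _ → const l))) (≈-reflexive (total-at i))) de≈0
    (trans (lem (δ i) (+ c) (+ d)) (cong (λ x → ℤ.0ℤ ℤ.+ ℤ.1ℤ ℤ.* (x ℤ.* δ i ℤ.- ℤ.0ℤ) ℤ.+ ℤ.- (+ c) ℤ.* (+ d ℤ.* δ i ℤ.- ℤ.0ℤ))
      (sym (trans (cong (λ x → + suc x) n≡) (trans (ℤ.pos-+ 1 (c * d)) (cong (λ ω → ℤ.1ℤ ℤ.+ ω) (ℤ.pos-* c d)))))))
    where
    lem : ∀ e c d → e ≡ ℤ.0ℤ ℤ.+ ℤ.1ℤ ℤ.* ((ℤ.1ℤ ℤ.+ c ℤ.* d) ℤ.* e ℤ.- ℤ.0ℤ) ℤ.+ ℤ.- c ℤ.* (d ℤ.* e ℤ.- ℤ.0ℤ)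
    lem = ℤ-Ring.solve-∀

  δ≈0 : ∀ y → δ y ≈[ μ ] ℤ.0ℤ
  δ≈0 y = ≈-trans (≈-reflexive (trans (sym (periodic* i y)) (cong δ (lem y i n)))) (≈-trans (const (y + i * n)) e≈0)
    where
    lem : ∀ y i n → y + i * suc n ≡ i + (y + i * n)
    lem = ℕ-Ring.solve-∀

funToFin-cong : ∀ {m n} {f g : Fin m → Fin n} → (∀ i → f i ≡ g i) → Fin.funToFin f ≡ Fin.funToFin g
funToFin-cong {zero} h = refl
funToFin-cong {suc m} h = cong₂ Fin.combine (h zero) (funToFin-cong (h ∘ suc))

-- Words of length n over ℤ/μ, extended by their negated digit sum to sequences of period n + 1.
module Digits (n μ : ℕ) .{{_ : NonZero μ}} where
  P = suc n

  digitAt : Fin (μ ^ n) → ∀ {j} → Dec (j < n) → ℤ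
  digitAt a (yes j<n) = ι (Fin.finToFun {μ} {n} a (fromℕ< j<n))
  digitAt a (no _) = ℤ.0ℤ

  digit : Fin (μ ^ n) → ℕ → ℤ
  digit a j = digitAt a (j <? n)

  baseAt : Fin (μ ^ n) → ∀ j → Dec (j < n) → ℤ
  baseAt a j (yes _) = digit a j
  baseAt a j (no _) = ℤ.- window (digit a) n 0

  base : Fin (μ ^ n) → ℕ → ℤ
  base a j = baseAt a j (j <? n)

  ext : Fin (μ ^ n) → ℕ → ℤ
  ext a j = base a (j % P)

  base-< : ∀ a j → j < n → base a j ≡ digit a j
  base-< a j h = go (j <? n)
    where
    go : ∀ d → baseAt a j d ≡ digit a j
    go (yes _) = refl
    go (no ¬h) = contradiction h ¬h

  base-n : ∀ a → base a n ≡ ℤ.- window (digit a) n 0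
  base-n a = go (n <? n)
    where
    go : ∀ d → baseAt a n d ≡ ℤ.- window (digit a) n 0
    go (yes h) = contradiction h (<-irrefl refl)
    go (no _) = refl

  ext-< : ∀ a j → j < n → ext a j ≡ digit a j
  ext-< a j h = trans (cong (base a) (m<n⇒m%n≡m (m<n⇒m<1+n h))) (base-< a j h)

  ext-digit : ∀ a (y : Fin n) → ext a (toℕ y) ≡ ι (Fin.finToFun {μ} {n} a y)
  ext-digit a y = trans (ext-< a (toℕ y) (Fin.toℕ<n y)) (go (toℕ y <? n))
    where
    go : ∀ d → digitAt a d ≡ ι (Fin.finToFun {μ} {n} a y)
    go (yes h) = cong (λ z → ι (Fin.finToFun {μ} {n} a z)) (Fin.fromℕ<-toℕ y h)
    go (no ¬h) = contradiction (Fin.toℕ<n y) ¬h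

  balanced : ∀ a → Balanced n (ext a)
  balanced a = record { periodic = λ z → cong (base a) ([m+n]%n≡m%n z P)
    ; total = trans (window-snoc (ext a) n 0) (trans (cong₂ ℤ._+_ (window-cong n 0 (λ l l<n → ext-< a l l<n)) (trans (cong (base a) (m<n⇒m%n≡m (n<1+n n))) (base-n a))) (ℤ.+-inverseʳ (window (digit a) n 0))) }

  -- With T the cyclic shift on sequences of period n + 1 and sum 0, level i of the block is (1 + T
  -- + ... + T ^ (i - 1)) a + b. Levels i and i + d differ by T ^ i (1 + ... + T ^ (d - 1)) a, and
  -- `Collapse` shows that this determines a when d divides n.
  row : Fin (μ ^ n) → Fin (μ ^ n) → ℕ → Fin (μ ^ n)
  row a b i = Fin.funToFin {n} {μ} (λ y → red μ (window (ext a) i (toℕ y) ℤ.+ ext b (toℕ y)))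

  row-eq : ∀ a b a' b' i → row a b i ≡ row a' b' i → ∀ y → y < n →
    window (ext a) i y ℤ.+ ext b y ≈[ μ ] window (ext a') i y ℤ.+ ext b' y
  row-eq a b a' b' i e y y<n = subst (λ z → window (ext a) i z ℤ.+ ext b z ≈[ μ ] window (ext a') i z ℤ.+ ext b' z) (Fin.toℕ-fromℕ< y<n)
    (red-injective (trans (sym (Fin.finToFun-funToFin f (fromℕ< y<n))) (trans (cong (λ z → Fin.finToFun {μ} {n} z (fromℕ< y<n)) e) (Fin.finToFun-funToFin f' (fromℕ< y<n)))))
    where
    f f' : Fin n → Fin μ
    f y = red μ (window (ext a) i (toℕ y) ℤ.+ ext b (toℕ y))
    f' y = red μ (window (ext a') i (toℕ y) ℤ.+ ext b' (toℕ y))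

  ext-injective : ∀ a a' → (∀ y → y < n → ext a y ≈[ μ ] ext a' y) → a ≡ a'
  ext-injective a a' h = trans (sym (Fin.funToFin-finToFin {n} {μ} a)) (trans (funToFin-cong digits) (Fin.funToFin-finToFin {n} {μ} a'))
    where
    digits : ∀ y → Fin.finToFun {μ} {n} a y ≡ Fin.finToFun {μ} {n} a' y
    digits y = ι-injective (≈-trans (≈-reflexive (sym (ext-digit a y))) (≈-trans (h (toℕ y) (Fin.toℕ<n y)) (≈-reflexive (ext-digit a' y))))

  lin< : ∀ a b a' b' i d → (∃ λ c → n ≡ c * d) → row a b i ≡ row a' b' i → row a b (i + d) ≡ row a' b' (i + d) → a ≡ a' × b ≡ b'
  lin< a b a' b' i d (c , n≡) e e' = finish (ext-injective a a' (λ y _ → -≈0⇒≈ (C.δ≈0 y)))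
    where
    δ : ℕ → ℤ
    δ z = ext a z ℤ.- ext a' z
    vanish : ∀ y → y < n → window δ d (i + y) ≈[ μ ] ℤ.0ℤ
    vanish y y<n = ≈-comb₂ (ℤ.- ℤ.1ℤ) ℤ.1ℤ (row-eq a b a' b' i e y y<n) (row-eq a b a' b' (i + d) e' y y<n)
      (trans (cong (window δ d) (+-comm i y)) (trans (window-sub (ext a) (ext a') d (y + i))
        (trans (lem (window (ext a) i y) (window (ext a') i y) (window (ext a) d (y + i)) (window (ext a') d (y + i)) (ext b y) (ext b' y))
          (sym (cong₂ (λ u v → ℤ.0ℤ ℤ.+ ℤ.- ℤ.1ℤ ℤ.* ((window (ext a) i y ℤ.+ ext b y) ℤ.- (window (ext a') i y ℤ.+ ext b' y)) ℤ.+ ℤ.1ℤ ℤ.* ((u ℤ.+ ext b y) ℤ.- (v ℤ.+ ext b' y)))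
            (window-+ (ext a) i d y) (window-+ (ext a') i d y))))))
      where
      lem : ∀ u u' v v' b b' → v ℤ.- v' ≡ ℤ.0ℤ ℤ.+ ℤ.- ℤ.1ℤ ℤ.* ((u ℤ.+ b) ℤ.- (u' ℤ.+ b')) ℤ.+ ℤ.1ℤ ℤ.* (((u ℤ.+ v) ℤ.+ b) ℤ.- ((u' ℤ.+ v') ℤ.+ b'))
      lem = ℤ-Ring.solve-∀
    module C = Collapse {n} {μ} {δ} (Balanced-sub (balanced a) (balanced a')) i d c n≡ vanish
    finish : a ≡ a' → a ≡ a' × b ≡ b'
    finish refl = refl , ext-injective b b' (λ y y<n → ≈-comb₁ ℤ.1ℤ (row-eq a b a b' i e y y<n) (lem (window (ext a) i y) (ext b y) (ext b' y)))
      where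
      lem : ∀ x b b' → b ≡ b' ℤ.+ ℤ.1ℤ ℤ.* ((x ℤ.+ b) ℤ.- (x ℤ.+ b'))
      lem = ℤ-Ring.solve-∀

-- All differences of levels are below w and hence divide the word length w !. In contrast to
-- `CyclicTD` the order may share small prime factors with w !.
TD-power : ∀ w μ .{{_ : NonZero μ}} → TD w (μ ^ (w !))
TD-power w μ = record { row = λ a b i → row a b (toℕ i) ; lin = lin }
  where
  open Digits (w !) μ using (row)
  divisor : ∀ {i j} → i < j → j < w → ∃ λ c → w ! ≡ c * (j ∸ i)
  divisor {i} {j} i<j j<w with ∣-trans (m∣m! (j ∸ i) (m<n⇒0<n∸m i<j)) (m≤n⇒m!∣n! (≤-trans (m∸n≤m j i) (<⇒≤ j<w)))
    where
    m∣m! : ∀ m → 0 < m → m ∣ m !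
    m∣m! (suc m) _ = m∣m*n (m !)
  ... | divides c eq = c , eq
  lin< : ∀ {a b a' b' i j} → i < j → j < w → row a b i ≡ row a' b' i → row a b j ≡ row a' b' j → a ≡ a' × b ≡ b'
  lin< {a} {b} {a'} {b'} {i} {j} i<j j<w e e' = Digits.lin< (w !) μ a b a' b' i (j ∸ i) (divisor i<j j<w) e
    (subst (λ z → row a b z ≡ row a' b' z) (sym (m+[n∸m]≡n (<⇒≤ i<j))) e')
  lin : ∀ {a b a' b'} {i j : Fin w} → i ≢ j → row a b (toℕ i) ≡ row a' b' (toℕ i) → row a b (toℕ j) ≡ row a' b' (toℕ j) → a ≡ a' × b ≡ b'
  lin {a} {b} {a'} {b'} {i} {j} h e e' with <-cmp (toℕ i) (toℕ j)
  ... | tri< l _ _ = lin< l (Fin.toℕ<n j) e e'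
  ... | tri≈ _ eq _ = contradiction (Fin.toℕ-injective eq) h
  ... | tri> _ _ l = lin< l (Fin.toℕ<n i) e' e

TD-from : ∀ {w q} {Y R : Set} (val : R → Fin w → Y) (g : Y → Fin q) → (∀ {x y} → g x ≡ g y → x ≡ y) →
  (∀ r r' {i j} → i ≢ j → val r i ≡ val r' i → val r j ≡ val r' j → r ≡ r') → Sized R (q * q) → TD w q
TD-from {q = q} val g g-inj lin (sized pick pick-inj) = record
  { row = λ a b i → g (val (pick (Fin.combine a b)) i)
  ; lin = λ {a} {b} {a'} {b'} h e e' → Fin.combine-injective a b a' b' (pick-inj (lin _ _ h (g-inj e) (g-inj e'))) }

-- Wilson's construction: each level consists of t * m old points and s new ones. A block of T off
-- the s kept points of its last group is inflated by `Tm`. A block through the kept point c is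
-- inflated by `Tm⁺`, with symbol zero read as the new point c and with the all-zero block left out;
-- `Ts` joins the new points of different levels.
module Wilson {w t m s : ℕ} (T : TD⁺ w t) (s≤t : s ≤ t) (Tm : TD w m) (Tm⁺ : TD w (suc m)) (Ts : TD w s)
  (zero-row : ∀ i → TD.row Tm⁺ zero zero i ≡ zero) where
  open Truncated T s≤t using (C; class; class-inj)
  open TD⁺ T using (row; last) renaming (lin to lin-t)
  module Tm = TD Tm
  module Tm⁺ = TD Tm⁺
  module Ts = TD Ts
  Y = (Fin t × Fin m) ⊎ Fin s
  NZ = (Fin m × Fin (suc m)) ⊎ Fin m
  R = ((Fin t × Fin (t ∸ s)) × (Fin m × Fin m)) ⊎ (((Fin t × Fin s) × NZ) ⊎ (Fin s × Fin s))

  fst⁺ snd⁺ : NZ → Fin (suc m)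
  fst⁺ (inj₁ (a , b)) = suc a
  fst⁺ (inj₂ b) = zero
  snd⁺ (inj₁ (a , b)) = b
  snd⁺ (inj₂ b) = suc b

  nz-inj : ∀ x y → fst⁺ x ≡ fst⁺ y → snd⁺ x ≡ snd⁺ y → x ≡ y
  nz-inj (inj₁ _) (inj₁ _) refl refl = refl
  nz-inj (inj₂ _) (inj₂ _) _ refl = refl

  nz-not-zero : ∀ x → fst⁺ x ≡ zero → snd⁺ x ≢ zero
  nz-not-zero (inj₁ _) ()
  nz-not-zero (inj₂ _) _ ()

  row⁺ : NZ → Fin w → Fin (suc m)
  row⁺ x i = Tm⁺.row (fst⁺ x) (snd⁺ x) i

  -- Any two zeros lie on the all-zero block, which `NZ` omits. Hence no inflated block joins two
  -- new points, and those pairs remain free for `Ts`.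
  two-zeros : ∀ x {i j} → i ≢ j → row⁺ x i ≡ zero → row⁺ x j ≢ zero
  two-zeros x {i} {j} h e e' = let (p , q) = Tm⁺.lin h (trans e (sym (zero-row i))) (trans e' (sym (zero-row j))) in nz-not-zero x p q

  hit : Fin t → Fin s → Fin w → Fin (suc m) → Y
  hit a c i zero = inj₂ c
  hit a c i (suc y) = inj₁ (row a (class (inj₂ c)) i , y)

  val : R → Fin w → Y
  val (inj₁ ((a , c) , (x , y))) i = inj₁ (row a (class (inj₁ c)) i , Tm.row x y i)
  val (inj₂ (inj₁ ((a , c) , x))) i = hit a c i (row⁺ x i)
  val (inj₂ (inj₂ (x , y))) i = inj₂ (Ts.row x y i)

  hit-inj : ∀ a c i v v' → hit a c i v ≡ hit a c i v' → v ≡ v'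
  hit-inj a c i zero zero e = refl
  hit-inj a c i (suc y) (suc y') e = cong suc (cong proj₂ (inj₁-injective e))

  hit-line : ∀ a c a' c' i j v u v' u' → i ≢ j → (v ≡ zero → u ≢ zero) → hit a c i v ≡ hit a' c' i v' → hit a c j u ≡ hit a' c' j u' → a ≡ a' × c ≡ c'
  hit-line a c a' c' i j zero zero v' u' h nz e e' = contradiction refl (nz refl)
  hit-line a c a' c' i j zero (suc _) zero (suc _) h nz refl e' = last (cong proj₁ (inj₁-injective e')) , refl
  hit-line a c a' c' i j (suc _) zero (suc _) zero h nz e refl = last (cong proj₁ (inj₁-injective e)) , refl
  hit-line a c a' c' i j (suc _) (suc _) (suc _) (suc _) h nz e e' =
    let (p , q) = lin-t h (cong proj₁ (inj₁-injective e)) (cong proj₁ (inj₁-injective e')) in p , inj₂-injective (class-inj {inj₂ c} {inj₂ c'} q)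

  miss-hit : ∀ a c a' c' i j y z v u → i ≢ j → inj₁ (row a (class (inj₁ c)) i , y) ≡ hit a' c' i v → inj₁ (row a (class (inj₁ c)) j , z) ≡ hit a' c' j u → ⊥
  miss-hit a c a' c' i j y z (suc _) (suc _) h e e' with class-inj {inj₁ c} {inj₂ c'} (proj₂ (lin-t h (cong proj₁ (inj₁-injective e)) (cong proj₁ (inj₁-injective e'))))
  ... | ()

  hit-short : ∀ a c i j v u (x y : Fin s) → i ≢ j → (v ≡ zero → u ≢ zero) → hit a c i v ≡ inj₂ x → hit a c j u ≡ inj₂ y → ⊥
  hit-short a c i j zero zero x y h nz e e' = nz refl refl

  lin : ∀ r r' {i j} → i ≢ j → val r i ≡ val r' i → val r j ≡ val r' j → r ≡ r'
  lin (inj₁ ((a , c) , (x , y))) (inj₁ ((a' , c') , (x' , y'))) h e e' with lin-t h (cong proj₁ (inj₁-injective e)) (cong proj₁ (inj₁-injective e')) | Tm.lin h (cong proj₂ (inj₁-injective e)) (cong proj₂ (inj₁-injective e'))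
  ... | refl , q | refl , refl with class-inj {inj₁ c} {inj₁ c'} q
  ...   | refl = refl
  lin (inj₁ ((a , c) , (x , y))) (inj₂ (inj₁ ((a' , c') , x'))) {i} {j} h e e' = ⊥-elim (miss-hit a c a' c' i j _ _ (row⁺ x' i) (row⁺ x' j) h e e')
  lin (inj₁ _) (inj₂ (inj₂ _)) h () e'
  lin (inj₂ (inj₁ ((a' , c') , x'))) (inj₁ ((a , c) , (x , y))) {i} {j} h e e' = ⊥-elim (miss-hit a c a' c' i j _ _ (row⁺ x' i) (row⁺ x' j) h (sym e) (sym e'))
  lin (inj₂ (inj₁ ((a , c) , x))) (inj₂ (inj₁ ((a' , c') , x'))) {i} {j} h e e' = finish (hit-line a c a' c' i j (row⁺ x i) (row⁺ x j) (row⁺ x' i) (row⁺ x' j) h (two-zeros x h) e e') e e'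
    where
    finish : ∀ {a' c'} → a ≡ a' × c ≡ c' → hit a c i (row⁺ x i) ≡ hit a' c' i (row⁺ x' i) → hit a c j (row⁺ x j) ≡ hit a' c' j (row⁺ x' j) →
      _≡_ {A = R} (inj₂ (inj₁ ((a , c) , x))) (inj₂ (inj₁ ((a' , c') , x')))
    finish (refl , refl) r r' = let (p , q) = Tm⁺.lin h (hit-inj a c i (row⁺ x i) (row⁺ x' i) r) (hit-inj a c j (row⁺ x j) (row⁺ x' j) r') in
      cong (λ z → inj₂ (inj₁ ((a , c) , z))) (nz-inj x x' p q)
  lin (inj₂ (inj₁ ((a , c) , x))) (inj₂ (inj₂ (y , z))) {i} {j} h e e' = ⊥-elim (hit-short a c i j (row⁺ x i) (row⁺ x j) _ _ h (two-zeros x h) e e')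
  lin (inj₂ (inj₂ _)) (inj₁ _) h () e'
  lin (inj₂ (inj₂ (y , z))) (inj₂ (inj₁ ((a , c) , x))) {i} {j} h e e' = ⊥-elim (hit-short a c i j (row⁺ x i) (row⁺ x j) _ _ h (two-zeros x h) (sym e) (sym e'))
  lin (inj₂ (inj₂ (x , y))) (inj₂ (inj₂ (x' , y'))) h e e' = let (p , q) = Ts.lin h (inj₂-injective e) (inj₂-injective e') in cong₂ (λ u v → inj₂ (inj₂ (u , v))) p q

  pt : Y → Fin (t * m) ⊎ Fin s
  pt (inj₁ (x , y)) = inj₁ (Fin.combine x y)
  pt (inj₂ x) = inj₂ x

  pt-inj : ∀ x y → pt x ≡ pt y → x ≡ y
  pt-inj (inj₁ (i , y)) (inj₁ (i' , y')) e with Fin.combine-injective i y i' y' (inj₁-injective e)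
  ... | refl , refl = refl
  pt-inj (inj₂ x) (inj₂ y) e = cong inj₂ (inj₂-injective e)

  td : TD w (t * m + s)
  td = TD-from val (λ y → Fin.join (t * m) s (pt y)) (λ {x} {y} e → pt-inj x y (join-injective e)) lin
    (subst (Sized R) (count-rows (t ∸ s) (m+[n∸m]≡n s≤t))
      (Sized-⊎ (Sized-× (Sized-× Sized-Fin Sized-Fin) (Sized-× Sized-Fin Sized-Fin))
        (Sized-⊎ (Sized-× (Sized-× Sized-Fin Sized-Fin) (Sized-⊎ (Sized-× Sized-Fin Sized-Fin) Sized-Fin)) (Sized-× Sized-Fin Sized-Fin))))
    where
    count-rows : ∀ r → s + r ≡ t → t * r * (m * m) + (t * s * (m * suc m + m) + s * s) ≡ (t * m + s) * (t * m + s)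
    count-rows r refl = lem s r m
      where
      lem : ∀ s r m → (s + r) * r * (m * m) + ((s + r) * s * (m * suc m + m) + s * s) ≡ ((s + r) * m + s) * ((s + r) * m + s)
      lem = ℕ-Ring.solve-∀

1+multiple-rough : ∀ u q → u ! ∣ q → Rough u (suc q)
1+multiple-rough u q u!∣q d@(suc d') 0<d d≤u {x} (x∣q , x∣d) = ∣1⇒≡1 (∣m+n∣m⇒∣n (subst (x ∣_) (+-comm 1 q) x∣q) (∣-trans x∣d (∣-trans (m∣m*n (d' !)) (∣-trans (m≤n⇒m!∣n! d≤u) u!∣q))))

multiple-1-rough : ∀ u q → u ! ∣ suc q → Rough u q
multiple-1-rough u q u!∣q d@(suc d') 0<d d≤u {x} (x∣q , x∣d) = ∣1⇒≡1 (∣m+n∣m⇒∣n (subst (x ∣_) (+-comm 1 q) (∣-trans x∣d (∣-trans (m∣m*n (d' !)) (∣-trans (m≤n⇒m!∣n! d≤u) u!∣q)))) x∣q)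

-- m t + m = m (t + 1) where m is divisible by w !, so that Wilson's construction applies with t and m + 1 both prime to w !.
TD-multiple : ∀ w K → (w !) ^ (w !) < K → w ! ∣ K → TD w ((w !) ^ (w !) * K)
TD-multiple w (suc t) (s≤s m≤t) w!∣K = subst (TD w) (trans (+-comm (t * m) m) (*-comm (suc t) m)) (Wilson.td T m≤t Tm Tm⁺ Tm zero-row)
  where
  m = (w !) ^ (w !)
  instance
    w!≢0 : NonZero (w !)
    w!≢0 = w !≢0
    t≢0 : NonZero t
    t≢0 = >-nonZero (≤-trans (m^n>0 (w !) (w !)) m≤t)
  Tm : TD w m
  Tm = TD-power w (w !)
  T : TD⁺ w t
  T = CyclicTD.td w t (multiple-1-rough w t w!∣K)
  w!∣m : w ! ∣ m
  w!∣m = d∣d^ (w !) (w !) (>-nonZero⁻¹ (w !))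
    where
    d∣d^ : ∀ d n → 0 < n → d ∣ d ^ n
    d∣d^ d (suc n) _ = m∣m*n (d ^ n)
  module C = CyclicTD w (suc m) (1+multiple-rough w m w!∣m)
  Tm⁺ : TD w (suc m)
  Tm⁺ = TD⁺⇒TD C.td
  zero-row : ∀ i → C.row zero zero i ≡ zero
  zero-row i = ι-injective (≈-trans (C.row-≈ zero zero i) (≈-reflexive (trans (cong₂ (λ x y → x ℤ.* C.lvl i ℤ.+ y) ι-zero ι-zero) (trans (cong (ℤ._+ ℤ.0ℤ) (ℤ.*-zeroˡ (C.lvl i))) (sym ι-zero)))))

-- Near-perfect group divisible designs

GDD-mono : ∀ {k N f g} → f ≤ g → GDD k N f → GDD k N g
GDD-mono {k} {N} f≤g (gdd b D h) = gdd b D (≤-trans h (+-monoˡ-≤ (k * N) (+-monoʳ-≤ (suc k * b) f≤g)))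

GDD-empty : ∀ k N f → k * (N * N) ≤ f + k * N → GDD k N f
GDD-empty k N f h = gdd 0 (record { blk = λ () ; transversal = λ () ; linear = λ { {()} } }) (≤-trans h (≤-reflexive (cong (λ z → z + f + k * N) (sym (*-zeroʳ (suc k))))))

∃GDD-pair : ∀ k → 1 ≤ k → ∀ K → 0 < K → ∃ λ a → 0 < a × K ∣ a × GDD k (suc k * a) 0 × GDD k (suc (suc k * a)) 0
∃GDD-pair k 1≤k K 0<K = build (∃Seed k 1≤k K' 0<K')
  where
  w = suc k
  m = (w !) ^ (w !)
  w!>0 : 0 < w !
  w!>0 = >-nonZero⁻¹ (w !) {{w !≢0}}
  m>0 : 0 < m
  m>0 = m^n>0 (w !) {{w !≢0}} (w !)
  -- With m * K₀ dividing τ, the order a * k is m times a multiple of w ! exceeding m, the form that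
  -- `TD-multiple` requires.
  K₀ = w ! * suc m * K
  K' = m * K₀
  0<K₀ : 0 < K₀
  0<K₀ = *-mono-≤ {1} {w ! * suc m} {1} {K} (*-mono-≤ {1} {w !} {1} {suc m} w!>0 (s≤s z≤n)) 0<K
  0<K' : 0 < K'
  0<K' = *-mono-≤ {1} {m} {1} {K₀} m>0 0<K₀
  build : (∃ λ τ → 0 < τ × K' ∣ τ × Seed k τ) → ∃ λ a → 0 < a × K ∣ a × GDD k (suc k * a) 0 × GDD k (suc (suc k * a)) 0
  build (τ , 0<τ , divides h τ≡ , S) = a , 0<a , K∣a , GDD-layers G td , GDD-oneMore p-prime k≤p (Design-reindex (Sized-× Sized-Fin Sized-Fin) planar) (lem-c τ k) G
    where
    open Seed S
    a = τ * w
    0<a : 0 < a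
    0<a = *-mono-≤ {1} {τ} {1} {w} 0<τ (s≤s z≤n)
    K∣a : K ∣ a
    K∣a = ∣m⇒∣m*n w (subst (K ∣_) (sym τ≡) (∣n⇒∣m*n h (∣n⇒∣m*n m (n∣m*n (w ! * suc m)))))
    k≤p : k ≤ suc (a * k)
    k≤p = ≤-trans (m≤n*m k a {{>-nonZero 0<a}}) (n≤1+n (a * k))
    lem-c : ∀ τ k → suc k * (τ * suc (τ * suc k * k)) ≡ τ * suc k * suc (τ * suc k * k)
    lem-c = ℕ-Ring.solve-∀
    G : GDD k a 0
    G = gdd (τ * (suc (τ * suc k * k) ∸ suc k)) (Design-reindex (Sized-× Sized-Fin Sized-Fin) derived) (bd a refl 0<a)
      where
      bd : ∀ a → τ * suc k ≡ a → 0 < a → k * (a * a) ≤ suc k * (τ * (suc (a * k) ∸ suc k)) + 0 + k * a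
      bd (suc a) τw≡ _ = ≤-reflexive (sym (begin
        suc k * (τ * (suc a * k ∸ k)) + 0 + k * suc a ≡⟨ cong (λ z → suc k * (τ * z) + 0 + k * suc a) (m+n∸m≡n k (a * k)) ⟩
        suc k * (τ * (a * k)) + 0 + k * suc a ≡⟨ l1 k τ (a * k) (k * suc a) ⟩
        τ * suc k * (a * k) + k * suc a ≡⟨ cong (λ z → z * (a * k) + k * suc a) τw≡ ⟩
        suc a * (a * k) + k * suc a ≡⟨ l2 a k ⟩
        k * (suc a * suc a) ∎))
        where
        open ≡-Reasoning
        l1 : ∀ k τ x y → suc k * (τ * x) + 0 + y ≡ τ * suc k * x + y
        l1 = ℕ-Ring.solve-∀
        l2 : ∀ a k → suc a * (a * k) + k * suc a ≡ k * (suc a * suc a)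
        l2 = ℕ-Ring.solve-∀
    0<h : 0 < h
    0<h = n≢0⇒n>0 (λ { refl → <-irrefl (sym τ≡) 0<τ })
    Kx = K₀ * (h * (w * k))
    td : TD (suc k) (a * k)
    td = subst (TD w) (sym (trans (cong (λ z → z * w * k) τ≡) (l3 h m K₀ w k)))
      (TD-multiple w Kx
        (≤-trans (≤-trans (m≤n*m (suc m) (w !) {{w !≢0}}) (m≤m*n (w ! * suc m) K {{>-nonZero 0<K}})) (m≤m*n K₀ (h * (w * k)) {{m*n≢0 h (w * k) {{>-nonZero 0<h}} {{m*n≢0 w k {{_}} {{>-nonZero 1≤k}}}}}}))
        (∣m⇒∣m*n (h * (w * k)) (∣m⇒∣m*n K (m∣m*n (suc m)))))
      where
      l3 : ∀ h m K₀ w k → h * (m * K₀) * w * k ≡ m * (K₀ * (h * (w * k)))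
      l3 = ℕ-Ring.solve-∀

cyclicTD⁺ : ∀ u q x → q ≡ suc x → u ! ∣ x → TD⁺ u q
cyclicTD⁺ u .(suc x) x refl d = CyclicTD.td u (suc x) (1+multiple-rough u x d)

module LinearBound {k u : ℕ} (Gu : GDD k u 0) (Gv : GDD k (suc u) 0) (2≤u : 2 ≤ u) where
  V = u !
  instance
    V≢0 : NonZero V
    V≢0 = u !≢0
    u≢0 : NonZero u
    u≢0 = >-nonZero (≤-trans (s≤s z≤n) 2≤u)
    uV≢0 : NonZero (u * V)
    uV≢0 = m*n≢0 u V
  -- From N₀ on, the quotient x below is at least u, so the long group size q = 1 + V * x exceeds
  -- every possible remainder t < u * V.
  N₀ = u + u * (u * V)
  C = k * N₀

  small : ∀ N n → N ≤ n → GDD k N (k * n * N)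
  small N n h = GDD-empty k N _ (≤-trans (≤-trans (*-monoʳ-≤ k (*-monoˡ-≤ N h)) (≤-reflexive (sym (*-assoc k n N)))) (m≤m+n _ (k * N)))

  -- Write N = u * q + t with q ≡ 1 modulo u ! and t bounded. Deficiencies add under truncation, so
  -- the bound C * q on each long group reproduces itself; the bounded short group is left without
  -- blocks, and C is chosen to pay for it.
  linear-bound : ∀ N → GDD k N (C * N)
  linear-bound = <-rec (λ N → GDD k N (C * N)) step
    where
    step : ∀ N → (∀ {M} → M < N → GDD k M (C * M)) → GDD k N (C * N)
    step N rec with N ≤? N₀
    ... | yes h = small N N₀ h
    ... | no ¬h = subst (λ z → GDD k z (C * z)) (sym N≡) (GDD-mono bd
        (GDD-truncated Gu Gv (cyclicTD⁺ u q (V * x) refl (m∣m*n x)) t≤q (rec q<N) (small t (u * V) (<⇒≤ t<))))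
      where
      N₀≤N : N₀ ≤ N
      N₀≤N = <⇒≤ (≰⇒> ¬h)
      D = N ∸ u
      x = D / (u * V)
      t = D % (u * V)
      t< : t < u * V
      t< = m%n<n D (u * V)
      q = suc (V * x)
      N≡ : N ≡ u * q + t
      N≡ = trans (sym (m+[n∸m]≡n (≤-trans (m≤m+n u _) N₀≤N))) (trans (cong (λ z → u + z) (m≡m%n+[m/n]*n D (u * V))) (lem u V x t))
        where
        lem : ∀ u V x t → u + (t + x * (u * V)) ≡ u * suc (V * x) + t
        lem = ℕ-Ring.solve-∀
      u≤x : u ≤ x
      u≤x = ≤-trans (≤-reflexive (sym (m*n/n≡m u (u * V)))) (/-monoˡ-≤ (u * V) (≤-trans (≤-reflexive (sym (m+n∸m≡n u (u * (u * V))))) (∸-monoˡ-≤ u N₀≤N)))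
      t≤q : t ≤ q
      t≤q = ≤-trans (<⇒≤ t<) (≤-trans (≤-reflexive (*-comm u V)) (≤-trans (*-monoʳ-≤ V u≤x) (n≤1+n (V * x))))
      q<N : q < N
      q<N = ≤-trans (≤-trans (≤-reflexive (+-comm 1 q)) (≤-trans (+-monoʳ-≤ q (s≤s z≤n)) (≤-trans (≤-reflexive (cong (λ z → q + z) (sym (+-identityʳ q)))) (*-monoˡ-≤ q 2≤u)))) (≤-trans (m≤m+n (u * q) t) (≤-reflexive (sym N≡)))
      bd : u * (C * q) + k * (u * V) * t ≤ C * (u * q + t)
      bd = ≤-trans (+-monoʳ-≤ (u * (C * q)) (*-monoˡ-≤ t (*-monoʳ-≤ k (≤-trans (m≤n*m (u * V) u) (m≤n+m (u * (u * V)) u))))) (≤-reflexive (lem u C q t))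
        where
        lem : ∀ u C q t → u * (C * q) + C * t ≡ C * (u * q + t)
        lem = ℕ-Ring.solve-∀

-- Bernoulli's inequality (1 + 1 / A) ^ n ≥ 1 + n / A, cleared of denominators.
bernoulli : ∀ A B n → A < B → A ^ n * (A + n) ≤ B ^ n * A
bernoulli A B zero A<B = ≤-reflexive (cong (λ z → z + 0) (+-identityʳ A))
bernoulli A B (suc n) A<B = begin
  A * A ^ n * (A + suc n) ≤⟨ m≤m+n _ (A ^ n * n) ⟩
  A * A ^ n * (A + suc n) + A ^ n * n ≡⟨ l1 A (A ^ n) n ⟩
  suc A * (A ^ n * (A + n)) ≤⟨ *-mono-≤ A<B (bernoulli A B n A<B) ⟩
  B * (B ^ n * A) ≡⟨ sym (*-assoc B (B ^ n) A) ⟩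
  B * B ^ n * A ∎
  where
  open ≤-Reasoning
  l1 : ∀ A x n → A * x * (A + suc n) + x * n ≡ suc A * (x * (A + n))
  l1 = ℕ-Ring.solve-∀

power-overtakes : ∀ A B n → 0 < A → A < B → A * A ≤ n → A ^ suc n ≤ B ^ n
power-overtakes A B n 0<A A<B h = *-cancelʳ-≤ (A ^ suc n) (B ^ n) A {{>-nonZero 0<A}} (≤-trans (≤-reflexive (l1 A (A ^ n))) (≤-trans (*-monoʳ-≤ (A ^ n) (≤-trans h (m≤n+m n A))) (bernoulli A B n A<B)))
  where
  l1 : ∀ A x → A * x * A ≡ x * (A * A)
  l1 = ℕ-Ring.solve-∀

crossing : ∀ (h : ℕ → ℕ) x n → h 0 ≤ x → x < h n → ∃ λ l → l < n × h l ≤ x × x < h (suc l)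
crossing h x zero h0 hn = contradiction h0 (<⇒≱ hn)
crossing h x (suc n) h0 hn with x <? h n
... | yes hx = let (l , l<n , rest) = crossing h x n h0 hx in l , m<n⇒m<1+n l<n , rest
... | no ¬hx = n , n<1+n n , ≮⇒≥ ¬hx , hn

n<2^n : ∀ n → n < 2 ^ n
n<2^n zero = s≤s z≤n
n<2^n (suc n) = ≤-trans (≤-trans (≤-reflexive (+-comm 1 (suc n))) (+-mono-≤ (n<2^n n) (≤-trans (s≤s z≤n) (n<2^n n)))) (≤-reflexive (cong (λ z → 2 ^ n + z) (sym (+-identityʳ _))))

-- The products A ^ (n - l) * B ^ l run from A ^ n past A ^ (n + 1) in steps of ratio B / A.
approximate : ∀ A B → 2 ≤ A → A < B → ∀ x → A ^ (A * A) ≤ x → ∃₂ λ i j → A ^ i * B ^ j ≤ x × A * x < B * (A ^ i * B ^ j)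
approximate A B 2≤A A<B x big with crossing (A ^_) x x (≤-trans (m^n>0 A {{A≢0}} (A * A)) big) (<-≤-trans (n<2^n x) (^-monoˡ-≤ x 2≤A))
  where
  A≢0 : NonZero A
  A≢0 = >-nonZero (≤-trans (s≤s z≤n) 2≤A)
-- The exponent n satisfies A ^ n ≤ x < A ^ (n + 1). As x ≥ A ^ (A * A), it is at least A * A, which
-- makes B ^ n ≥ A ^ (n + 1) > x.
... | n , _ , lo , hi = finish (crossing (λ l → A ^ (n ∸ l) * B ^ l) x n (≤-trans (≤-reflexive (*-identityʳ (A ^ n))) lo)
      (<-≤-trans hi (≤-trans (power-overtakes A B n 0<A A<B AA≤n) (≤-reflexive (sym (trans (cong (λ z → A ^ z * B ^ n) (n∸n≡0 n)) (*-identityˡ (B ^ n))))))))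
  where
  0<A : 0 < A
  0<A = ≤-trans (s≤s z≤n) 2≤A
  AA≤n : A * A ≤ n
  AA≤n = s≤s⁻¹ (≰⇒> (λ h → <⇒≱ hi (≤-trans (^-monoʳ-≤ A {{>-nonZero 0<A}} h) big)))
  finish : (∃ λ l → l < n × A ^ (n ∸ l) * B ^ l ≤ x × x < A ^ (n ∸ suc l) * B ^ suc l) → ∃₂ λ i j → A ^ i * B ^ j ≤ x × A * x < B * (A ^ i * B ^ j)
  finish (l , l<n , p , q) = n ∸ l , l , p , <-≤-trans (*-monoʳ-< A {{>-nonZero 0<A}} q) (≤-reflexive (trans (l1 A (A ^ (n ∸ suc l)) B (B ^ l)) (cong (λ z → B * (A ^ z * B ^ l)) (sym (+-∸-assoc 1 l<n)))))
    where
    l1 : ∀ A x B y → A * (x * (B * y)) ≡ B * (A * x * y)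
    l1 = ℕ-Ring.solve-∀

module Powers {k V : ℕ} (w!∣V : suc k ! ∣ V) where
  -- The residue 1 modulo V is preserved by products and makes N the order of a cyclic transversal
  -- design. The latter is needed both for the product construction and when N later serves as a
  -- long group.
  record Good (N : ℕ) : Set where
    constructor good
    field
      prev   : ℕ
      N≡     : N ≡ suc prev
      V∣prev : V ∣ prev
      G      : GDD k N 0

  Good-* : ∀ {N M} → Good N → Good M → Good (N * M)
  Good-* {N} {M} (good n refl V∣n G) (good m refl V∣m H) = good (m + n * suc m) refl (∣m∣n⇒∣m+n V∣m (∣m⇒∣m*n (suc m) V∣n))
    (GDD-product G H (TD⁺⇒TD (cyclicTD⁺ (suc k) (suc m) m refl (∣-trans w!∣V V∣m))))

  Good-1 : Good 1
  Good-1 = good 0 refl (V ∣0) (GDD-empty k 1 0 ≤-refl)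

  Good-^ : ∀ {N} → Good N → ∀ n → Good (N ^ n)
  Good-^ G zero = Good-1
  Good-^ G (suc n) = Good-* G (Good-^ G n)

near-perfect : ∀ k → 1 ≤ k → ∃ λ N₁ → ∀ N → N₁ ≤ N → ∃ λ f → GDD k N f × 4 * f ≤ N
near-perfect k 1≤k = go₁ (∃GDD-pair k 1≤k 1 (s≤s z≤n))
  where
  w = suc k
  Goal = ∃ λ N₁ → ∀ N → N₁ ≤ N → ∃ λ f → GDD k N f × 4 * f ≤ N
  go₁ : (∃ λ a → 0 < a × 1 ∣ a × GDD k (w * a) 0 × GDD k (suc (w * a)) 0) → Goal
  -- The factor 8 * suc C makes u' at least 8 * C, the precision at which the short group becomes
  -- harmless; the factor V keeps A and B congruent to 1 modulo V.
  go₁ (a , 0<a , _ , Gu , Gv) = go₂ (∃GDD-pair k 1≤k (V * (8 * suc C)) 0<K)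
    where
    u = w * a
    w≤u : w ≤ u
    w≤u = m≤m*n w a {{>-nonZero 0<a}}
    2≤u : 2 ≤ u
    2≤u = ≤-trans (s≤s 1≤k) w≤u
    open LinearBound Gu Gv 2≤u using (V; C; linear-bound)
    0<V : 0 < V
    0<V = >-nonZero⁻¹ V {{u !≢0}}
    0<K : 0 < V * (8 * suc C)
    0<K = *-mono-≤ {1} {V} {1} {8 * suc C} 0<V (s≤s z≤n)
    open Powers {k} {V} (m≤n⇒m!∣n! w≤u)
    u≤V : u ≤ V
    u≤V = m≤m! u 2≤u
      where
      m≤m! : ∀ m → 2 ≤ m → m ≤ m !
      m≤m! (suc m) _ = m≤m*n (suc m) (m !) {{m !≢0}}
    go₂ : (∃ λ a → 0 < a × V * (8 * suc C) ∣ a × GDD k (w * a) 0 × GDD k (suc (w * a)) 0) → Goal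
    -- The multiple of u' ! allows a cyclic transversal design of order q' with u' + 1 groups; the
    -- factor V is again for the residue of B.
    go₂ (a' , 0<a' , Ka' , Gu' , Gv') = go₃ (∃GDD-pair k 1≤k (u' ! * V) (*-mono-≤ {1} {u' !} {1} {V} (>-nonZero⁻¹ (u' !) {{u' !≢0}}) 0<V))
      where
      u' = w * a'
      K∣u' : V * (8 * suc C) ∣ u'
      K∣u' = ∣n⇒∣m*n w Ka'
      K≤u' : V * (8 * suc C) ≤ u'
      K≤u' = ∣⇒≤ {{m*n≢0 w a' {{_}} {{>-nonZero 0<a'}}}} K∣u'
      8C≤u' : 8 * C ≤ u'
      8C≤u' = ≤-trans (*-monoʳ-≤ 8 (n≤1+n C)) (≤-trans (m≤n*m (8 * suc C) V {{>-nonZero 0<V}}) K≤u')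
      2u≤u' : 2 * u ≤ u'
      2u≤u' = ≤-trans (≤-trans (*-monoʳ-≤ 2 u≤V) (≤-trans (≤-reflexive (*-comm 2 V)) (*-monoʳ-≤ V (≤-trans (*-mono-≤ {2} {8} {1} {suc C} (s≤s (s≤s z≤n)) (s≤s z≤n)) ≤-refl)))) K≤u'
      V∣u' : V ∣ u'
      V∣u' = ∣-trans (m∣m*n (8 * suc C)) K∣u'
      go₃ : (∃ λ a → 0 < a × u' ! * V ∣ a × GDD k (w * a) 0 × GDD k (suc (w * a)) 0) → Goal
      go₃ (a'' , 0<a'' , Ka'' , _ , Gq) = N₁ , final
        where
        x' = w * a''
        q' = suc x'
        u'!∣x' : u' ! ∣ x'
        u'!∣x' = ∣n⇒∣m*n w (∣-trans (m∣m*n V) Ka'')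
        V∣x' : V ∣ x'
        V∣x' = ∣n⇒∣m*n w (∣-trans (n∣m*n (u' !)) Ka'')
        0<x' : 0 < x'
        0<x' = *-mono-≤ {1} {w} {1} {a''} (s≤s z≤n) 0<a''
        -- The two extreme truncations, to a single point and to all q' points, both without
        -- deficiency. Since B = A + x' and u' * x' ≤ A, the ratio B / A is at most 1 + 1 / u'.
        A B : ℕ
        A = u' * q' + 1
        B = u' * q' + q'
        T' : TD⁺ u' q'
        T' = cyclicTD⁺ u' q' x' refl u'!∣x'
        zeros : u' * 0 + 0 ≤ 0
        zeros = ≤-reflexive (trans (+-identityʳ (u' * 0)) (*-zeroʳ u'))
        GA : Good A
        GA = good (u' * q') (+-comm (u' * q') 1) (∣m⇒∣m*n q' V∣u') (GDD-mono zeros (GDD-truncated Gu' Gv' T' (s≤s z≤n) Gq (GDD-empty k 1 0 ≤-refl)))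
        GB : Good B
        GB = good (u' * q' + x') (+-suc (u' * q') x') (∣m∣n⇒∣m+n (∣m⇒∣m*n q' V∣u') V∣x') (GDD-mono zeros (GDD-truncated Gu' Gv' T' ≤-refl Gq Gq))
        2≤A : 2 ≤ A
        2≤A = +-mono-≤ {1} {u' * q'} {1} {1} (*-mono-≤ {1} {u'} {1} {q'} (≤-trans (s≤s z≤n) (≤-trans (≤-trans (s≤s z≤n) (*-monoʳ-≤ 2 2≤u)) 2u≤u')) (s≤s z≤n)) ≤-refl
        A<B : A < B
        A<B = ≤-trans (≤-reflexive (sym (+-suc (u' * q') 1))) (+-monoʳ-≤ (u' * q') (s≤s 0<x'))
        B≡ : B ≡ A + x'
        B≡ = sym (+-assoc (u' * q') 1 x')
        u'x'≤A : u' * x' ≤ A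
        u'x'≤A = ≤-trans (*-monoʳ-≤ u' (n≤1+n x')) (m≤m+n (u' * q') 1)
        instance
          u≢0 : NonZero u
          u≢0 = >-nonZero (≤-trans (s≤s z≤n) 2≤u)
        -- The first term is what `approximate` asks for; 4 * u gives q ≥ 2 * u, so that the
        -- remainder of N modulo u still fits into the short group. In N₁ the term 8 * C * u pays
        -- for the deficiency due to that remainder.
        X₀ = A ^ (A * A) + 4 * u
        N₁ = u * X₀ + 8 * C * u
        final : ∀ N → N₁ ≤ N → ∃ λ f → GDD k N f × 4 * f ≤ N
        final N N₁≤N = pick (approximate A B 2≤A A<B x (≤-trans (m≤m+n (A ^ (A * A)) (4 * u)) X₀≤x))
          where
          x = N / u
          r = N % u
          X₀≤x : X₀ ≤ x
          X₀≤x = ≤-trans (≤-reflexive (sym (m*n/n≡m X₀ u))) (/-monoˡ-≤ u (≤-trans (≤-reflexive (*-comm X₀ u)) (≤-trans (m≤m+n (u * X₀) (8 * C * u)) N₁≤N)))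
          pick : (∃₂ λ i j → A ^ i * B ^ j ≤ x × A * x < B * (A ^ i * B ^ j)) → ∃ λ f → GDD k N f × 4 * f ≤ N
          pick (i , j , q≤x , Ax<Bq) = C * t , subst (λ z → GDD k z (C * t)) (sym N≡)
              (GDD-mono (≤-reflexive (cong (λ z → z + C * t) (*-zeroʳ u))) (GDD-truncated Gu Gv (cyclicTD⁺ u q (Good.prev Gq*) (Good.N≡ Gq*) (Good.V∣prev Gq*)) t≤q (Good.G Gq*) (linear-bound t))) , small
            where
            q = A ^ i * B ^ j
            Gq* : Good q
            Gq* = Good-* (Good-^ GA i) (Good-^ GB j)
            y = x ∸ q
            x≡ : x ≡ q + y
            x≡ = sym (m+[n∸m]≡n q≤x)
            t = u * y + r
            N≡ : N ≡ u * q + t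
            N≡ = trans (m≡m%n+[m/n]*n N u) (trans (cong (λ z → r + z * u) x≡) (lem r q y u))
              where
              lem : ∀ r q y u → r + (q + y) * u ≡ u * q + (u * y + r)
              lem = ℕ-Ring.solve-∀
            Ay≤ : A * y ≤ x' * q
            Ay≤ = +-cancelˡ-≤ (A * q) (A * y) (x' * q) (≤-trans (≤-reflexive (sym (trans (cong (A *_) x≡) (*-distribˡ-+ A q y)))) (≤-trans (<⇒≤ Ax<Bq) (≤-reflexive (trans (cong (_* q) B≡) (*-distribʳ-+ q A x')))))
            -- The number x exceeds its approximation q by a factor below B / A ≤ 1 + 1 / u'.
            u'y≤q : u' * y ≤ q
            u'y≤q = *-cancelˡ-≤ A {{>-nonZero (≤-trans (s≤s z≤n) 2≤A)}} (begin
              A * (u' * y) ≡⟨ l1 A u' y ⟩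
              u' * (A * y) ≤⟨ *-monoʳ-≤ u' Ay≤ ⟩
              u' * (x' * q) ≡⟨ sym (*-assoc u' x' q) ⟩
              u' * x' * q ≤⟨ *-monoˡ-≤ q u'x'≤A ⟩
              A * q ∎)
              where
              open ≤-Reasoning
              l1 : ∀ a b c → a * (b * c) ≡ b * (a * c)
              l1 = ℕ-Ring.solve-∀
            1≤u' : 1 ≤ u'
            1≤u' = ≤-trans (≤-trans (s≤s z≤n) 2≤u) (≤-trans (m≤n*m u 2) 2u≤u')
            x≤2q : x ≤ 2 * q
            x≤2q = ≤-trans (≤-reflexive x≡) (+-monoʳ-≤ q (≤-trans (≤-trans (m≤n*m y u' {{>-nonZero 1≤u'}}) u'y≤q) (≤-reflexive (sym (+-identityʳ q)))))
            2u≤q : 2 * u ≤ q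
            2u≤q = *-cancelˡ-≤ 2 (≤-trans (≤-reflexive (sym (*-assoc 2 2 u))) (≤-trans (≤-trans (m≤n+m (4 * u) (A ^ (A * A))) X₀≤x) x≤2q))
            r≤u : r ≤ u
            r≤u = <⇒≤ (m%n<n N u)
            t≤q : t ≤ q
            t≤q = *-cancelˡ-≤ 2 (begin
              2 * (u * y + r) ≤⟨ *-monoʳ-≤ 2 (+-monoʳ-≤ (u * y) r≤u) ⟩
              2 * (u * y + u) ≡⟨ l1 u y ⟩
              2 * u * y + 2 * u ≤⟨ +-mono-≤ (≤-trans (*-monoˡ-≤ y 2u≤u') u'y≤q) 2u≤q ⟩
              q + q ≡⟨ cong (λ z → q + z) (sym (+-identityʳ q)) ⟩
              2 * q ∎)
              where
              open ≤-Reasoning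
              l1 : ∀ u y → 2 * (u * y + u) ≡ 2 * u * y + 2 * u
              l1 = ℕ-Ring.solve-∀
            small : 4 * (C * t) ≤ N
            small = *-cancelˡ-≤ 2 (begin
              2 * (4 * (C * (u * y + r))) ≤⟨ *-monoʳ-≤ 2 (*-monoʳ-≤ 4 (*-monoʳ-≤ C (+-monoʳ-≤ (u * y) r≤u))) ⟩
              2 * (4 * (C * (u * y + u))) ≡⟨ l1 C u y ⟩
              u * (8 * C * y) + 8 * C * u ≤⟨ +-mono-≤ (*-monoʳ-≤ u (≤-trans (*-monoˡ-≤ y 8C≤u') u'y≤q)) (≤-trans (m≤n+m (8 * C * u) (u * X₀)) N₁≤N) ⟩
              u * q + N ≤⟨ +-monoˡ-≤ N (≤-trans (m≤m+n (u * q) t) (≤-reflexive (sym N≡))) ⟩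
              N + N ≡⟨ cong (λ z → N + z) (sym (+-identityʳ N)) ⟩
              2 * N ∎)
              where
              open ≤-Reasoning
              l1 : ∀ C u y → 2 * (4 * (C * (u * y + u))) ≡ u * (8 * C * y) + 8 * C * u
              l1 = ℕ-Ring.solve-∀

-- Words and distances

β : Bool → ℕ
β true = 1
β false = 0

bit : ∀ {n} → Word n → Fin n → ℕ
bit x i = β (lookup x i)

wt≡ : ∀ {n} (x : Word n) → wt x ≡ sum (bit x)
wt≡ [] = refl
wt≡ (true ∷ x) = cong suc (wt≡ x)
wt≡ (false ∷ x) = wt≡ x

inter : ∀ {n} → Word n → Word n → ℕ
inter x y = sum (λ i → bit x i * bit y i)

bit≤1 : ∀ {n} (x : Word n) i → bit x i ≤ 1
bit≤1 x i with lookup x i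
... | true = ≤-refl
... | false = z≤n

dist-inter : ∀ {n} (x y : Word n) → dist x y + 2 * inter x y ≡ wt x + wt y
dist-inter x y = trans (cong₂ _+_ (wt≡ (x ⊕ y)) (sym (sum-*ˡ 2 (λ i → bit x i * bit y i))))
  (trans (sym (∑-distrib-+ (bit (x ⊕ y)) (λ i → 2 * (bit x i * bit y i))))
    (trans (sum-cong-≗ pointwise) (trans (∑-distrib-+ (bit x) (bit y)) (sym (cong₂ _+_ (wt≡ x) (wt≡ y))))))
  where
  β-xor : ∀ a b → β (a xor b) + 2 * (β a * β b) ≡ β a + β b
  β-xor true true = refl
  β-xor true false = refl
  β-xor false true = refl
  β-xor false false = refl
  pointwise : ∀ i → bit (x ⊕ y) i + 2 * (bit x i * bit y i) ≡ bit x i + bit y i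
  pointwise i = trans (cong (λ b → β b + 2 * (bit x i * bit y i)) (lookup-zipWith _xor_ i x y)) (β-xor (lookup x i) (lookup y i))

inter≤wt : ∀ {n} (x y : Word n) → inter x y ≤ wt x
inter≤wt x y = ≤-trans (sum-mono-≤ (λ i → ≤-trans (*-monoʳ-≤ (bit x i) (bit≤1 y i)) (≤-reflexive (*-identityʳ (bit x i))))) (≤-reflexive (sym (wt≡ x)))

inter-comm : ∀ {n} (x y : Word n) → inter x y ≡ inter y x
inter-comm x y = sum-cong-≗ (λ i → *-comm (bit x i) (bit y i))

dist-translate : ∀ {n} (x x' y : Word n) → dist (x ⊕ y) (x' ⊕ y) ≡ dist x x'
dist-translate x x' y = cong wt (lem x x' y)
  where
  xor-cancel : ∀ a b c → (a xor c) xor (b xor c) ≡ a xor b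
  xor-cancel true true true = refl
  xor-cancel true true false = refl
  xor-cancel true false true = refl
  xor-cancel true false false = refl
  xor-cancel false true true = refl
  xor-cancel false true false = refl
  xor-cancel false false true = refl
  xor-cancel false false false = refl
  lem : ∀ {n} (x x' y : Word n) → (x ⊕ y) ⊕ (x' ⊕ y) ≡ x ⊕ x'
  lem [] [] [] = refl
  lem (a ∷ x) (b ∷ x') (c ∷ y) = cong₂ _∷_ (xor-cancel a b c) (lem x x' y)

candidates : ∀ {n} → Word n → Word n → List (Word n)
candidates [] [] = [] ∷ []
candidates (true ∷ x) (true ∷ y) = map (true ∷_) (candidates x y)
candidates (false ∷ x) (false ∷ y) = map (false ∷_) (candidates x y)
candidates (true ∷ x) (false ∷ y) = map (true ∷_) (candidates x y) ++ map (false ∷_) (candidates x y)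
candidates (false ∷ x) (true ∷ y) = map (true ∷_) (candidates x y) ++ map (false ∷_) (candidates x y)

length-candidates : ∀ {n} (x y : Word n) → length (candidates x y) ≡ 2 ^ dist x y
length-candidates [] [] = refl
length-candidates (true ∷ x) (true ∷ y) = trans (length-map (true ∷_) (candidates x y)) (length-candidates x y)
length-candidates (false ∷ x) (false ∷ y) = trans (length-map (false ∷_) (candidates x y)) (length-candidates x y)
length-candidates (true ∷ x) (false ∷ y) = double x y
  where
  double : ∀ {n} (x y : Word n) → length (map (true ∷_) (candidates x y) ++ map (false ∷_) (candidates x y)) ≡ 2 * 2 ^ dist x y
  double x y = trans (length-++ (map (true ∷_) (candidates x y))) (cong₂ _+_ (trans (length-map (true ∷_) (candidates x y)) (length-candidates x y))
    (trans (trans (length-map (false ∷_) (candidates x y)) (length-candidates x y)) (sym (+-identityʳ _))))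
length-candidates (false ∷ x) (true ∷ y) = trans (length-++ (map (true ∷_) (candidates x y))) (cong₂ _+_ (trans (length-map (true ∷_) (candidates x y)) (length-candidates x y))
    (trans (trans (length-map (false ∷_) (candidates x y)) (length-candidates x y)) (sym (+-identityʳ _))))

-- The centre is the coordinatewise majority of the three words. A coordinate adds 2 to both sides
-- if x differs there from both x₀ and x₁, adds 1 if these two disagree, and 0 otherwise.
nearest : ∀ {n} (x₀ x₁ x : Word n) → ∃ λ y → y ∈ candidates x₀ x₁ × 2 * dist x y + dist x₀ x₁ ≡ dist x x₀ + dist x x₁
nearest [] [] [] = [] , here refl , refl
nearest (a ∷ x₀) (b ∷ x₁) (c ∷ x) with nearest x₀ x₁ x
... | y , y∈ , eq = extend a b c
  where
  d = dist x y
  e = dist x₀ x₁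
  p = dist x x₀
  q = dist x x₁
  both : 2 * suc d + e ≡ suc p + suc q
  both = trans (l1 d e) (trans (cong (λ z → 2 + z) eq) (l2 p q))
    where
    l1 : ∀ d e → 2 * suc d + e ≡ 2 + (2 * d + e)
    l1 = ℕ-Ring.solve-∀
    l2 : ∀ p q → 2 + (p + q) ≡ suc p + suc q
    l2 = ℕ-Ring.solve-∀
  left : 2 * d + suc e ≡ suc p + q
  left = trans (+-suc (2 * d) e) (cong suc eq)
  right : 2 * d + suc e ≡ p + suc q
  right = trans (+-suc (2 * d) e) (trans (cong suc eq) (sym (+-suc p q)))
  extend : ∀ a b c → ∃ λ z → z ∈ candidates (a ∷ x₀) (b ∷ x₁) × 2 * dist (c ∷ x) z + dist (a ∷ x₀) (b ∷ x₁) ≡ dist (c ∷ x) (a ∷ x₀) + dist (c ∷ x) (b ∷ x₁)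
  extend true true true = true ∷ y , ∈-map⁺ (true ∷_) y∈ , eq
  extend true true false = true ∷ y , ∈-map⁺ (true ∷_) y∈ , both
  extend false false true = false ∷ y , ∈-map⁺ (false ∷_) y∈ , both
  extend false false false = false ∷ y , ∈-map⁺ (false ∷_) y∈ , eq
  extend true false true = true ∷ y , ∈-++⁺ˡ (∈-map⁺ (true ∷_) y∈) , right
  extend true false false = false ∷ y , ∈-++⁺ʳ (map (true ∷_) (candidates x₀ x₁)) (∈-map⁺ (false ∷_) y∈) , left
  extend false true true = true ∷ y , ∈-++⁺ˡ (∈-map⁺ (true ∷_) y∈) , left
  extend false true false = false ∷ y , ∈-++⁺ʳ (map (true ∷_) (candidates x₀ x₁)) (∈-map⁺ (false ∷_) y∈) , right

lsum : ∀ {A : Set} → (A → ℕ) → List A → ℕ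
lsum f [] = 0
lsum f (x ∷ xs) = f x + lsum f xs

lsum-mono : ∀ {A : Set} {f g : A → ℕ} xs → (∀ x → x ∈ xs → f x ≤ g x) → lsum f xs ≤ lsum g xs
lsum-mono [] h = z≤n
lsum-mono (x ∷ xs) h = +-mono-≤ (h x (here refl)) (lsum-mono xs (λ y y∈ → h y (there y∈)))

lsum-cong : ∀ {A : Set} {f g : A → ℕ} xs → (∀ x → x ∈ xs → f x ≡ g x) → lsum f xs ≡ lsum g xs
lsum-cong [] h = refl
lsum-cong (x ∷ xs) h = cong₂ _+_ (h x (here refl)) (lsum-cong xs (λ y y∈ → h y (there y∈)))

lsum-+ : ∀ {A : Set} (f g : A → ℕ) xs → lsum (λ x → f x + g x) xs ≡ lsum f xs + lsum g xs
lsum-+ f g [] = refl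
lsum-+ f g (x ∷ xs) = trans (cong (λ z → f x + g x + z) (lsum-+ f g xs)) (lem (f x) (g x) (lsum f xs) (lsum g xs))
  where
  lem : ∀ a b c d → a + b + (c + d) ≡ a + c + (b + d)
  lem = ℕ-Ring.solve-∀

lsum-*ˡ : ∀ {A : Set} c (f : A → ℕ) xs → lsum (λ x → c * f x) xs ≡ c * lsum f xs
lsum-*ˡ c f [] = sym (*-zeroʳ c)
lsum-*ˡ c f (x ∷ xs) = trans (cong (λ z → c * f x + z) (lsum-*ˡ c f xs)) (sym (*-distribˡ-+ c (f x) _))

lsum-const : ∀ {A : Set} c (xs : List A) → lsum (λ _ → c) xs ≡ length xs * c
lsum-const c [] = refl
lsum-const c (x ∷ xs) = cong (λ z → c + z) (lsum-const c xs)

lsum-∑ : ∀ {A : Set} {n} (g : A → Fin n → ℕ) xs → lsum (λ x → sum (g x)) xs ≡ sum (λ i → lsum (λ x → g x i) xs)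
lsum-∑ {n = n} g [] = sym (trans (sum-const n 0) (*-zeroʳ n))
lsum-∑ g (x ∷ xs) = trans (cong (λ z → sum (g x) + z) (lsum-∑ g xs)) (sym (∑-distrib-+ (g x) (λ i → lsum (λ x → g x i) xs)))

lsum-swap : ∀ {A B : Set} (g : A → B → ℕ) xs ys → lsum (λ x → lsum (g x) ys) xs ≡ lsum (λ y → lsum (λ x → g x y) xs) ys
lsum-swap g [] ys = sym (trans (lsum-const 0 ys) (*-zeroʳ (length ys)))
lsum-swap g (x ∷ xs) ys = trans (cong (λ z → lsum (g x) ys + z) (lsum-swap g xs ys)) (sym (lsum-+ (g x) (λ y → lsum (λ x → g x y) xs) ys))

lsum-≥-at : ∀ {A : Set} (f : A → ℕ) {x} xs → x ∈ xs → f x ≤ lsum f xs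
lsum-≥-at f (x ∷ xs) (here refl) = m≤m+n (f x) _
lsum-≥-at f (y ∷ xs) (there x∈) = ≤-trans (lsum-≥-at f xs x∈) (m≤n+m _ (f y))

∃-lsum-< : ∀ {A : Set} (f g : A → ℕ) xs → lsum f xs < lsum g xs → ∃ λ x → x ∈ xs × f x < g x
∃-lsum-< f g (x ∷ xs) h with f x <? g x
... | yes h0 = x , here refl , h0
... | no ¬h0 with ∃-lsum-< f g xs (≰⇒> (λ le → <⇒≱ h (+-mono-≤ (≮⇒≥ ¬h0) le)))
...   | y , y∈ , hy = y , there y∈ , hy

countₗ : ∀ {A : Set} {P : A → Set} → (∀ x → Dec (P x)) → List A → ℕ
countₗ P? = lsum (λ x → ⟦ P? x ⟧)

countₗ-≤1 : ∀ {A : Set} {P : A → Set} (P? : ∀ x → Dec (P x)) xs → Unique xs →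
  (∀ x y → x ∈ xs → y ∈ xs → P x → P y → x ≡ y) → countₗ P? xs ≤ 1
countₗ-≤1 P? [] u h = z≤n
countₗ-≤1 P? (x ∷ xs) (x∉ ∷ u) h with P? x
... | no _ = countₗ-≤1 P? xs u (λ y z y∈ z∈ → h y z (there y∈) (there z∈))
... | yes px = s≤s (≤-trans (lsum-mono xs (λ y y∈ → ≤-reflexive (⟦⟧-no (P? y) (λ py → All.lookup x∉ y∈ (h x y (here refl) (there y∈) px py))))) (≤-reflexive (trans (lsum-const 0 xs) (*-zeroʳ (length xs)))))

module TwoDistance {n k : ℕ} (L : List (Word n)) (unique-L : Unique L)
  (H : ∀ u v → u ∈ L → v ∈ L → u ≢ v → dist u v ≡ 2 * k ⊎ dist u v ≡ 2 * k + 2) where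

  lower : ∀ u v → u ∈ L → v ∈ L → u ≢ v → 2 * k ≤ dist u v
  lower u v u∈ v∈ h with H u v u∈ v∈ h
  ... | inj₁ e = ≤-reflexive (sym e)
  ... | inj₂ e = ≤-trans (m≤m+n (2 * k) 2) (≤-reflexive (sym e))

  upper : ∀ u v → u ∈ L → v ∈ L → u ≢ v → dist u v ≤ 2 * k + 2
  upper u v u∈ v∈ h with H u v u∈ v∈ h
  ... | inj₁ e = ≤-trans (≤-reflexive e) (m≤m+n (2 * k) 2)
  ... | inj₂ e = ≤-reflexive e

  module Centre (y : Word n) where
    r : Word n → ℕ
    r x = wt (x ⊕ y)

    meet : Word n → Word n → ℕ
    meet u v = inter (u ⊕ y) (v ⊕ y)

    identity : ∀ u v → dist u v + 2 * meet u v ≡ r u + r v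
    identity u v = trans (cong (λ z → z + 2 * meet u v) (sym (dist-translate u v y))) (dist-inter (u ⊕ y) (v ⊕ y))

    separated : ∀ u v → u ∈ L → v ∈ L → u ≢ v → 2 * k + 2 * meet u v ≤ r u + r v
    separated u v u∈ v∈ h = ≤-trans (+-monoˡ-≤ (2 * meet u v) (lower u v u∈ v∈ h)) (≤-reflexive (identity u v))

    inside? : ∀ x → Dec (r x < k)
    inside? x = r x <? k
    on? : ∀ x → Dec (r x ≡ k)
    on? x = r x ≟ k
    beyond? : ∀ x → Dec (r x ≡ suc k)
    beyond? x = r x ≟ suc k

    inside-unique : ∀ u v → u ∈ L → v ∈ L → r u < k → r v < k → u ≡ v
    inside-unique u v u∈ v∈ hu hv with ≡-dec _≟ᵇ_ u v
    ... | yes e = e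
    ... | no h = contradiction (≤-trans (m≤m+n (2 * k) _) (separated u v u∈ v∈ h)) (<⇒≱ (<-≤-trans (+-mono-< hu hv) (≤-reflexive (cong (λ z → k + z) (sym (+-identityʳ k))))))

    few-inside : countₗ inside? L ≤ 1
    few-inside = countₗ-≤1 inside? L unique-L inside-unique

    has? : ∀ x i → Dec (lookup (x ⊕ y) i ≡ true)
    has? x i = lookup (x ⊕ y) i ≟ᵇ true

    bit-has : ∀ x i → bit (x ⊕ y) i ≡ ⟦ has? x i ⟧
    bit-has x i = go (lookup (x ⊕ y) i)
      where
      go : ∀ b → β b ≡ ⟦ b ≟ᵇ true ⟧
      go true = refl
      go false = refl

    common : ∀ u v i → lookup (u ⊕ y) i ≡ true → lookup (v ⊕ y) i ≡ true → bit (u ⊕ y) i * bit (v ⊕ y) i ≡ 1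
    common u v i hu hv = cong₂ (λ a b → β a * β b) hu hv

    -- Two words at distance k from y would be closer than 2 * k if their translates shared a
    -- coordinate. Hence the supports are disjoint, and nonempty as k > 0.
    few-on : 0 < k → countₗ on? L ≤ n
    few-on 0<k = ≤-trans (m≤n*m (countₗ on? L) k {{>-nonZero 0<k}}) (begin
      k * countₗ on? L ≡⟨ sym (lsum-*ˡ k (λ x → ⟦ on? x ⟧) L) ⟩
      lsum (λ x → k * ⟦ on? x ⟧) L ≡⟨ lsum-cong L (λ x _ → weigh x) ⟩
      lsum (λ x → sum (λ i → ⟦ on? x ⟧ * bit (x ⊕ y) i)) L ≡⟨ lsum-∑ (λ x i → ⟦ on? x ⟧ * bit (x ⊕ y) i) L ⟩
      sum (λ i → lsum (λ x → ⟦ on? x ⟧ * bit (x ⊕ y) i) L) ≤⟨ sum-≤-const 1 column ⟩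
      n * 1 ≡⟨ *-identityʳ n ⟩
      n ∎)
      where
      open ≤-Reasoning
      weigh : ∀ x → k * ⟦ on? x ⟧ ≡ sum (λ i → ⟦ on? x ⟧ * bit (x ⊕ y) i)
      weigh x = trans (go (on? x)) (sym (trans (sum-*ˡ ⟦ on? x ⟧ (bit (x ⊕ y))) (cong (⟦ on? x ⟧ *_) (sym (wt≡ (x ⊕ y))))))
        where
        go : (d : Dec (r x ≡ k)) → k * ⟦ d ⟧ ≡ ⟦ d ⟧ * r x
        go (yes e) = trans (*-identityʳ k) (trans (sym e) (sym (*-identityˡ (r x))))
        go (no _) = *-zeroʳ k
      column : ∀ i → lsum (λ x → ⟦ on? x ⟧ * bit (x ⊕ y) i) L ≤ 1
      column i = ≤-trans (≤-reflexive (lsum-cong L (λ x _ → trans (cong (⟦ on? x ⟧ *_) (bit-has x i)) (⟦⟧-* (on? x) (has? x i)))))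
        (countₗ-≤1 (λ x → on? x ×-dec has? x i) L unique-L same)
        where
        same : ∀ u v → u ∈ L → v ∈ L → (r u ≡ k × lookup (u ⊕ y) i ≡ true) → (r v ≡ k × lookup (v ⊕ y) i ≡ true) → u ≡ v
        same u v u∈ v∈ (ru , hu) (rv , hv) with ≡-dec _≟ᵇ_ u v
        ... | yes e = e
        ... | no h = contradiction (≤-trans (+-monoʳ-≤ (2 * k) (*-monoʳ-≤ 2 (≤-trans (≤-reflexive (sym (common u v i hu hv))) (sum-≥-at (λ i → bit (u ⊕ y) i * bit (v ⊕ y) i) i)))) (separated u v u∈ v∈ h))
              (<⇒≱ (≤-<-trans (≤-reflexive (trans (cong₂ _+_ ru rv) (cong (λ z → k + z) (sym (+-identityʳ k))))) (≤-trans (≤-reflexive (+-comm 1 (2 * k))) (+-monoʳ-≤ (2 * k) (s≤s z≤n)))))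

    beyond-meet : ∀ u v → u ∈ L → v ∈ L → u ≢ v → r u ≡ suc k → r v ≡ suc k → meet u v ≤ 1
    beyond-meet u v u∈ v∈ h ru rv = *-cancelˡ-≤ 2 (+-cancelˡ-≤ (2 * k) _ _ (≤-trans (separated u v u∈ v∈ h) (≤-reflexive (trans (cong₂ _+_ ru rv) (lem k)))))
      where
      lem : ∀ k → suc k + suc k ≡ 2 * k + 2 * 1
      lem = ℕ-Ring.solve-∀

    degree : Fin n → ℕ
    degree i = lsum (λ x → ⟦ beyond? x ⟧ * bit (x ⊕ y) i) L

    through? : ∀ i x → Dec (r x ≡ suc k × lookup (x ⊕ y) i ≡ true)
    through? i x = beyond? x ×-dec has? x i

    degree-count : ∀ i → degree i ≡ countₗ (through? i) L
    degree-count i = lsum-cong L (λ x _ → trans (cong (⟦ beyond? x ⟧ *_) (bit-has x i)) (⟦⟧-* (beyond? x) (has? x i)))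

    -- The words through i are disjoint outside i, and avoid e.
    degree-bound : ∀ i (e : Word n) → bit e i ≡ 0 → (∀ x → x ∈ L → r x ≡ suc k → inter (x ⊕ y) e ≡ 0) → k * degree i + wt e + 1 ≤ n
    degree-bound i e e-i e-disjoint = +-cancelʳ-≤ (degree i) _ _ (begin
      k * degree i + wt e + 1 + degree i ≡⟨ l1 k (degree i) (wt e) ⟩
      suc k * degree i + wt e + 1 ≡⟨ cong₂ _+_ (cong₂ _+_ weights (wt≡ e)) (sym one) ⟩
      sum (λ j → lsum (λ x → ⟦ through? i x ⟧ * bit (x ⊕ y) j) L) + sum (bit e) + sum (λ j → ⟦ i Fin.≟ j ⟧)
        ≡⟨ sym (trans (∑-distrib-+ (λ j → col j + bit e j) (λ j → ⟦ i Fin.≟ j ⟧)) (cong (λ z → z + sum (λ j → ⟦ i Fin.≟ j ⟧)) (∑-distrib-+ col (bit e)))) ⟩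
      sum (λ j → col j + bit e j + ⟦ i Fin.≟ j ⟧) ≤⟨ sum-mono-≤ pointwise ⟩
      sum (λ j → 1 + ⟦ i Fin.≟ j ⟧ * degree i) ≡⟨ ∑-distrib-+ (λ _ → 1) (λ j → ⟦ i Fin.≟ j ⟧ * degree i) ⟩
      sum (λ (j : Fin n) → 1) + sum (λ j → ⟦ i Fin.≟ j ⟧ * degree i) ≡⟨ cong₂ _+_ (trans (sum-const n 1) (*-identityʳ n)) (trans (sum-*ʳ (degree i) (λ j → ⟦ i Fin.≟ j ⟧)) (trans (cong (_* degree i) one) (*-identityˡ _))) ⟩
      n + degree i ∎)
      where
      open ≤-Reasoning
      l1 : ∀ k d t → k * d + t + 1 + d ≡ suc k * d + t + 1
      l1 = ℕ-Ring.solve-∀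
      col : Fin n → ℕ
      col j = lsum (λ x → ⟦ through? i x ⟧ * bit (x ⊕ y) j) L
      one : sum (λ j → ⟦ i Fin.≟ j ⟧) ≡ 1
      one = ≤-antisym (count-exclusive (i Fin.≟_) (yes tt) (λ _ _ → tt) (λ a b h h' → trans (sym h) h'))
        (≤-trans (≤-reflexive (sym (⟦⟧-yes (i Fin.≟ i) refl))) (sum-≥-at (λ j → ⟦ i Fin.≟ j ⟧) i))
      weights : suc k * degree i ≡ sum col
      weights = trans (cong (suc k *_) (degree-count i)) (trans (sym (lsum-*ˡ (suc k) (λ x → ⟦ through? i x ⟧) L)) (trans (lsum-cong L (λ x _ → weigh x)) (lsum-∑ (λ x j → ⟦ through? i x ⟧ * bit (x ⊕ y) j) L)))
        where
        weigh : ∀ x → suc k * ⟦ through? i x ⟧ ≡ sum (λ j → ⟦ through? i x ⟧ * bit (x ⊕ y) j)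
        weigh x = trans (go (through? i x)) (sym (trans (sum-*ˡ ⟦ through? i x ⟧ (bit (x ⊕ y))) (cong (⟦ through? i x ⟧ *_) (sym (wt≡ (x ⊕ y))))))
          where
          go : (d : Dec (r x ≡ suc k × lookup (x ⊕ y) i ≡ true)) → suc k * ⟦ d ⟧ ≡ ⟦ d ⟧ * r x
          go (yes (e , _)) = trans (*-identityʳ (suc k)) (trans (sym e) (sym (*-identityˡ (r x))))
          go (no _) = *-zeroʳ (suc k)
      pointwise : ∀ j → col j + bit e j + ⟦ i Fin.≟ j ⟧ ≤ 1 + ⟦ i Fin.≟ j ⟧ * degree i
      pointwise j with i Fin.≟ j
      ... | yes refl = ≤-trans (≤-reflexive (trans (cong (λ z → col i + z + 1) e-i) (trans (cong (λ z → z + 1) (+-identityʳ (col i))) (+-comm (col i) 1))))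
              (s≤s (≤-trans (lsum-mono L (λ x _ → ≤-trans (*-monoʳ-≤ ⟦ through? i x ⟧ (bit≤1 (x ⊕ y) i)) (≤-reflexive (*-identityʳ _)))) (≤-reflexive (trans (sym (degree-count i)) (sym (+-identityʳ (degree i)))))))
      ... | no i≢j = ≤-trans (≤-reflexive (+-identityʳ _)) (cases (lookup e j) refl)
        where
        both? : ∀ x → Dec ((r x ≡ suc k × lookup (x ⊕ y) i ≡ true) × lookup (x ⊕ y) j ≡ true)
        both? x = through? i x ×-dec has? x j
        col-count : col j ≡ countₗ both? L
        col-count = lsum-cong L (λ x _ → trans (cong (⟦ through? i x ⟧ *_) (bit-has x j)) (⟦⟧-* (through? i x) (has? x j)))
        two-common : ∀ u v → lookup (u ⊕ y) i ≡ true → lookup (v ⊕ y) i ≡ true → lookup (u ⊕ y) j ≡ true → lookup (v ⊕ y) j ≡ true → 2 ≤ meet u v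
        two-common u v ui vi uj vj = ≤-trans (≤-reflexive (sym (cong₂ _+_ one one')))
          (≤-trans (≤-reflexive (sym (∑-distrib-+ (λ l → ⟦ i Fin.≟ l ⟧) (λ l → ⟦ j Fin.≟ l ⟧)))) (sum-mono-≤ at-most))
          where
          one' : sum (λ l → ⟦ j Fin.≟ l ⟧) ≡ 1
          one' = ≤-antisym (count-exclusive (j Fin.≟_) (yes tt) (λ _ _ → tt) (λ a b h h' → trans (sym h) h'))
            (≤-trans (≤-reflexive (sym (⟦⟧-yes (j Fin.≟ j) refl))) (sum-≥-at (λ l → ⟦ j Fin.≟ l ⟧) j))
          at-most : ∀ l → ⟦ i Fin.≟ l ⟧ + ⟦ j Fin.≟ l ⟧ ≤ bit (u ⊕ y) l * bit (v ⊕ y) l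
          at-most l with i Fin.≟ l | j Fin.≟ l
          ... | yes refl | yes refl = contradiction refl i≢j
          ... | yes refl | no _ = ≤-reflexive (sym (common u v i ui vi))
          ... | no _ | yes refl = ≤-reflexive (sym (common u v j uj vj))
          ... | no _ | no _ = z≤n
        same : ∀ u v → u ∈ L → v ∈ L → ((r u ≡ suc k × lookup (u ⊕ y) i ≡ true) × lookup (u ⊕ y) j ≡ true) → ((r v ≡ suc k × lookup (v ⊕ y) i ≡ true) × lookup (v ⊕ y) j ≡ true) → u ≡ v
        same u v u∈ v∈ ((ru , ui) , uj) ((rv , vi) , vj) with ≡-dec _≟ᵇ_ u v
        ... | yes eq = eq
        ... | no h = contradiction (beyond-meet u v u∈ v∈ h ru rv) (<⇒≱ (two-common u v ui vi uj vj))
        cases : ∀ b → lookup e j ≡ b → col j + bit e j ≤ 1 + 0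
        cases false eq = ≤-trans (≤-reflexive (trans (cong (λ b → col j + β b) eq) (trans (+-identityʳ (col j)) col-count))) (countₗ-≤1 both? L unique-L same)
        cases true eq = ≤-reflexive (cong₂ _+_ (trans col-count none) (cong β eq))
          where
          none : countₗ both? L ≡ 0
          none = trans (lsum-cong L (λ x x∈ → ⟦⟧-no (both? x) (λ ((rx , _) , xj) → contradiction
            (≤-trans (≤-reflexive (sym (cong₂ (λ a b → β a * β b) xj eq))) (≤-trans (sum-≥-at (λ l → bit (x ⊕ y) l * bit e l) j) (≤-reflexive (e-disjoint x x∈ rx)))) λ ())))
            (trans (lsum-const 0 L) (*-zeroʳ (length L)))

-- The structure of large two-distance codes

inter-self : ∀ {n} (x : Word n) → inter x x ≡ wt x
inter-self x = trans (sum-cong-≗ (λ i → go (lookup x i))) (sym (wt≡ x))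
  where
  go : ∀ b → β b * β b ≡ β b
  go true = refl
  go false = refl

dist-self : ∀ {n} (x : Word n) → dist x x ≡ 0
dist-self x = +-cancelʳ-≡ (2 * inter x x) (dist x x) 0 (trans (dist-inter x x) (trans (cong (λ z → z + z) (sym (inter-self x))) (cong (λ z → inter x x + z) (sym (+-identityʳ _)))))

module Structure {n k : ℕ} (0<k : 0 < k) (L : List (Word n)) (unique-L : Unique L)
  (H : ∀ u v → u ∈ L → v ∈ L → u ≢ v → dist u v ≡ 2 * k ⊎ dist u v ≡ 2 * k + 2) where
  open TwoDistance {n} {k} L unique-L H

  upper′ : ∀ u v → u ∈ L → v ∈ L → dist u v ≤ 2 * k + 2
  upper′ u v u∈ v∈ with ≡-dec _≟ᵇ_ u v
  ... | yes refl = ≤-trans (≤-reflexive (dist-self u)) z≤n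
  ... | no h = upper u v u∈ v∈ h

  -- Pigeonhole over 2 ^ (2 * k + 2) centres: each word lies within distance k + 1 of one of them,
  -- and the part strictly inside a ball accounts for at most 1 + n words.
  popular-centre : ∀ B x₀ x₁ → x₀ ∈ L → x₁ ∈ L → dist x₀ x₁ ≡ 2 * k + 2 → 2 ^ (2 * k + 2) * (1 + n + B) < length L →
    ∃ λ y → B < countₗ (Centre.beyond? y) L
  popular-centre B x₀ x₁ x₀∈ x₁∈ d big = finish (∃-lsum-< (λ _ → 1 + n + B) total Y (<-≤-trans (≤-<-trans (≤-reflexive (trans (lsum-const (1 + n + B) Y) (cong (_* (1 + n + B)) (trans (length-candidates x₀ x₁) (cong (2 ^_) d))))) big) covered))
    where
    Y = candidates x₀ x₁
    shells : Word n → Word n → ℕ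
    shells y x = ⟦ Centre.inside? y x ⟧ + ⟦ Centre.on? y x ⟧ + ⟦ Centre.beyond? y x ⟧
    total : Word n → ℕ
    total y = lsum (shells y) L
    total-bound : ∀ y → total y ≤ 1 + n + countₗ (Centre.beyond? y) L
    total-bound y = ≤-trans (≤-reflexive (trans (lsum-+ (λ x → ⟦ Centre.inside? y x ⟧ + ⟦ Centre.on? y x ⟧) (λ x → ⟦ Centre.beyond? y x ⟧) L) (cong (λ z → z + countₗ (Centre.beyond? y) L) (lsum-+ (λ x → ⟦ Centre.inside? y x ⟧) (λ x → ⟦ Centre.on? y x ⟧) L))))
      (+-monoˡ-≤ _ (+-mono-≤ (Centre.few-inside y) (Centre.few-on y 0<k)))
    in-shell : ∀ y x → Centre.r y x ≤ suc k → 1 ≤ shells y x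
    in-shell y x h with m≤n⇒m<n∨m≡n h
    ... | inj₂ e = ≤-trans (≤-reflexive (sym (⟦⟧-yes (Centre.beyond? y x) e))) (m≤n+m _ (⟦ Centre.inside? y x ⟧ + ⟦ Centre.on? y x ⟧))
    ... | inj₁ (s≤s h') with m≤n⇒m<n∨m≡n h'
    ...   | inj₂ e = ≤-trans (≤-trans (≤-reflexive (sym (⟦⟧-yes (Centre.on? y x) e))) (m≤n+m _ ⟦ Centre.inside? y x ⟧)) (m≤m+n _ ⟦ Centre.beyond? y x ⟧)
    ...   | inj₁ l = ≤-trans (≤-trans (≤-reflexive (sym (⟦⟧-yes (Centre.inside? y x) l))) (m≤m+n _ ⟦ Centre.on? y x ⟧)) (m≤m+n _ ⟦ Centre.beyond? y x ⟧)
    each : ∀ x → x ∈ L → 1 ≤ lsum (λ y → shells y x) Y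
    each x x∈ with nearest x₀ x₁ x
    ... | y , y∈ , eq = ≤-trans (in-shell y x close) (lsum-≥-at (λ y → shells y x) Y y∈)
      where
      lem : ∀ k → 2 * k + 2 ≡ 2 * suc k
      lem = ℕ-Ring.solve-∀
      close : dist x y ≤ suc k
      close = *-cancelˡ-≤ 2 (+-cancelʳ-≤ (2 * k + 2) _ _ (≤-trans (≤-reflexive (trans (cong (λ z → 2 * dist x y + z) (sym d)) eq))
        (≤-trans (+-mono-≤ (upper′ x x₀ x∈ x₀∈) (upper′ x x₁ x∈ x₁∈)) (≤-reflexive (cong (λ z → z + (2 * k + 2)) (lem k))))))
    covered : length L ≤ lsum total Y
    covered = ≤-trans (≤-reflexive (trans (sym (*-identityʳ (length L))) (sym (lsum-const 1 L)))) (≤-trans (lsum-mono L each) (≤-reflexive (lsum-swap (λ x y → shells y x) L Y)))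
    finish : (∃ λ y → y ∈ Y × 1 + n + B < total y) → ∃ λ y → B < countₗ (Centre.beyond? y) L
    finish (y , _ , h) = y , +-cancelˡ-< (1 + n) B _ (<-≤-trans h (total-bound y))

  module Popular (y : Word n) (many : (3 * k + 3) * n < countₗ (Centre.beyond? y) L) where
    open Centre y
    F = countₗ beyond? L

    zero-word : Word n
    zero-word = replicate n false

    bit-zero : ∀ i → bit zero-word i ≡ 0
    bit-zero i = cong β (lookup-replicate i false)

    degree≤n : ∀ i → degree i ≤ n
    degree≤n i = ≤-trans (m≤n*m (degree i) k {{>-nonZero 0<k}}) (≤-trans (≤-trans (m≤m+n _ (wt zero-word)) (m≤m+n _ 1))
      (degree-bound i zero-word (bit-zero i) (λ x _ _ → trans (sum-cong-≗ (λ j → trans (cong (bit (x ⊕ y) j *_) (bit-zero j)) (*-zeroʳ (bit (x ⊕ y) j)))) (trans (sum-const n 0) (*-zeroʳ n)))))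

    some-beyond : ∃ λ x → x ∈ L × r x ≡ suc k
    some-beyond with ∃-lsum-< (λ _ → 0) (λ x → ⟦ beyond? x ⟧) L (≤-<-trans (≤-trans (≤-reflexive (trans (lsum-const 0 L) (*-zeroʳ (length L)))) z≤n) many)
    ... | x , x∈ , h = x , x∈ , ⟦⟧-holds (beyond? x) h

    -- The triangle inequality through a word at distance k + 1 from y, at most 2 * k + 2 away from
    -- z. This is the origin of the constant 3 * k + 3.
    r-bound : ∀ z → z ∈ L → r z ≤ 3 * k + 3
    r-bound z z∈ with some-beyond
    ... | x , x∈ , rx = +-cancelʳ-≤ (suc k) _ _ (≤-trans (≤-reflexive (trans (cong (λ w → r z + w) (sym rx)) (sym (identity z x))))
      (≤-trans (+-mono-≤ (upper′ z x z∈ x∈) (*-monoʳ-≤ 2 (≤-trans (≤-reflexive (inter-comm (z ⊕ y) (x ⊕ y))) (≤-trans (inter≤wt (x ⊕ y) (z ⊕ y)) (≤-reflexive rx))))) (≤-reflexive (lem k))))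
      where
      lem : ∀ k → 2 * k + 2 + 2 * suc k ≡ 3 * k + 3 + suc k
      lem = ℕ-Ring.solve-∀

    meets : ∀ z → lsum (λ x → ⟦ beyond? x ⟧ * meet x z) L ≤ r z * n
    meets z = begin
      lsum (λ x → ⟦ beyond? x ⟧ * meet x z) L ≡⟨ lsum-cong L (λ x _ → trans (sym (sum-*ˡ ⟦ beyond? x ⟧ (λ i → bit (x ⊕ y) i * bit (z ⊕ y) i))) (sum-cong-≗ (λ i → lem ⟦ beyond? x ⟧ (bit (x ⊕ y) i) (bit (z ⊕ y) i)))) ⟩
      lsum (λ x → sum (λ i → bit (z ⊕ y) i * (⟦ beyond? x ⟧ * bit (x ⊕ y) i))) L ≡⟨ lsum-∑ (λ x i → bit (z ⊕ y) i * (⟦ beyond? x ⟧ * bit (x ⊕ y) i)) L ⟩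
      sum (λ i → lsum (λ x → bit (z ⊕ y) i * (⟦ beyond? x ⟧ * bit (x ⊕ y) i)) L) ≡⟨ sum-cong-≗ (λ i → lsum-*ˡ (bit (z ⊕ y) i) (λ x → ⟦ beyond? x ⟧ * bit (x ⊕ y) i) L) ⟩
      sum (λ i → bit (z ⊕ y) i * degree i) ≤⟨ sum-mono-≤ (λ i → *-monoʳ-≤ (bit (z ⊕ y) i) (degree≤n i)) ⟩
      sum (λ i → bit (z ⊕ y) i * n) ≡⟨ sum-*ʳ n (bit (z ⊕ y)) ⟩
      sum (bit (z ⊕ y)) * n ≡⟨ cong (_* n) (sym (wt≡ (z ⊕ y))) ⟩
      r z * n ∎
      where
      open ≤-Reasoning
      lem : ∀ a b c → a * (b * c) ≡ c * (a * b)
      lem = ℕ-Ring.solve-∀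

    -- The at most 3 * k + 3 coordinates of z lie in at most n words each, and `many` provides more
    -- words than that.
    disjoint-word : ∀ z → z ∈ L → ∃ λ x → x ∈ L × r x ≡ suc k × meet x z ≡ 0
    disjoint-word z z∈ = go (∃-lsum-< (λ x → ⟦ beyond? x ⟧ * meet x z) (λ x → ⟦ beyond? x ⟧) L (≤-<-trans (meets z) (≤-<-trans (*-monoˡ-≤ n (r-bound z z∈)) many)))
      where
      split : ∀ x → (d : Dec (r x ≡ suc k)) → ∀ m → ⟦ d ⟧ * m < ⟦ d ⟧ → r x ≡ suc k × m ≡ 0
      split x (yes e) m h = e , n≤0⇒n≡0 (s≤s⁻¹ (≤-trans (s≤s (≤-reflexive (sym (+-identityʳ m)))) h))
      split x (no _) m ()
      go : (∃ λ x → x ∈ L × ⟦ beyond? x ⟧ * meet x z < ⟦ beyond? x ⟧) → ∃ λ x → x ∈ L × r x ≡ suc k × meet x z ≡ 0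
      go (x , x∈ , h) = x , x∈ , split x (beyond? x) (meet x z) h

    radius : ∀ z → z ∈ L → suc (r z) ≡ k ⊎ r z ≡ suc k
    radius z z∈ = go (disjoint-word z z∈)
      where
      go : (∃ λ x → x ∈ L × r x ≡ suc k × meet x z ≡ 0) → suc (r z) ≡ k ⊎ r z ≡ suc k
      go (x , x∈ , rx , m0) = finish (H z x z∈ x∈ z≢x)
        where
        z≢x : z ≢ x
        z≢x refl = contradiction (trans (sym rx) (trans (sym (inter-self (z ⊕ y))) m0)) λ ()
        total : dist z x ≡ r z + suc k
        total = trans (sym (trans (cong (λ w → dist z x + 2 * w) (trans (inter-comm (z ⊕ y) (x ⊕ y)) m0)) (+-identityʳ _))) (trans (identity z x) (cong (λ w → r z + w) rx))
        finish : dist z x ≡ 2 * k ⊎ dist z x ≡ 2 * k + 2 → suc (r z) ≡ k ⊎ r z ≡ suc k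
        finish (inj₁ e) = inj₁ (+-cancelʳ-≡ k (suc (r z)) k (trans (sym (+-suc (r z) k)) (trans (trans (sym total) e) (cong (λ w → k + w) (+-identityʳ k)))))
        finish (inj₂ e) = inj₂ (+-cancelʳ-≡ (suc k) (r z) (suc k) (trans (trans (sym total) e) (lem k)))
          where
          lem : ∀ k → 2 * k + 2 ≡ suc k + suc k
          lem = ℕ-Ring.solve-∀

    constant-or-deep : All (λ x → r x ≡ suc k) L ⊎ ∃ λ z → z ∈ L × suc (r z) ≡ k
    constant-or-deep = go L (λ _ h → h)
      where
      go : ∀ xs → (∀ x → x ∈ xs → x ∈ L) → All (λ x → r x ≡ suc k) xs ⊎ ∃ λ z → z ∈ L × suc (r z) ≡ k
      go [] _ = inj₁ []
      go (x ∷ xs) sub = step (radius x (sub x (here refl))) (go xs (λ y y∈ → sub y (there y∈)))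
        where
        step : suc (r x) ≡ k ⊎ r x ≡ suc k → All (λ x → r x ≡ suc k) xs ⊎ (∃ λ z → z ∈ L × suc (r z) ≡ k) → All (λ x → r x ≡ suc k) (x ∷ xs) ⊎ ∃ λ z → z ∈ L × suc (r z) ≡ k
        step (inj₁ e) _ = inj₂ (x , sub x (here refl) , e)
        step (inj₂ e) (inj₁ es) = inj₁ (e ∷ es)
        step (inj₂ e) (inj₂ h) = inj₂ h

    -- A word z at distance k - 1 from y is disjoint from all others, which therefore live on the remaining v coordinates.
    module Deep (z : Word n) (z∈ : z ∈ L) (rz : suc (r z) ≡ k) where
      L≤1+F : length L ≤ suc F
      L≤1+F = ≤-trans (≤-reflexive (trans (sym (*-identityʳ (length L))) (sym (lsum-const 1 L)))) (≤-trans (lsum-mono L each)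
        (≤-trans (≤-reflexive (lsum-+ (λ x → ⟦ inside? x ⟧) (λ x → ⟦ beyond? x ⟧) L)) (+-monoˡ-≤ F few-inside)))
        where
        each : ∀ x → x ∈ L → 1 ≤ ⟦ inside? x ⟧ + ⟦ beyond? x ⟧
        each x x∈ = [ (λ e → ≤-trans (≤-reflexive (sym (⟦⟧-yes (inside? x) (≤-reflexive e)))) (m≤m+n _ ⟦ beyond? x ⟧))
          , (λ e → ≤-trans (≤-reflexive (sym (⟦⟧-yes (beyond? x) e))) (m≤n+m _ ⟦ inside? x ⟧)) ]′ (radius x x∈)

      avoids : ∀ x → x ∈ L → r x ≡ suc k → inter (x ⊕ y) (z ⊕ y) ≡ 0
      avoids x x∈ rx = n≤0⇒n≡0 (*-cancelˡ-≤ 2 (+-cancelˡ-≤ (2 * k) _ _ (≤-trans (separated x z x∈ z∈ x≢z) (≤-reflexive (trans (cong (λ w → w + r z) rx) (trans (sym (+-suc k (r z))) (trans (cong (λ w → k + w) rz) (lem k))))))))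
        where
        x≢z : x ≢ z
        x≢z refl = <-irrefl (trans (sym rz) (cong suc rx)) (≤-trans (n<1+n k) (n≤1+n (suc k)))
        lem : ∀ k → k + k ≡ 2 * k + 2 * 0
        lem = ℕ-Ring.solve-∀

      -- Johnson's double count of incidences. Coordinates of z have degree 0 and the others at most
      -- D; crediting D to each coordinate of z makes the bound uniform over all n, and the k - 1
      -- credits are then taken off, leaving v = n + 1 - k.
      johnson : ∀ D v → (∀ d → k * d + k ≤ n → d ≤ D) → v + k ≡ suc n → suc k * F ≤ v * D
      johnson D v maxD v+k = +-cancelʳ-≤ (r z * D) _ _ (begin
        suc k * F + r z * D ≡⟨ cong₂ _+_ weights (trans (cong (_* D) (wt≡ (z ⊕ y))) (sym (sum-*ʳ D (bit (z ⊕ y))))) ⟩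
        sum degree + sum (λ i → bit (z ⊕ y) i * D) ≡⟨ sym (∑-distrib-+ degree (λ i → bit (z ⊕ y) i * D)) ⟩
        sum (λ i → degree i + bit (z ⊕ y) i * D) ≤⟨ sum-≤-const D column ⟩
        n * D ≡⟨ cong (_* D) n≡ ⟩
        (v + r z) * D ≡⟨ *-distribʳ-+ D v (r z) ⟩
        v * D + r z * D ∎)
        where
        open ≤-Reasoning
        n≡ : n ≡ v + r z
        n≡ = suc-injective (trans (sym v+k) (trans (cong (λ w → v + w) (sym rz)) (+-suc v (r z))))
        weights : suc k * F ≡ sum degree
        weights = trans (sym (lsum-*ˡ (suc k) (λ x → ⟦ beyond? x ⟧) L)) (trans (lsum-cong L (λ x _ → weigh x)) (lsum-∑ (λ x i → ⟦ beyond? x ⟧ * bit (x ⊕ y) i) L))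
          where
          weigh : ∀ x → suc k * ⟦ beyond? x ⟧ ≡ sum (λ i → ⟦ beyond? x ⟧ * bit (x ⊕ y) i)
          weigh x = trans (go (beyond? x)) (sym (trans (sum-*ˡ ⟦ beyond? x ⟧ (bit (x ⊕ y))) (cong (⟦ beyond? x ⟧ *_) (sym (wt≡ (x ⊕ y))))))
            where
            go : (d : Dec (r x ≡ suc k)) → suc k * ⟦ d ⟧ ≡ ⟦ d ⟧ * r x
            go (yes e) = trans (*-identityʳ (suc k)) (trans (sym e) (sym (*-identityˡ (r x))))
            go (no _) = *-zeroʳ (suc k)
        column : ∀ i → degree i + bit (z ⊕ y) i * D ≤ D
        column i = cases (lookup (z ⊕ y) i) refl
          where
          cases : ∀ b → lookup (z ⊕ y) i ≡ b → degree i + bit (z ⊕ y) i * D ≤ D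
          cases false eq = ≤-trans (≤-reflexive (trans (cong (λ b → degree i + β b * D) eq) (+-identityʳ (degree i))))
            (maxD (degree i) (≤-trans (≤-reflexive (trans (cong (λ w → k * degree i + w) (trans (sym rz) (+-comm 1 (r z)))) (sym (+-assoc (k * degree i) (r z) 1)))) (degree-bound i (z ⊕ y) (cong β eq) avoids)))
          cases true eq = ≤-reflexive (trans (cong₂ _+_ none (cong (λ b → β b * D) eq)) (*-identityˡ D))
            where
            none : degree i ≡ 0
            none = trans (degree-count i) (trans (lsum-cong L (λ x x∈ → ⟦⟧-no (through? i x) (λ (rx , xi) → contradiction
              (≤-trans (≤-reflexive (sym (cong₂ (λ a b → β a * β b) xi eq))) (≤-trans (sum-≥-at (λ l → bit (x ⊕ y) l * bit (z ⊕ y) l) i) (≤-reflexive (avoids x x∈ rx)))) λ ())))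
              (trans (lsum-const 0 L) (*-zeroʳ (length L))))

-- Codes from packings

β-does : ∀ {A : Set} (d : Dec A) → β (does d) ≡ ⟦ d ⟧
β-does (yes _) = refl
β-does (no _) = refl

Packing : ℕ → ℕ → ℕ → Set
Packing w n b = Design w (Fin n) _≡_ (Fin b)

module PackingCode {n k b : ℕ} (D : Packing (suc k) n b) (many : 1 + suc k * n < b) where
  open Design D
  w = suc k

  member? : ∀ i x → Dec (∃ λ l → blk i l ≡ x)
  member? i x = Fin.any? (λ l → blk i l Fin.≟ x)

  word : Fin b → Word n
  word i = tabulate (λ x → does (member? i x))

  bit-word : ∀ i x → bit (word i) x ≡ ⟦ member? i x ⟧
  bit-word i x = trans (cong β (lookup∘tabulate (λ x → does (member? i x)) x)) (β-does (member? i x))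

  blk-inj : ∀ i {l m} → blk i l ≡ blk i m → l ≡ m
  blk-inj = Design-injective D (λ _ → refl)

  wt-word : ∀ i → wt (word i) ≡ w
  wt-word i = trans (wt≡ (word i)) (trans (sum-cong-≗ (bit-word i)) (≤-antisym below above))
    where
    all? : ∀ (l : Fin w) → Dec ⊤
    all? _ = yes tt
    all≡ : count all? ≡ w
    all≡ = trans (sum-const w 1) (*-identityʳ w)
    below : count (member? i) ≤ w
    below = ≤-trans (count-inj (member? i) all? (λ x h → proj₁ h) (λ _ _ → tt) (λ x x' h h' e → trans (sym (proj₂ h)) (trans (cong (blk i) e) (proj₂ h')))) (≤-reflexive all≡)
    above : w ≤ count (member? i)
    above = ≤-trans (≤-reflexive (sym all≡)) (count-inj all? (member? i) (λ l _ → blk i l) (λ l _ → l , refl) (λ l m _ _ e → blk-inj i e))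

  inter-word : ∀ i j → inter (word i) (word j) ≡ count (λ x → member? i x ×-dec member? j x)
  inter-word i j = sum-cong-≗ (λ x → trans (cong₂ _*_ (bit-word i x) (bit-word j x)) (⟦⟧-* (member? i x) (member? j x)))

  inter≤1 : ∀ {i j} → i ≢ j → inter (word i) (word j) ≤ 1
  inter≤1 {i} {j} i≢j = ≤-trans (≤-reflexive (inter-word i j)) (count-exclusive (λ x → member? i x ×-dec member? j x) (yes tt) (λ _ _ → tt) same)
    where
    same : ∀ x y → (∃ λ l → blk i l ≡ x) × (∃ λ l → blk j l ≡ x) → (∃ λ l → blk i l ≡ y) × (∃ λ l → blk j l ≡ y) → x ≡ y
    same x y ((l , e) , (l' , e')) ((m , f) , (m' , f')) with l Fin.≟ m
    ... | yes refl = trans (sym e) f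
    ... | no h = contradiction (linear h (trans e (sym e')) (trans f (sym f'))) i≢j

  dist-word : ∀ i j → dist (word i) (word j) + 2 * inter (word i) (word j) ≡ 2 * k + 2
  dist-word i j = trans (dist-inter (word i) (word j)) (trans (cong₂ _+_ (wt-word i) (wt-word j)) (lem k))
    where
    lem : ∀ k → suc k + suc k ≡ 2 * k + 2
    lem = ℕ-Ring.solve-∀

  dist-0 : ∀ i j → inter (word i) (word j) ≡ 0 → dist (word i) (word j) ≡ 2 * k + 2
  dist-0 i j e = trans (sym (trans (cong (λ z → dist (word i) (word j) + 2 * z) e) (+-identityʳ _))) (dist-word i j)

  dist-1 : ∀ i j → inter (word i) (word j) ≡ 1 → dist (word i) (word j) ≡ 2 * k
  dist-1 i j e = +-cancelʳ-≡ 2 _ _ (trans (sym (cong (λ z → dist (word i) (word j) + 2 * z) e)) (dist-word i j))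

  two-distances : ∀ {i j} → i ≢ j → dist (word i) (word j) ≡ 2 * k ⊎ dist (word i) (word j) ≡ 2 * k + 2
  two-distances {i} {j} h = go (inter (word i) (word j)) refl (inter≤1 h)
    where
    go : ∀ m → inter (word i) (word j) ≡ m → m ≤ 1 → dist (word i) (word j) ≡ 2 * k ⊎ dist (word i) (word j) ≡ 2 * k + 2
    go 0 e _ = inj₂ (dist-0 i j e)
    go 1 e _ = inj₁ (dist-1 i j e)
    go (suc (suc _)) e (s≤s ())

  word-injective : 0 < k → ∀ {i j} → word i ≡ word j → i ≡ j
  word-injective 0<k {i} {j} e with i Fin.≟ j
  ... | yes h = h
  ... | no h = ⊥-elim (far (two-distances h))
    where
    zero-dist : dist (word i) (word j) ≡ 0
    zero-dist = subst (λ z → dist (word i) z ≡ 0) e (dist-self (word i))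
    far : dist (word i) (word j) ≡ 2 * k ⊎ dist (word i) (word j) ≡ 2 * k + 2 → ⊥
    far (inj₁ eq) = <-irrefl (trans (sym zero-dist) eq) (≤-trans 0<k (m≤m+n k _))
    far (inj₂ eq) = <-irrefl (trans (sym zero-dist) eq) (≤-trans (s≤s z≤n) (m≤n+m 2 (2 * k)))

  n<b : n < b
  n<b = ≤-<-trans (≤-trans (m≤m+n n (k * n)) (n≤1+n _)) many

  -- Both distances have to occur in the code. For the smaller one, more blocks than points force
  -- two blocks with the same first point.
  meeting-pair : ∃₂ λ i j → i ≢ j × inter (word i) (word j) ≡ 1
  meeting-pair with Fin.pigeonhole n<b (λ i → blk i zero)
  ... | i , j , i<j , e = i , j , i≢j , ≤-antisym (inter≤1 i≢j) (≤-trans (≤-trans (≤-reflexive (sym (cong₂ _*_ (in-word i zero) (trans (cong (bit (word j)) e) (in-word j zero))))) (sum-≥-at (λ x → bit (word i) x * bit (word j) x) (blk i zero))) ≤-refl)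
    where
    i≢j : i ≢ j
    i≢j refl = <-irrefl refl i<j
    in-word : ∀ i l → bit (word i) (blk i l) ≡ 1
    in-word i l = trans (bit-word i (blk i l)) (⟦⟧-yes (member? i (blk i l)) (l , refl))

  b₀ : Fin b
  b₀ = fromℕ< (≤-<-trans z≤n many)

  -- A block meeting b₀ in its l-th point is determined by l and one more of its points.
  module AllMeet (0<k : 0 < k) (meets : ∀ i → inter (word b₀) (word i) ≢ 0) where
    common : ∀ i → ∃ λ x → (∃ λ l → blk b₀ l ≡ x) × (∃ λ l → blk i l ≡ x)
    common i = search (λ x → member? b₀ x ×-dec member? i x) λ none → meets i (trans (inter-word b₀ i)
      (trans (sum-cong-≗ (λ x → ⟦⟧-no (member? b₀ x ×-dec member? i x) (none x))) (trans (sum-const n 0) (*-zeroʳ n))))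
    pos own other : Fin b → Fin w
    pos i = proj₁ (proj₁ (proj₂ (common i)))
    own i = proj₁ (proj₂ (proj₂ (common i)))
    other i = punchIn (own i) (fromℕ< 0<k)
    agree : ∀ i → blk b₀ (pos i) ≡ blk i (own i)
    agree i = trans (proj₂ (proj₁ (proj₂ (common i)))) (sym (proj₂ (proj₂ (proj₂ (common i)))))
    label : ∀ i → Dec (i ≡ b₀) → Fin (1 + w * n)
    label i (yes _) = zero
    label i (no _) = suc (Fin.combine (pos i) (blk i (other i)))
    determined : ∀ i j → pos i ≡ pos j × blk i (other i) ≡ blk j (other j) → i ≡ j
    determined i j (p , q) = linear (Fin.punchInᵢ≢i (own i) (fromℕ< 0<k) ∘ sym) (trans (sym (agree i)) (trans (cong (blk b₀) p) (agree j))) q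
    label-inj : ∀ i j d d' → label i d ≡ label j d' → i ≡ j
    label-inj i j (yes p) (yes q) e = trans p (sym q)
    label-inj i j (no _) (no _) e = determined i j (Fin.combine-injective (pos i) (blk i (other i)) (pos j) (blk j (other j)) (Fin.suc-injective e))
    impossible : ⊥
    impossible = <⇒≱ many (Fin.injective⇒≤ {f = λ i → label i (i Fin.≟ b₀)} (λ {i} {j} → label-inj i j (i Fin.≟ b₀) (j Fin.≟ b₀)))

  disjoint-pair : 0 < k → ∃₂ λ i j → i ≢ j × inter (word i) (word j) ≡ 0
  disjoint-pair 0<k with Fin.any? (λ i → inter (word b₀) (word i) ≟ 0)
  ... | yes (i , e) = b₀ , i , b₀≢i , e
    where
    b₀≢i : b₀ ≢ i
    b₀≢i refl = contradiction (trans (sym (trans (inter-self (word b₀)) (wt-word b₀))) e) λ ()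
  ... | no ¬h = ⊥-elim (AllMeet.impossible 0<k (λ i e → ¬h (i , e)))

  code : 0 < k → Code n
  code 0<k = mkCode (List.tabulate word) (tabulate⁺ (word-injective 0<k))

  code-size : ∀ 0<k → length (words (code 0<k)) ≡ b
  code-size 0<k = length-tabulate word

  code-distances : ∀ 0<k → HasDistanceSet (code 0<k) (2 * k) (2 * k + 2)
  code-distances 0<k = all-pairs , at 0<k dist-1 meeting-pair , at 0<k dist-0 (disjoint-pair 0<k)
    where
    all-pairs : ∀ u v → u ∈ List.tabulate word → v ∈ List.tabulate word → u ≢ v → dist u v ≡ 2 * k ⊎ dist u v ≡ 2 * k + 2
    all-pairs u v u∈ v∈ u≢v with ∈-tabulate⁻ {f = word} u∈ | ∈-tabulate⁻ {f = word} v∈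
    ... | i , refl | j , refl = two-distances (λ { refl → u≢v refl })
    at : ∀ 0<k {m d} → (∀ i j → inter (word i) (word j) ≡ m → dist (word i) (word j) ≡ d) → (∃₂ λ i j → i ≢ j × inter (word i) (word j) ≡ m) →
      ∃ λ u → ∃ λ v → u ∈ List.tabulate word × v ∈ List.tabulate word × u ≢ v × dist u v ≡ d
    at 0<k f (i , j , i≢j , e) = word i , word j , ∈-tabulate⁺ {f = word} i , ∈-tabulate⁺ {f = word} j , (λ eq → i≢j (word-injective 0<k eq)) , f i j e

Packing-affine : ∀ {k N b} n → N * k ≤ n → Design (suc k) (Fin N × Fin k) Fibre (Fin b) → Packing (suc k) n b
Packing-affine {k} {N} n h = Design-map (λ (x , s) → Fin.inject≤ (Fin.combine x s) h) inj (λ e → cong proj₁ (inj e))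
  where
  inj : ∀ {x y : Fin N × Fin k} → Fin.inject≤ (Fin.combine (proj₁ x) (proj₂ x)) h ≡ Fin.inject≤ (Fin.combine (proj₁ y) (proj₂ y)) h → x ≡ y
  inj e = combine-injective (Fin.inject≤-injective h h _ _ e)

-- A common point at infinity turns each fibre of size k into a block of size k + 1.
module Completion {k N : ℕ} {I : Set} (D : Design (suc k) (Fin N × Fin k) Fibre I) where
  open Design D renaming (blk to old)
  X = ⊤ ⊎ (Fin N × Fin k)

  blk : I ⊎ Fin N → Fin (suc k) → X
  blk (inj₁ i) l = inj₂ (old i l)
  blk (inj₂ x) zero = inj₁ tt
  blk (inj₂ x) (suc s) = inj₂ (x , s)

  tr : ∀ i {l m} → l ≢ m → blk i l ≢ blk i m
  tr (inj₁ i) h e = transversal i h (cong proj₁ (inj₂-injective e))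
  tr (inj₂ x) {zero} {zero} h e = h refl
  tr (inj₂ x) {suc s} {suc t} h e = h (cong suc (cong proj₂ (inj₂-injective e)))

  old-fibre : ∀ i x {l m l' m'} → l ≢ m → blk (inj₁ i) l ≡ blk (inj₂ x) l' → blk (inj₁ i) m ≡ blk (inj₂ x) m' → ⊥
  old-fibre i x {l' = suc s} {suc t} h e e' = transversal i h (trans (cong proj₁ (inj₂-injective e)) (sym (cong proj₁ (inj₂-injective e'))))

  lin : ∀ i i' {l m l' m'} → l ≢ m → blk i l ≡ blk i' l' → blk i m ≡ blk i' m' → i ≡ i'
  lin (inj₁ i) (inj₁ i') h e e' = cong inj₁ (linear h (inj₂-injective e) (inj₂-injective e'))
  lin (inj₁ i) (inj₂ x) h e e' = ⊥-elim (old-fibre i x h e e')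
  lin (inj₂ x) (inj₁ i) {l} {m} {l'} {m'} h e e' = ⊥-elim (old-fibre i x (λ { refl → tr (inj₂ x) h (trans e (sym e')) }) (sym e) (sym e'))
  lin (inj₂ x) (inj₂ y) {zero} {zero} h e e' = contradiction refl h
  lin (inj₂ x) (inj₂ y) {suc s} {_} {suc t} h e e' = cong inj₂ (cong proj₁ (inj₂-injective e))
  lin (inj₂ x) (inj₂ y) {zero} {suc s} {_} {suc t} h e e' = cong inj₂ (cong proj₁ (inj₂-injective e'))

  completion : Design (suc k) X _≡_ (I ⊎ Fin N)
  completion = record { blk = blk ; transversal = tr ; linear = λ {i} {i'} → lin i i' }

Packing-projective : ∀ {k N b} n → suc (N * k) ≤ n → Design (suc k) (Fin N × Fin k) Fibre (Fin b) → Packing (suc k) n (b + N)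
Packing-projective {k} {N} n h D = Design-map (λ x → Fin.inject≤ (f x) h) (λ e → f-inj _ _ (Fin.inject≤-injective h h _ _ e)) (λ e → f-inj _ _ (Fin.inject≤-injective h h _ _ e))
  (Design-reindex (Sized-⊎ Sized-Fin Sized-Fin) (Completion.completion D))
  where
  f : ⊤ ⊎ (Fin N × Fin k) → Fin (suc (N * k))
  f (inj₁ _) = zero
  f (inj₂ (x , s)) = suc (Fin.combine x s)
  f-inj : ∀ x y → f x ≡ f y → x ≡ y
  f-inj (inj₁ _) (inj₁ _) e = refl
  f-inj (inj₂ _) (inj₂ _) e = cong inj₂ (combine-injective (Fin.suc-injective e))

-- The hypotheses on M are Johnson's bound for packings on v = n + 1 - k points.
BeatsJohnson : ℕ → ℕ → ℕ → Set
BeatsJohnson k n b = ∀ v D M → v + k ≡ suc n → k * D < v → suc k * M ≤ v * D → 2 + M ≤ b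

large-packing : ∀ k → 2 ≤ k → ∀ K → ∃ λ N* → ∀ n → N* ≤ n → ∃ λ b → Packing (suc k) n b × BeatsJohnson k n b × K * n ≤ b
large-packing k 2≤k K = start (near-perfect k 1≤k)
  where
  w = suc k
  1≤k : 1 ≤ k
  1≤k = ≤-trans (s≤s z≤n) 2≤k
  instance
    k≢0 : NonZero k
    k≢0 = >-nonZero 1≤k
  start : (∃ λ N₁ → ∀ N → N₁ ≤ N → ∃ λ f → GDD k N f × 4 * f ≤ N) → ∃ λ N* → ∀ n → N* ≤ n → ∃ λ b → Packing (suc k) n b × BeatsJohnson k n b × K * n ≤ b
  start (N₁ , near) = suc (T * k) , main
    where
    T = N₁ + (2 * (w * K) + 4 * w)
    main : ∀ n → suc (T * k) ≤ n → ∃ λ b → Packing (suc k) n b × BeatsJohnson k n b × K * n ≤ b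
    -- There are n + 1 = (a + 1) + N * k points. N groups with a point at infinity always fit, and N
    -- + 1 groups fit exactly when a + 1 = k.
    main (suc n) (s≤s Tk≤n) = cases (suc (n % k) <? k)
      where
      N = n / k
      a = n % k
      n≡ : n ≡ a + N * k
      n≡ = m≡m%n+[m/n]*n n k
      T≤N : T ≤ N
      T≤N = ≤-trans (≤-reflexive (sym (m*n/n≡m T k))) (/-monoˡ-≤ k Tk≤n)
      N₁≤N : N₁ ≤ N
      N₁≤N = ≤-trans (m≤m+n N₁ _) T≤N
      2wK≤N : 2 * (w * K) ≤ N
      2wK≤N = ≤-trans (≤-trans (m≤m+n (2 * (w * K)) (4 * w)) (m≤n+m _ N₁)) T≤N
      4w≤N : 4 * w ≤ N
      4w≤N = ≤-trans (≤-trans (m≤n+m (4 * w) (2 * (w * K))) (m≤n+m _ N₁)) T≤N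
      1≤N : 1 ≤ N
      1≤N = ≤-trans (s≤s z≤n) 4w≤N
      a<k : a < k
      a<k = m%n<n n k
      Goal = ∃ λ b → Packing (suc k) (suc n) b × BeatsJohnson k (suc n) b × K * suc n ≤ b
      few : ∀ {f} → 4 * f ≤ N → f ≤ N
      few {f} h = ≤-trans (m≤n*m f 4) h
      projective : suc a < k → (∃ λ f → GDD k N f × 4 * f ≤ N) → Goal
      projective a+1<k (f , gdd b D hb , hf) = b + N , Packing-projective (suc n) (s≤s (≤-trans (m≤n+m (N * k) a) (≤-reflexive (sym n≡)))) D , beats , enough
        where
        size : k * (N * N) ≤ w * (b + N)
        size = +-cancelʳ-≤ N _ _ (begin
          k * (N * N) + N ≤⟨ +-monoˡ-≤ N hb ⟩
          w * b + f + k * N + N ≤⟨ +-monoˡ-≤ N (+-monoˡ-≤ (k * N) (+-monoʳ-≤ (w * b) (few hf))) ⟩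
          w * b + N + k * N + N ≡⟨ lem k b N ⟩
          w * (b + N) + N ∎)
          where
          open ≤-Reasoning
          lem : ∀ k b N → suc k * b + N + k * N + N ≡ suc k * (b + N) + N
          lem = ℕ-Ring.solve-∀
        beats : BeatsJohnson k (suc n) (b + N)
        beats v D M v+k kD<v hM = *-cancelˡ-≤ w (begin
          w * (2 + M) ≡⟨ *-distribˡ-+ w 2 M ⟩
          w * 2 + w * M ≤⟨ +-mono-≤ 2w≤ (≤-trans hM (*-monoˡ-≤ D v≤)) ⟩
          k * N + k * N * D ≡⟨ lem k N D ⟩
          k * (N * suc D) ≤⟨ *-monoʳ-≤ k (*-monoʳ-≤ N D<N) ⟩
          k * (N * N) ≤⟨ size ⟩
          w * (b + N) ∎)
          where
          open ≤-Reasoning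
          lem : ∀ k N D → k * N + k * N * D ≡ k * (N * suc D)
          lem = ℕ-Ring.solve-∀
          v≤ : v ≤ k * N
          v≤ = +-cancelʳ-≤ k v (k * N) (≤-trans (≤-reflexive v+k) (≤-trans (s≤s (s≤s (≤-reflexive n≡))) (≤-trans (+-monoˡ-≤ (N * k) a+1<k) (≤-reflexive (trans (+-comm k (N * k)) (cong (λ z → z + k) (*-comm N k)))))))
          D<N : D < N
          D<N = *-cancelˡ-< k D N (<-≤-trans kD<v v≤)
          2w≤ : w * 2 ≤ k * N
          2w≤ = ≤-trans (≤-trans (*-monoʳ-≤ w (s≤s (s≤s (z≤n {2})))) (≤-trans (≤-reflexive (*-comm w 4)) 4w≤N)) (m≤n*m N k)
        enough : K * suc n ≤ b + N
        enough = *-cancelˡ-≤ w (begin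
          w * (K * suc n) ≤⟨ *-monoʳ-≤ w (*-monoʳ-≤ K n≤) ⟩
          w * (K * (2 * (k * N))) ≡⟨ lem w K k N ⟩
          k * (2 * (w * K) * N) ≤⟨ *-monoʳ-≤ k (*-monoˡ-≤ N 2wK≤N) ⟩
          k * (N * N) ≤⟨ size ⟩
          w * (b + N) ∎)
          where
          open ≤-Reasoning
          lem : ∀ w K k N → w * (K * (2 * (k * N))) ≡ k * (2 * (w * K) * N)
          lem = ℕ-Ring.solve-∀
          n≤ : suc n ≤ 2 * (k * N)
          n≤ = ≤-trans (s≤s (≤-reflexive n≡)) (≤-trans (+-monoˡ-≤ (N * k) (≤-trans a<k (m≤m*n k N {{>-nonZero 1≤N}}))) (≤-reflexive (cong (λ z → k * N + z) (trans (*-comm N k) (sym (+-identityʳ (k * N)))))))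
      -- Here Johnson's bound is (k * N + 1) * N / (k + 1), just what N groups with a point at
      -- infinity could reach at best. Using N + 1 groups instead gains ((k - 1) * N - f) / (k + 1),
      -- so f has to stay well below N.
      affine : suc a ≡ k → (∃ λ f → GDD k (suc N) f × 4 * f ≤ suc N) → Goal
      affine a+1≡k (f , gdd b D hb , hf) = b , Packing-affine (suc n) (≤-reflexive (sym n+1≡)) D , beats , enough
        where
        n+1≡ : suc n ≡ suc N * k
        n+1≡ = trans (cong suc n≡) (cong (λ z → z + N * k) a+1≡k)
        size : k * (suc N * N) ≤ w * b + f
        size = +-cancelʳ-≤ (k * suc N) _ _ (≤-trans (≤-reflexive (lem k N)) hb)
          where
          lem : ∀ k N → k * (suc N * N) + k * suc N ≡ k * (suc N * suc N)
          lem = ℕ-Ring.solve-∀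
        room : 2 * w + f ≤ N
        room = *-cancelˡ-≤ 4 (begin
          4 * (2 * w + f) ≡⟨ *-distribˡ-+ 4 (2 * w) f ⟩
          4 * (2 * w) + 4 * f ≤⟨ +-monoʳ-≤ (4 * (2 * w)) hf ⟩
          4 * (2 * w) + suc N ≡⟨ lem w N ⟩
          1 + 2 * (4 * w) + N ≤⟨ +-monoˡ-≤ N (+-mono-≤ 1≤N (*-monoʳ-≤ 2 4w≤N)) ⟩
          N + 2 * N + N ≡⟨ lem2 N ⟩
          4 * N ∎)
          where
          open ≤-Reasoning
          lem : ∀ w N → 4 * (2 * w) + suc N ≡ 1 + 2 * (4 * w) + N
          lem = ℕ-Ring.solve-∀
          lem2 : ∀ N → N + 2 * N + N ≡ 4 * N
          lem2 = ℕ-Ring.solve-∀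
        beats : BeatsJohnson k (suc n) b
        beats v D M v+k kD<v hM = *-cancelˡ-≤ w (+-cancelʳ-≤ f _ _ (begin
          w * (2 + M) + f ≡⟨ l1 k M f ⟩
          2 * w + f + w * M ≤⟨ +-mono-≤ room (≤-trans hM (*-mono-≤ (≤-reflexive v≡) D≤N)) ⟩
          N + suc (k * N) * N ≡⟨ l2 k N ⟩
          k * (N * N) + 2 * N ≤⟨ +-monoʳ-≤ (k * (N * N)) (*-monoˡ-≤ N 2≤k) ⟩
          k * (N * N) + k * N ≡⟨ l3 k N ⟩
          k * (suc N * N) ≤⟨ size ⟩
          w * b + f ∎))
          where
          open ≤-Reasoning
          l1 : ∀ k M f → suc k * (2 + M) + f ≡ 2 * suc k + f + suc k * M
          l1 = ℕ-Ring.solve-∀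
          l2 : ∀ k N → N + suc (k * N) * N ≡ k * (N * N) + 2 * N
          l2 = ℕ-Ring.solve-∀
          l3 : ∀ k N → k * (N * N) + k * N ≡ k * (suc N * N)
          l3 = ℕ-Ring.solve-∀
          v≡ : v ≡ suc (k * N)
          v≡ = +-cancelʳ-≡ k v (suc (k * N)) (trans v+k (cong suc (trans n+1≡ (trans (+-comm k (N * k)) (cong (λ z → z + k) (*-comm N k))))))
          D≤N : D ≤ N
          D≤N = *-cancelˡ-≤ k (s≤s⁻¹ (≤-trans kD<v (≤-reflexive v≡)))
        enough : K * suc n ≤ b
        enough = *-cancelˡ-≤ w (+-cancelʳ-≤ f _ _ (begin
          w * (K * suc n) + f ≤⟨ +-mono-≤ (≤-reflexive (cong (λ z → w * (K * z)) n+1≡)) (≤-trans (m≤n*m f 4) (≤-trans hf (m≤m*n (suc N) k))) ⟩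
          w * (K * (suc N * k)) + suc N * k ≡⟨ l1 w K N k ⟩
          k * (suc N * (w * K + 1)) ≤⟨ *-monoʳ-≤ k (*-monoʳ-≤ (suc N) wK+1≤N) ⟩
          k * (suc N * N) ≤⟨ size ⟩
          w * b + f ∎))
          where
          open ≤-Reasoning
          l1 : ∀ w K N k → w * (K * (suc N * k)) + suc N * k ≡ k * (suc N * (w * K + 1))
          l1 = ℕ-Ring.solve-∀
          wK+1≤N : w * K + 1 ≤ N
          wK+1≤N = ≤-trans (+-mono-≤ (m≤n*m (w * K) 2) (s≤s (z≤n {k + 3 * w}))) (≤-trans (m≤n+m (2 * (w * K) + 4 * w) N₁) T≤N)
      cases : Dec (suc a < k) → Goal
      cases (yes h) = projective h (near N N₁≤N)
      cases (no ¬h) = affine (≤-antisym a<k (≮⇒≥ ¬h)) (near (suc N) (≤-trans N₁≤N (n≤1+n N)))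

constant-weight : ∀ k → 2 ≤ k → ∃ λ N → 0 < N × (∀ n → N ≤ n → ∀ (C : Code n) → Optimal C (2 * k) (2 * k + 2) → ∃ λ y → All (λ x → wt (x ⊕ y) ≡ suc k) (words C))
constant-weight k 2≤k = start (large-packing k 2≤k K)
  where
  0<k : 0 < k
  0<k = ≤-trans (s≤s z≤n) 2≤k
  Y = 2 ^ (2 * k + 2)
  -- The first summand makes the code large enough for `popular-centre` with bound (3 * k + 3) * n.
  -- The second gives the packing more than 1 + (k + 1) * n blocks, so that both distances occur in
  -- its code.
  K = Y * (3 * k + 5) + (k + 4)
  start : (∃ λ N* → ∀ n → N* ≤ n → ∃ λ b → Packing (suc k) n b × BeatsJohnson k n b × K * n ≤ b) →
    ∃ λ N → 0 < N × (∀ n → N ≤ n → ∀ (C : Code n) → Optimal C (2 * k) (2 * k + 2) → ∃ λ y → All (λ x → wt (x ⊕ y) ≡ suc k) (words C))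
  start (N* , packing) = suc (N* + k) , s≤s z≤n , λ n N≤n C opt → main n N≤n C opt (packing n (≤-trans (m≤m+n N* k) (≤-trans (n≤1+n _) N≤n)))
    where
    main : ∀ n → suc (N* + k) ≤ n → (C : Code n) → Optimal C (2 * k) (2 * k + 2) → (∃ λ b → Packing (suc k) n b × BeatsJohnson k n b × K * n ≤ b) → ∃ λ y → All (λ x → wt (x ⊕ y) ≡ suc k) (words C)
    main n N≤n C ((H , _ , x₀ , x₁ , x₀∈ , x₁∈ , _ , d) , best) (b , D , beats , Kn≤b) =
      go (popular-centre ((3 * k + 3) * n) x₀ x₁ x₀∈ x₁∈ d big)
      where
      L = words C
      open Structure {n} {k} 0<k L (Code.unique C) H
      1≤n : 1 ≤ n
      1≤n = ≤-trans (s≤s z≤n) N≤n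
      k≤n : k ≤ n
      k≤n = ≤-trans (≤-trans (m≤n+m k N*) (n≤1+n _)) N≤n
      many : 1 + suc k * n < b
      many = ≤-trans (≤-trans (≤-trans (+-monoˡ-≤ (suc k * n) (+-mono-≤ 1≤n (≤-trans 1≤n (m≤m+n n n)))) (≤-reflexive (lem k n))) (*-monoˡ-≤ n (m≤n+m (k + 4) (Y * (3 * k + 5))))) Kn≤b
        where
        lem : ∀ k n → n + (n + n) + suc k * n ≡ (k + 4) * n
        lem = ℕ-Ring.solve-∀
      module PC = PackingCode D many
      b≤L : b ≤ length L
      b≤L = ≤-trans (≤-reflexive (sym (PC.code-size 0<k))) (best (PC.code 0<k) (PC.code-distances 0<k))
      big : Y * (1 + n + (3 * k + 3) * n) < length L
      big = <-≤-trans (≤-<-trans (*-monoʳ-≤ Y (≤-trans (+-monoˡ-≤ ((3 * k + 3) * n) (+-monoˡ-≤ n 1≤n)) (≤-reflexive (lem k n)))) (≤-<-trans (≤-reflexive (sym (*-assoc Y (3 * k + 5) n)))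
        (≤-trans (≤-trans (≤-reflexive (+-comm 1 _)) (+-monoʳ-≤ (Y * (3 * k + 5) * n) (≤-trans 1≤n (m≤n*m n (k + 4) {{>-nonZero (≤-trans (s≤s z≤n) (m≤n+m 4 k))}})))) (≤-reflexive (sym (*-distribʳ-+ n (Y * (3 * k + 5)) (k + 4))))))) (≤-trans Kn≤b b≤L)
        where
        lem : ∀ k n → n + n + (3 * k + 3) * n ≡ (3 * k + 5) * n
        lem = ℕ-Ring.solve-∀
      go : (∃ λ y → (3 * k + 3) * n < countₗ (TwoDistance.Centre.beyond? L (Code.unique C) H y) L) → ∃ λ y → All (λ x → wt (x ⊕ y) ≡ suc k) L
      go (y , many') = [ (λ all → y , all) , (λ (z , z∈ , rz) → ⊥-elim (deep z z∈ rz)) ]′ constant-or-deep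
        where
        open Popular y many'
        deep : ∀ z → z ∈ L → suc (wt (z ⊕ y)) ≡ k → ⊥
        deep z z∈ rz = <⇒≱ (≤-<-trans L≤1+F (beats v D' F v+k kD'<v (johnson D' v maxD v+k))) b≤L
          where
          open Deep z z∈ rz
          instance
            k≢0 : NonZero k
            k≢0 = >-nonZero 0<k
          -- The words through a coordinate off z use k further coordinates each, all different from
          -- that coordinate and from the k - 1 coordinates of z. Hence k * d + k ≤ n for their
          -- number d.
          D' = (n ∸ k) / k
          v = suc (n ∸ k)
          v+k : v + k ≡ suc n
          v+k = cong suc (m∸n+n≡m k≤n)
          kD'<v : k * D' < v
          kD'<v = s≤s (≤-trans (≤-reflexive (*-comm k D')) (m/n*n≤m (n ∸ k) k))
          maxD : ∀ d → k * d + k ≤ n → d ≤ D'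
          maxD d h = ≤-trans (≤-reflexive (sym (m*n/n≡m d k))) (/-monoˡ-≤ k (≤-trans (≤-reflexive (*-comm d k)) (≤-trans (≤-reflexive (sym (m+n∸n≡m (k * d) k))) (∸-monoˡ-≤ k h))))

theorem2 : ∀ (d : ℕ) → (∃ λ k → d ≡ 2 * k) → 2 < d →
    ∃ λ (N : ℕ) → 0 < N ×
    (∀ (n : ℕ) → N ≤ n → ∀ (C : Code n) → Optimal C d (d + 2) →
    ∃ λ (y : Word n) → All (λ x → wt (x ⊕ y) ≡ d / 2 + 1) (words C))
theorem2 d (k , refl) 2<d = finish (constant-weight k (*-cancelˡ-< 2 1 k 2<d))
  where
  weight : suc k ≡ 2 * k / 2 + 1
  weight = trans (+-comm 1 k) (cong (λ z → z + 1) (sym (trans (cong (_/ 2) (*-comm 2 k)) (m*n/n≡m k 2))))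
  finish : (∃ λ N → 0 < N × (∀ n → N ≤ n → ∀ (C : Code n) → Optimal C (2 * k) (2 * k + 2) → ∃ λ y → All (λ x → wt (x ⊕ y) ≡ suc k) (words C))) →
    ∃ λ N → 0 < N × (∀ n → N ≤ n → ∀ (C : Code n) → Optimal C (2 * k) (2 * k + 2) → ∃ λ y → All (λ x → wt (x ⊕ y) ≡ 2 * k / 2 + 1) (words C))
  finish (N , 0<N , h) = N , 0<N , λ n N≤n C opt → let (y , all) = h n N≤n C opt in y , All.map (λ e → trans e weight) all
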